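{- For all $k\geq 2$, $$\sum_{n\geq0}I^e_{2134\cdots k}(n)\,x^n=\sum_{j=0}^{k-3}\left(x^j\Bigl(1+x^2R^e_{k-1-j}(x^2)\,F_{k-j}(x)\Bigr)\prod_{i=k-j}^{k}R_i(-x^2)\right)+x^{k-2}R_2(x)\prod_{j=3}^{k}R_j(-x^2),$$ where $F_m(x)=\dfrac{1}{x\,U_m\!\left(\frac{1}{2x}\right)}\sum_{j=0}^{m-1}U_j\!\left(\frac{1}{2x}\right)$.
   Context: $2134\cdots k$ denotes the permutation $(2,1,3,4,\dots,k)$ of length $k$ (for $k=2$ it is $21$). For a pattern $\tau$, $I^e_\tau(n)$ is the number of even involutions $\pi\in\mathfrak{S}_n$ (i.e. $\pi=\pi^{ -1}$ with an even number of inversions, an inversion being a pair $i<j$ with $\pi_i>\pi_j$) avoiding both $132$ and $\tau$ (avoiding meaning no subsequence order-isomorphic to the pattern); $I^e_\tau(0)=1$. $U_r$ is the Chebyshev polynomial of the second kind ($U_0=1$, $U_1(t)=2t$, $U_r(t)=2tU_{r-1}(t)-U_{r-2}(t)$). For $k\geq1$, $R_k(x)=\dfrac{U_{k-1}\left(\frac{1}{2\sqrt{x}}\right)}{\sqrt{x}\,U_k\left(\frac{1}{2\sqrt{x}}\right)}$ (rational in $x$; $R_1=1$, $R_k=1/(1-xR_{k-1})$), and $R^e_k(x)=\tfrac12(R_k(x)+R_k(-x))$. Identities are of power series in $x$. -}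

module Defs where

open import Data.Bool using (Bool; true; false; not; _∧_; if_then_else_)
open import Data.Nat as ℕ using (ℕ; zero; suc; _∸_; _≡ᵇ_; _<ᵇ_)
open import Data.Nat.DivMod using (_/_; _%_)
open import Data.Integer as ℤ using (ℤ; +_; -_)
open import Data.List using (List; []; _∷_; [_]; _++_; map; foldr; length; concatMap; upTo)
open import Data.Bool.ListAction using (all; any)
open import Data.Nat.ListAction using (sum)

-- Words / permutations (one-line notation, 0-based values)

-- entry at position i (0-based); default 0 outside the word
at : List ℕ → ℕ → ℕ
at []       _       = 0
at (x ∷ xs) zero    = x
at (x ∷ xs) (suc i) = at xs i

allWords : ℕ → ℕ → List (List ℕ)
allWords m zero    = [ [] ]
allWords m (suc n) = concatMap (λ a → map (a ∷_) (allWords m n)) (upTo m)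

count : {A : Set} → (A → Bool) → List A → ℕ
count p []       = 0
count p (x ∷ xs) = if p x then suc (count p xs) else count p xs

-- a word of length n over {0..n-1} is a permutation of S_n iff every value occurs
isPerm : ℕ → List ℕ → Bool
isPerm n w = all (λ v → any (v ≡ᵇ_) w) (upTo n)

perms : ℕ → List (List ℕ)
perms n = Data.List.filterᵇ (isPerm n) (allWords n n)
  where import Data.List

isInvolution : List ℕ → Bool
isInvolution w = all (λ i → at w (at w i) ≡ᵇ i) (upTo (length w))

numInversions : List ℕ → ℕ
numInversions w =
  sum (map (λ i → count (λ j → (i <ᵇ j) ∧ (at w j <ᵇ at w i)) (upTo (length w)))
                     (upTo (length w)))
  where import Data.List

isEven : ℕ → Bool
isEven n = n % 2 ≡ᵇ 0

subseqs : List ℕ → List (List ℕ)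
subseqs []       = [ [] ]
subseqs (x ∷ xs) = map (x ∷_) (subseqs xs) ++ subseqs xs

orderIso : List ℕ → List ℕ → Bool
orderIso p s = (length s ≡ᵇ length p) ∧
  all (λ i → all (λ j → eqB (at s i <ᵇ at s j) (at p i <ᵇ at p j)) (upTo (length p)))
      (upTo (length p))
  where
  eqB : Bool → Bool → Bool
  eqB true  b = b
  eqB false b = not b

contains : List ℕ → List ℕ → Bool
contains w p = any (orderIso p) (subseqs w)

avoids : List ℕ → List ℕ → Bool
avoids w p = not (contains w p)

p132 : List ℕ
p132 = 0 ∷ 2 ∷ 1 ∷ []

p2134 : ℕ → List ℕ
p2134 k = 1 ∷ 0 ∷ map (λ t → 2 ℕ.+ t) (upTo (k ∸ 2))

Ie : List ℕ → ℕ → ℕ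
Ie τ n = count (λ π → isInvolution π ∧ isEven (numInversions π) ∧ avoids π p132 ∧ avoids π τ)
               (perms n)

Series : Set
Series = ℕ → ℤ

sumℤ : List ℤ → ℤ
sumℤ = foldr ℤ._+_ (+ 0)

one : Series
one zero    = + 1
one (suc _) = + 0

X : Series
X 1 = + 1
X _ = + 0

_⊕_ : Series → Series → Series
(a ⊕ b) n = a n ℤ.+ b n

⊖_ : Series → Series
(⊖ a) n = - a n

_⊛_ : Series → Series → Series
(a ⊛ b) n = sumℤ (map (λ i → a i ℤ.* b (n ∸ i)) (upTo (suc n)))

infixl 6 _⊕_
infixl 7 _⊛_

_^ˢ_ : Series → ℕ → Series
a ^ˢ zero  = one
a ^ˢ suc m = a ⊛ (a ^ˢ m)

-- 1/(1-g) = Σ_m g^m  (for g with zero constant term)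
geom : Series → Series
geom g n = sumℤ (map (λ m → (g ^ˢ m) n) (upTo (suc n)))

-- multiplicative inverse of a series with constant term 1
inv : Series → Series
inv f = geom (one ⊕ (⊖ f))

prodS : List Series → Series
prodS = foldr _⊛_ one

sumS : List Series → Series
sumS = foldr _⊕_ (λ _ → + 0)

substSq : ℤ → Series → Series
substSq c a n = if isEven n then (c ℤ.^ (n / 2)) ℤ.* a (n / 2) else + 0

evenPart : Series → Series
evenPart a n = if isEven n then a n else + 0

-- Chebyshev polynomials, normalised.
-- Q m is the polynomial with  Q_m(x²) = x^m U_m(1/(2x))  (equivalently
-- Q_m(x) = √x^m U_m(1/(2√x))). From U_m = 2tU_{m-1} - U_{m-2}:
-- Q_0 = 1, Q_1 = 1, Q_m = Q_{m-1} - x Q_{m-2}.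
Q : ℕ → Series
Q zero          = one
Q (suc zero)    = one
Q (suc (suc m)) = Q (suc m) ⊕ (⊖ (X ⊛ Q m))

-- R_k(x) = U_{k-1}(1/(2√x)) / (√x U_k(1/(2√x))) = Q_{k-1}(x)/Q_k(x)
R : ℕ → Series
R k = Q (k ∸ 1) ⊛ inv (Q k)

Re : ℕ → Series
Re k = evenPart (R k)

-- F_m(x) = (1/(x U_m(1/(2x)))) Σ_{j<m} U_j(1/(2x))
--        = (Σ_{j<m} x^{m-1-j} · x^j U_j(1/(2x))) / (x^m U_m(1/(2x)))
F : ℕ → Series
F m = sumS (map (λ j → (X ^ˢ (m ∸ 1 ∸ j)) ⊛ substSq (+ 1) (Q j)) (upTo m))
      ⊛ inv (substSq (+ 1) (Q m))

rhs : ℕ → Series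
rhs k =
  sumS (map (λ j →
        (X ^ˢ j) ⊛ (one ⊕ (X ^ˢ 2) ⊛ substSq (+ 1) (Re (k ∸ 1 ∸ j)) ⊛ F (k ∸ j))
        ⊛ prodS (map (λ t → substSq (- + 1) (R (k ∸ j ℕ.+ t))) (upTo (suc j))))
     (upTo (k ∸ 2)))
  ⊕ (X ^ˢ (k ∸ 2)) ⊛ R 2 ⊛ prodS (map (λ t → substSq (- + 1) (R (3 ℕ.+ t))) (upTo (k ∸ 2)))

-- A 132-avoiding permutation factors at its maximum as (A, n, B) with every letter of A above every letter
-- of B, so such permutations are binary trees; listing the left-hand parts along the right spine, inversion
-- reverses the list and inverts its members.  Hence the involutions are the twisted palindromes: the empty
-- one, (A, n) with A an involution, or (A, n, M, A⁻¹, j) with M an involution and |A| = j − 1.  In the last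
-- case the number of inversions has the parity of inv M + j, and for k ≥ 3 avoiding 2134⋯k means that A
-- avoids 2134⋯(k−1) and M avoids 2134⋯k.  The generating functions P of the avoiding permutations, T of all
-- avoiding involutions and E of the even ones therefore satisfy
--   Pₖ = 1 + x Pₖ₋₁ Pₖ,   Tₖ = 1 + x Tₖ₋₁ + x² Pₖ₋₁(x²) Tₖ,
--   Eₖ + x² Pₖ₋₁(−x²) Eₖ = 1 + x Eₖ₋₁ + x² Pᵉₖ₋₁(x²) Tₖ,
-- the same recurrences as Rₖ, Fₖ and the right-hand side of the theorem.

module Submission where

open import Defs
open import Algebra.Bundles using (CommutativeSemiring)
import Algebra.Properties.AbelianGroup
open import Data.Bool using (Bool; true; false; not; _∧_; if_then_else_; _xor_; T; T?)
open import Data.Bool.ListAction using (all; any)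
import Data.Bool.Properties as Boolₚ
open import Data.Empty using (⊥; ⊥-elim)
open import Data.Integer as ℤ using (ℤ; +_; -_)
import Data.Integer.Properties as ℤₚ
open import Data.Integer.Tactic.RingSolver using (solve-∀)
open import Data.List using (List; []; _∷_; map; upTo; length; _++_; _∷ʳ_; concatMap; cartesianProductWith)
open import Data.List.Membership.Propositional using (_∈_; _∉_; find)
import Data.List.Membership.Propositional.Properties as ∈ₚ
import Data.List.Properties as Listₚ
open import Data.List.Relation.Binary.Sublist.Propositional
  using (_⊆_; []; _∷_; ⊆-refl; ⊆-trans; minimum) renaming (_∷ʳ_ to _∷ⁿ_)
import Data.List.Relation.Binary.Sublist.Propositional.Properties as ⊆ₚ
open import Data.List.Relation.Unary.All as All using ([]; _∷_)
import Data.List.Relation.Unary.All.Properties as Allₚ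
open import Data.List.Relation.Unary.AllPairs using ([]; _∷_)
open import Data.List.Relation.Unary.Any as Any using (here; there)
open import Data.List.Relation.Unary.Unique.Propositional using (Unique)
import Data.List.Relation.Unary.Unique.Propositional.Properties as Uniqueₚ
open import Data.Nat as ℕ using (ℕ; zero; suc; _≤_; _<_; z≤n; s≤s; _∸_; _<ᵇ_; _≡ᵇ_)
open import Data.Nat.DivMod using (_/_; m/n≤m; m/n≡1+[m∸n]/n)
open import Data.Nat.ListAction using (sum)
import Data.Nat.Properties as ℕₚ
open import Data.List.Membership.DecPropositional ℕₚ._≟_ using (_∈?_)
open import Data.Nat.Tactic.RingSolver using () renaming (solve-∀ to solveℕ-∀)
open import Data.Product using (_,_; _×_; proj₁; proj₂; ∃; ∃₂)
open import Data.Sum using (_⊎_; inj₁; inj₂)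
open import Data.Unit using (tt)
open import Function using (_∘_; id)
import Relation.Binary.Reasoning.Setoid
open import Relation.Binary.PropositionalEquality
open import Relation.Nullary using (¬_; yes; no)

-- The blocks A and A⁻¹ have equally many inversions and meet M in equally many, so modulo 2 only
-- the inversions of M and the j² pairs between the two blocks remain, and j² has the parity of j =
-- |A| + 1. An even |A| therefore asks for an odd M, counted by Tₖ - Eₖ, and an odd |A| for an even
-- M, counted by Eₖ. Adding (-1)^|A| Eₖ gives Tₖ in the first case and 0 in the second: this is the
-- origin of the term with Pₖ₋₁(-x²) on the left, and the reason why only the even part of Pₖ₋₁
-- survives on the right. The three equations are never solved. Each determines a coefficient from
-- coefficients of lower degree and from the series for k - 1, so counts and coefficients are
-- compared directly, by induction on a bound for the size. For k = 2 the pattern is 21, only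
-- identity permutations remain, and all three series are 1/(1 - x).

module ℤGroup = Algebra.Properties.AbelianGroup ℤₚ.+-0-abelianGroup

-- The semiring of power series

-- Wrapped in a record so that unification can recover `a` and `b` from the type of a proof; the
-- bare pointwise equality mentions them only applied to an index.
record _≈_ (a b : Series) : Set where
  constructor pointwise
  field coeff : ∀ n → a n ≡ b n
open _≈_

infix 4 _≈_

shift : Series → Series
shift a n = a (suc n)

sumℤ-map-upTo-suc : ∀ (f : ℕ → ℤ) n →
  sumℤ (map f (upTo (suc n))) ≡ f 0 ℤ.+ sumℤ (map (f ∘ suc) (upTo n))
sumℤ-map-upTo-suc f n = cong (λ l → f 0 ℤ.+ sumℤ l)
  (trans (Listₚ.map-applyUpTo suc f n) (sym (Listₚ.map-upTo (f ∘ suc) n)))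

⊛-zero : ∀ a b → (a ⊛ b) 0 ≡ a 0 ℤ.* b 0
⊛-zero a b = ℤₚ.+-identityʳ _

-- Splitting off the index 0 leaves the same kind of convolution with the tail of `a`. The semiring
-- laws follow from this by induction on the coefficient, with the series generalised.
⊛-suc : ∀ a b n → (a ⊛ b) (suc n) ≡ a 0 ℤ.* b (suc n) ℤ.+ (shift a ⊛ b) n
⊛-suc a b n = sumℤ-map-upTo-suc (λ i → a i ℤ.* b (suc n ∸ i)) (suc n)

-- Only coefficients up to `n` enter. The bounded hypotheses matter for `geom`, which agrees with a
-- partial sum only up to some degree.
⊛-cong-≤ : ∀ {a b c d} n → (∀ i → i ≤ n → a i ≡ b i) → (∀ i → i ≤ n → c i ≡ d i) →
  (a ⊛ c) n ≡ (b ⊛ d) n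
⊛-cong-≤ zero p q = cong₂ (λ x y → x ℤ.* y ℤ.+ (+ 0)) (p 0 z≤n) (q 0 z≤n)
⊛-cong-≤ {a} {b} {c} {d} (suc n) p q = begin
  (a ⊛ c) (suc n)                        ≡⟨ ⊛-suc a c n ⟩
  a 0 ℤ.* c (suc n) ℤ.+ (shift a ⊛ c) n  ≡⟨ cong₂ ℤ._+_ (cong₂ ℤ._*_ (p 0 z≤n) (q (suc n) ℕₚ.≤-refl))
    (⊛-cong-≤ n (λ i i≤n → p (suc i) (s≤s i≤n)) (λ i i≤n → q i (ℕₚ.m≤n⇒m≤1+n i≤n))) ⟩
  b 0 ℤ.* d (suc n) ℤ.+ (shift b ⊛ d) n  ≡⟨ ⊛-suc b d n ⟨
  (b ⊛ d) (suc n)                        ∎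
  where open ≡-Reasoning

⊛-congˡ-at : ∀ {a b} c n → (∀ i → a i ≡ b i) → (a ⊛ c) n ≡ (b ⊛ c) n
⊛-congˡ-at c n p = ⊛-cong-≤ {c = c} n (λ i _ → p i) (λ i _ → refl)

⊛-distribʳ-at : ∀ a b c n → ((a ⊕ b) ⊛ c) n ≡ (a ⊛ c) n ℤ.+ (b ⊛ c) n
⊛-distribʳ-at a b c zero = lemma (a 0) (b 0) (c 0)
  where
  lemma : ∀ x y z → (x ℤ.+ y) ℤ.* z ℤ.+ (+ 0) ≡ (x ℤ.* z ℤ.+ (+ 0)) ℤ.+ (y ℤ.* z ℤ.+ (+ 0))
  lemma = solve-∀
⊛-distribʳ-at a b c (suc n) rewrite ⊛-suc (a ⊕ b) c n | ⊛-suc a c n | ⊛-suc b c n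
  | ⊛-distribʳ-at (shift a) (shift b) c n = lemma (a 0) (b 0) (c (suc n)) _ _
  where
  lemma : ∀ x y z p q → (x ℤ.+ y) ℤ.* z ℤ.+ (p ℤ.+ q) ≡ (x ℤ.* z ℤ.+ p) ℤ.+ (y ℤ.* z ℤ.+ q)
  lemma = solve-∀

⊛-scaleˡ-at : ∀ x a c n → ((λ i → x ℤ.* a i) ⊛ c) n ≡ x ℤ.* (a ⊛ c) n
⊛-scaleˡ-at x a c zero = lemma x (a 0) (c 0)
  where
  lemma : ∀ x y z → (x ℤ.* y) ℤ.* z ℤ.+ (+ 0) ≡ x ℤ.* (y ℤ.* z ℤ.+ (+ 0))
  lemma = solve-∀
⊛-scaleˡ-at x a c (suc n) rewrite ⊛-suc (λ i → x ℤ.* a i) c n | ⊛-suc a c n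
  | ⊛-scaleˡ-at x (shift a) c n = lemma x (a 0) (c (suc n)) _
  where
  lemma : ∀ x y z p → (x ℤ.* y) ℤ.* z ℤ.+ x ℤ.* p ≡ x ℤ.* (y ℤ.* z ℤ.+ p)
  lemma = solve-∀

⊛-assoc-at : ∀ a b c n → ((a ⊛ b) ⊛ c) n ≡ (a ⊛ (b ⊛ c)) n
⊛-assoc-at a b c zero = lemma (a 0) (b 0) (c 0)
  where
  lemma : ∀ x y z → (x ℤ.* y ℤ.+ (+ 0)) ℤ.* z ℤ.+ (+ 0) ≡ x ℤ.* (y ℤ.* z ℤ.+ (+ 0)) ℤ.+ (+ 0)
  lemma = solve-∀
⊛-assoc-at a b c (suc n) = begin
  ((a ⊛ b) ⊛ c) (suc n)
    ≡⟨ ⊛-suc (a ⊛ b) c n ⟩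
  (a ⊛ b) 0 ℤ.* c (suc n) ℤ.+ (shift (a ⊛ b) ⊛ c) n
    ≡⟨ cong₂ ℤ._+_ (cong (ℤ._* c (suc n)) (⊛-zero a b)) (⊛-congˡ-at c n (⊛-suc a b)) ⟩
  a 0 ℤ.* b 0 ℤ.* c (suc n) ℤ.+ (((λ i → a 0 ℤ.* shift b i) ⊕ (shift a ⊛ b)) ⊛ c) n
    ≡⟨ cong (ℤ._+_ (a 0 ℤ.* b 0 ℤ.* c (suc n))) (⊛-distribʳ-at (λ i → a 0 ℤ.* shift b i) (shift a ⊛ b) c n) ⟩
  a 0 ℤ.* b 0 ℤ.* c (suc n) ℤ.+ (((λ i → a 0 ℤ.* shift b i) ⊛ c) n ℤ.+ ((shift a ⊛ b) ⊛ c) n)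
    ≡⟨ cong (ℤ._+_ (a 0 ℤ.* b 0 ℤ.* c (suc n)))
        (cong₂ ℤ._+_ (⊛-scaleˡ-at (a 0) (shift b) c n) (⊛-assoc-at (shift a) b c n)) ⟩
  a 0 ℤ.* b 0 ℤ.* c (suc n) ℤ.+ (a 0 ℤ.* (shift b ⊛ c) n ℤ.+ (shift a ⊛ (b ⊛ c)) n)
    ≡⟨ lemma (a 0) (b 0) (c (suc n)) _ _ ⟩
  a 0 ℤ.* (b 0 ℤ.* c (suc n) ℤ.+ (shift b ⊛ c) n) ℤ.+ (shift a ⊛ (b ⊛ c)) n
    ≡⟨ cong (λ x → a 0 ℤ.* x ℤ.+ (shift a ⊛ (b ⊛ c)) n) (⊛-suc b c n) ⟨
  a 0 ℤ.* (b ⊛ c) (suc n) ℤ.+ (shift a ⊛ (b ⊛ c)) n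
    ≡⟨ ⊛-suc a (b ⊛ c) n ⟨
  (a ⊛ (b ⊛ c)) (suc n) ∎
  where
  open ≡-Reasoning
  lemma : ∀ x y z p q → x ℤ.* y ℤ.* z ℤ.+ (x ℤ.* p ℤ.+ q) ≡ x ℤ.* (y ℤ.* z ℤ.+ p) ℤ.+ q
  lemma = solve-∀

-- The mirror image of `⊛-suc`, splitting off the last index; commutativity exchanges the two.
⊛-sucʳ : ∀ a b n → (a ⊛ b) (suc n) ≡ (a ⊛ shift b) n ℤ.+ a (suc n) ℤ.* b 0
⊛-sucʳ a b zero = lemma (a 0) (a 1) (b 0) (b 1)
  where
  lemma : ∀ x y z w → x ℤ.* w ℤ.+ (y ℤ.* z ℤ.+ (+ 0)) ≡ (x ℤ.* w ℤ.+ (+ 0)) ℤ.+ y ℤ.* z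
  lemma = solve-∀
⊛-sucʳ a b (suc n) rewrite ⊛-suc a b (suc n) | ⊛-sucʳ (shift a) b n | ⊛-suc a (shift b) n =
  sym (ℤₚ.+-assoc (a 0 ℤ.* b (suc (suc n))) ((shift a ⊛ shift b) n) (a (suc (suc n)) ℤ.* b 0))

⊛-comm-at : ∀ a b n → (a ⊛ b) n ≡ (b ⊛ a) n
⊛-comm-at a b zero = cong (ℤ._+ (+ 0)) (ℤₚ.*-comm (a 0) (b 0))
⊛-comm-at a b (suc n) = begin
  (a ⊛ b) (suc n)
    ≡⟨ ⊛-sucʳ a b n ⟩
  (a ⊛ shift b) n ℤ.+ a (suc n) ℤ.* b 0
    ≡⟨ cong₂ ℤ._+_ (⊛-comm-at a (shift b) n) (ℤₚ.*-comm (a (suc n)) (b 0)) ⟩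
  (shift b ⊛ a) n ℤ.+ b 0 ℤ.* a (suc n)
    ≡⟨ ℤₚ.+-comm _ (b 0 ℤ.* a (suc n)) ⟩
  b 0 ℤ.* a (suc n) ℤ.+ (shift b ⊛ a) n
    ≡⟨ ⊛-suc b a n ⟨
  (b ⊛ a) (suc n) ∎
  where open ≡-Reasoning

0ˢ : Series
0ˢ _ = + 0

0ˢ-⊛-at : ∀ a n → (0ˢ ⊛ a) n ≡ + 0
0ˢ-⊛-at a zero = refl
0ˢ-⊛-at a (suc n) = trans (⊛-suc 0ˢ a n) (trans (ℤₚ.+-identityˡ _) (0ˢ-⊛-at a n))

one-⊛-at : ∀ a n → (one ⊛ a) n ≡ a n
one-⊛-at a zero = trans (ℤₚ.+-identityʳ _) (ℤₚ.*-identityˡ (a 0))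
one-⊛-at a (suc n) = begin
  (one ⊛ a) (suc n)                   ≡⟨ ⊛-suc one a n ⟩
  (+ 1) ℤ.* a (suc n) ℤ.+ (0ˢ ⊛ a) n  ≡⟨ cong₂ ℤ._+_ (ℤₚ.*-identityˡ (a (suc n))) (0ˢ-⊛-at a n) ⟩
  a (suc n) ℤ.+ (+ 0)                 ≡⟨ ℤₚ.+-identityʳ _ ⟩
  a (suc n)                           ∎
  where open ≡-Reasoning

-- Negation is left out, so that the solver works with natural coefficients; the recurrences below
-- accordingly carry negative terms on the opposite side.
seriesSemiring : CommutativeSemiring _ _
seriesSemiring = record
  { Carrier = Series ; _≈_ = _≈_ ; _+_ = _⊕_ ; _*_ = _⊛_ ; 0# = 0ˢ ; 1# = one
  ; isCommutativeSemiring = record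
    { isSemiring = record
      { isSemiringWithoutAnnihilatingZero = record
        { +-isCommutativeMonoid = record
          { isMonoid = record
            { isSemigroup = record
              { isMagma = record
                { isEquivalence = record
                  { refl  = pointwise λ _ → refl
                  ; sym   = λ p → pointwise λ n → sym (coeff p n)
                  ; trans = λ p q → pointwise λ n → trans (coeff p n) (coeff q n) }
                ; ∙-cong = λ p q → pointwise λ n → cong₂ ℤ._+_ (coeff p n) (coeff q n) }
              ; assoc = λ a b c → pointwise λ n → ℤₚ.+-assoc (a n) (b n) (c n) }
            ; identity = (λ a → pointwise λ n → ℤₚ.+-identityˡ (a n))
                       , (λ a → pointwise λ n → ℤₚ.+-identityʳ (a n)) }
          ; comm = λ a b → pointwise λ n → ℤₚ.+-comm (a n) (b n) }
        ; *-cong = λ p q → pointwise λ n → ⊛-cong-≤ n (λ i _ → coeff p i) (λ i _ → coeff q i)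
        ; *-assoc = λ a b c → pointwise (⊛-assoc-at a b c)
        ; *-identity = (λ a → pointwise (one-⊛-at a))
                     , (λ a → pointwise λ n → trans (⊛-comm-at a one n) (one-⊛-at a n))
        ; distrib = (λ a b c → pointwise λ n → trans (⊛-comm-at a (b ⊕ c) n)
                      (trans (⊛-distribʳ-at b c a n) (cong₂ ℤ._+_ (⊛-comm-at b a n) (⊛-comm-at c a n))))
                  , (λ a b c → pointwise (⊛-distribʳ-at b c a)) }
      ; zero = (λ a → pointwise (0ˢ-⊛-at a))
             , (λ a → pointwise λ n → trans (⊛-comm-at a 0ˢ n) (0ˢ-⊛-at a n)) }
    ; *-comm = λ a b → pointwise (⊛-comm-at a b) } }

module S = CommutativeSemiring seriesSemiring
open import Algebra.Solver.Ring.NaturalCoefficients.Default seriesSemiring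
  using (solve; _:=_; _:+_; _:*_; con)
module ≈-Reasoning = Relation.Binary.Reasoning.Setoid S.setoid

⊕-congˡ : ∀ a {b c} → b ≈ c → a ⊕ b ≈ a ⊕ c
⊕-congˡ a {b} {c} = S.+-congˡ {a} {b} {c}

⊕-congʳ : ∀ a {b c} → b ≈ c → b ⊕ a ≈ c ⊕ a
⊕-congʳ a {b} {c} = S.+-congʳ {a} {b} {c}

⊛-congˡ : ∀ a {b c} → b ≈ c → a ⊛ b ≈ a ⊛ c
⊛-congˡ a {b} {c} = S.*-congˡ {a} {b} {c}

⊛-congʳ : ∀ a {b c} → b ≈ c → b ⊛ a ≈ c ⊛ a
⊛-congʳ a {b} {c} = S.*-congʳ {a} {b} {c}

⊖-inverse : ∀ a → a ⊕ (⊖ a) ≈ 0ˢ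
⊖-inverse a = pointwise λ n → ℤₚ.+-inverseʳ (a n)

X-⊛-suc : ∀ a n → (X ⊛ a) (suc n) ≡ a n
X-⊛-suc a n = trans (⊛-suc X a n) (trans (ℤₚ.+-identityˡ _)
  (trans (⊛-congˡ-at a n shiftX) (one-⊛-at a n)))
  where
  shiftX : ∀ i → shift X i ≡ one i
  shiftX zero = refl
  shiftX (suc i) = refl

-- Geometric series and inverses

geomPartial : Series → ℕ → Series
geomPartial g n = sumS (map (g ^ˢ_) (upTo n))

sumS-at : ∀ {A : Set} (f : A → Series) xs n → sumS (map f xs) n ≡ sumℤ (map (λ x → f x n) xs)
sumS-at f []       n = refl
sumS-at f (x ∷ xs) n = cong (ℤ._+_ (f x n)) (sumS-at f xs n)

sumS-∷ʳ : ∀ as b → sumS (as ∷ʳ b) ≈ sumS as ⊕ b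
sumS-∷ʳ []       b = S.+-comm b 0ˢ
sumS-∷ʳ (a ∷ as) b = S.trans (⊕-congˡ a (sumS-∷ʳ as b)) (S.sym (S.+-assoc a (sumS as) b))

sumS-map-upTo-suc : ∀ (f : ℕ → Series) n → sumS (map f (upTo (suc n))) ≈ sumS (map f (upTo n)) ⊕ f n
sumS-map-upTo-suc f n = S.trans
  (S.reflexive (cong sumS (trans (cong (map f) (sym (Listₚ.upTo-∷ʳ n))) (Listₚ.map-++ f (upTo n) _))))
  (sumS-∷ʳ (map f (upTo n)) (f n))

geomPartial-suc : ∀ g n → geomPartial g (suc n) ≈ one ⊕ g ⊛ geomPartial g n
geomPartial-suc g zero    = ⊕-congˡ one (S.sym (S.zeroʳ g))
geomPartial-suc g (suc n) = begin
  geomPartial g (suc (suc n))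
    ≈⟨ sumS-map-upTo-suc (g ^ˢ_) (suc n) ⟩
  geomPartial g (suc n) ⊕ g ⊛ (g ^ˢ n)
    ≈⟨ ⊕-congʳ (g ⊛ (g ^ˢ n)) (geomPartial-suc g n) ⟩
  one ⊕ g ⊛ geomPartial g n ⊕ g ⊛ (g ^ˢ n)
    ≈⟨ solve 3 (λ g p q → con 1 :+ g :* p :+ g :* q := con 1 :+ g :* (p :+ q)) S.refl g (geomPartial g n)
        (g ^ˢ n) ⟩
  one ⊕ g ⊛ (geomPartial g n ⊕ (g ^ˢ n))
    ≈⟨ ⊕-congˡ one (⊛-congˡ g (sumS-map-upTo-suc (g ^ˢ_) n)) ⟨
  one ⊕ g ⊛ geomPartial g (suc n) ∎
  where open ≈-Reasoning

-- A zero constant term makes the power `g ^ˢ m` divisible by xᵐ, so only finitely many powers reach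
-- a given coefficient and `geom` really sums all of them.
^ˢ-vanish : ∀ g → g 0 ≡ + 0 → ∀ m n → n < m → (g ^ˢ m) n ≡ + 0
^ˢ-vanish g g0 (suc m) zero    _         = cong (λ x → x ℤ.* (g ^ˢ m) 0 ℤ.+ (+ 0)) g0
^ˢ-vanish g g0 (suc m) (suc n) (s≤s n<m) =
  trans (⊛-suc g (g ^ˢ m) n) (cong₂ ℤ._+_ (cong (ℤ._* (g ^ˢ m) (suc n)) g0)
    (trans (⊛-cong-≤ {b = shift g} {d = 0ˢ} n (λ _ _ → refl)
        (λ i i≤n → ^ˢ-vanish g g0 m i (ℕₚ.≤-<-trans i≤n n<m)))
           (trans (⊛-comm-at (shift g) 0ˢ n) (0ˢ-⊛-at (shift g) n))))

geomPartial-stable : ∀ g → g 0 ≡ + 0 → ∀ d n → geomPartial g (d ℕ.+ suc n) n ≡ geom g n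
geomPartial-stable g g0 zero    n = sumS-at (g ^ˢ_) (upTo (suc n)) n
geomPartial-stable g g0 (suc d) n = trans (coeff (sumS-map-upTo-suc (g ^ˢ_) (d ℕ.+ suc n)) n)
  (trans (cong (ℤ._+_ (geomPartial g (d ℕ.+ suc n) n)) (^ˢ-vanish g g0 (d ℕ.+ suc n) n (ℕₚ.m≤n+m (suc n) d)))
  (trans (ℤₚ.+-identityʳ _) (geomPartial-stable g g0 d n)))

geomPartial-≡ : ∀ g → g 0 ≡ + 0 → ∀ {m n} → n < m → geomPartial g m n ≡ geom g n
geomPartial-≡ g g0 {m} {n} n<m =
  subst (λ m → geomPartial g m n ≡ geom g n) (ℕₚ.m∸n+n≡m n<m) (geomPartial-stable g g0 (m ∸ suc n) n)

geom-unfold : ∀ g → g 0 ≡ + 0 → geom g ≈ one ⊕ g ⊛ geom g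
geom-unfold g g0 = pointwise λ n →
  -- The partial sum has n + 2 terms, one more than the coefficient needs: after one unfolding n + 1
  -- remain, still enough for every coefficient up to `n`.
  trans (sym (geomPartial-≡ g g0 {suc (suc n)} {n} (ℕₚ.m≤n⇒m≤1+n ℕₚ.≤-refl)))
  (trans (coeff (geomPartial-suc g (suc n)) n)
  (cong (ℤ._+_ (one n)) (⊛-cong-≤ {g} {g} n (λ _ _ → refl) (λ i i≤n → geomPartial-≡ g g0 (s≤s i≤n)))))

-- With g = 1 - f and h = 1/(1 - g) one has h = 1 + g h, so f h = (f + g) h - g h = h - g h = 1. The
-- negated product is carried as an opaque summand past the solver.
inv-inverse : ∀ f → f 0 ≡ + 1 → f ⊛ inv f ≈ one
inv-inverse f f0 = begin
  f ⊛ h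
    ≈⟨ S.+-identityʳ _ ⟨
  f ⊛ h ⊕ 0ˢ
    ≈⟨ ⊕-congˡ (f ⊛ h) (⊖-inverse (g ⊛ h)) ⟨
  f ⊛ h ⊕ (g ⊛ h ⊕ (⊖ (g ⊛ h)))
    ≈⟨ solve 4 (λ f h g k → f :* h :+ (g :* h :+ k) := (f :+ g) :* h :+ k) S.refl f h g (⊖ (g ⊛ h)) ⟩
  (f ⊕ g) ⊛ h ⊕ (⊖ (g ⊛ h))
    ≈⟨ ⊕-congʳ (⊖ (g ⊛ h)) (⊛-congʳ h f+g) ⟩
  one ⊛ h ⊕ (⊖ (g ⊛ h))
    ≈⟨ ⊕-congʳ (⊖ (g ⊛ h)) (S.trans (S.*-identityˡ h) (geom-unfold g g0)) ⟩
  one ⊕ g ⊛ h ⊕ (⊖ (g ⊛ h))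
    ≈⟨ S.+-assoc one (g ⊛ h) (⊖ (g ⊛ h)) ⟩
  one ⊕ (g ⊛ h ⊕ (⊖ (g ⊛ h)))
    ≈⟨ ⊕-congˡ one (⊖-inverse (g ⊛ h)) ⟩
  one ⊕ 0ˢ
    ≈⟨ S.+-identityʳ _ ⟩
  one ∎
  where
  open ≈-Reasoning
  g h : Series
  g = one ⊕ (⊖ f)
  h = inv f
  g0 : g 0 ≡ + 0
  g0 = cong (λ x → (+ 1) ℤ.+ - x) f0
  f+g : f ⊕ g ≈ one
  f+g = pointwise λ n → lemma (f n) (one n)
    where
    lemma : ∀ x y → x ℤ.+ (y ℤ.+ - x) ≡ y
    lemma = solve-∀

⊛-cancelˡ : ∀ f {a b} → f 0 ≡ + 1 → f ⊛ a ≈ f ⊛ b → a ≈ b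
⊛-cancelˡ f {a} {b} f0 eq = begin
  a                ≈⟨ unit a ⟨
  inv f ⊛ (f ⊛ a)  ≈⟨ ⊛-congˡ (inv f) eq ⟩
  inv f ⊛ (f ⊛ b)  ≈⟨ unit b ⟩
  b                ∎
  where
  open ≈-Reasoning
  unit : ∀ c → inv f ⊛ (f ⊛ c) ≈ c
  unit c = begin
    inv f ⊛ (f ⊛ c)  ≈⟨ solve 3 (λ i f c → i :* (f :* c) := (f :* i) :* c) S.refl (inv f) f c ⟩
    f ⊛ inv f ⊛ c    ≈⟨ ⊛-congʳ c (inv-inverse f f0) ⟩
    one ⊛ c          ≈⟨ S.*-identityˡ c ⟩
    c                ∎

⊛-quotient : ∀ f a → f 0 ≡ + 1 → f ⊛ (a ⊛ inv f) ≈ a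
⊛-quotient f a f0 = begin
  f ⊛ (a ⊛ inv f)  ≈⟨ solve 3 (λ f a i → f :* (a :* i) := a :* (f :* i)) S.refl f a (inv f) ⟩
  a ⊛ (f ⊛ inv f)  ≈⟨ ⊛-congˡ a (inv-inverse f f0) ⟩
  a ⊛ one          ≈⟨ S.*-identityʳ a ⟩
  a                ∎
  where open ≈-Reasoning

-- Substitution of c x² for x

half-suc-suc : ∀ n → suc (suc n) / 2 ≡ suc (n / 2)
half-suc-suc n = m/n≡1+[m∸n]/n {suc (suc n)} {2} (s≤s (s≤s z≤n))

-- Two degrees of the substituted series are one degree of `a`; this drives the inductions in steps
-- of two.
substSq-suc-suc : ∀ c a n → substSq c a (suc (suc n)) ≡ c ℤ.* substSq c (shift a) n
substSq-suc-suc c a n with isEven n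
... | false = sym (ℤₚ.*-zeroʳ c)
... | true rewrite half-suc-suc n = ℤₚ.*-assoc c _ _

substSq-pointwise : ∀ c {a b} → (∀ n → a n ≡ b n) → ∀ n → substSq c a n ≡ substSq c b n
substSq-pointwise c p n = cong (λ x → if isEven n then c ℤ.^ (n / 2) ℤ.* x else + 0) (p (n / 2))

substSq-cong : ∀ c {a b} → a ≈ b → substSq c a ≈ substSq c b
substSq-cong c p = pointwise (substSq-pointwise c (coeff p))

substSq-0ˢ-at : ∀ c n → substSq c 0ˢ n ≡ + 0
substSq-0ˢ-at c n with isEven n
... | false = refl
... | true  = ℤₚ.*-zeroʳ (c ℤ.^ (n / 2))

substSq-one-at : ∀ c n → substSq c one n ≡ one n
substSq-one-at c zero          = refl
substSq-one-at c (suc zero)    = refl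
substSq-one-at c (suc (suc n)) = trans (substSq-suc-suc c one n)
  (trans (cong (c ℤ.*_) (substSq-0ˢ-at c n)) (ℤₚ.*-zeroʳ c))

substSq-one : ∀ c → substSq c one ≈ one
substSq-one c = pointwise (substSq-one-at c)

substSq-⊕-at : ∀ c a b n → substSq c (a ⊕ b) n ≡ substSq c a n ℤ.+ substSq c b n
substSq-⊕-at c a b n with isEven n
... | false = refl
... | true  = ℤₚ.*-distribˡ-+ (c ℤ.^ (n / 2)) _ _

substSq-scale-at : ∀ c x a n → substSq c (λ i → x ℤ.* a i) n ≡ x ℤ.* substSq c a n
substSq-scale-at c x a n with isEven n
... | false = sym (ℤₚ.*-zeroʳ x)
... | true  = lemma (c ℤ.^ (n / 2)) x (a (n / 2))
  where
  lemma : ∀ p x y → p ℤ.* (x ℤ.* y) ≡ x ℤ.* (p ℤ.* y)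
  lemma = solve-∀

substSq-⊛-at : ∀ c a b n → substSq c (a ⊛ b) n ≡ (substSq c a ⊛ substSq c b) n
substSq-⊛-at c a b zero = lemma (a 0) (b 0)
  where
  lemma : ∀ x y → (+ 1) ℤ.* (x ℤ.* y ℤ.+ (+ 0)) ≡ ((+ 1) ℤ.* x) ℤ.* ((+ 1) ℤ.* y) ℤ.+ (+ 0)
  lemma = solve-∀
substSq-⊛-at c a b (suc zero) = sym (cong (ℤ._+ (+ 0)) (ℤₚ.*-zeroʳ ((+ 1) ℤ.* a 0)))
substSq-⊛-at c a b (suc (suc n)) = begin
  substSq c (a ⊛ b) (suc (suc n))
    ≡⟨ substSq-suc-suc c (a ⊛ b) n ⟩
  c ℤ.* substSq c (shift (a ⊛ b)) n
    ≡⟨ cong (c ℤ.*_) (substSq-pointwise c {b = (λ i → a 0 ℤ.* shift b i) ⊕ (shift a ⊛ b)} (⊛-suc a b) n) ⟩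
  c ℤ.* substSq c ((λ i → a 0 ℤ.* shift b i) ⊕ (shift a ⊛ b)) n
    ≡⟨ cong (c ℤ.*_) (substSq-⊕-at c (λ i → a 0 ℤ.* shift b i) (shift a ⊛ b) n) ⟩
  c ℤ.* (substSq c (λ i → a 0 ℤ.* shift b i) n ℤ.+ substSq c (shift a ⊛ b) n)
    ≡⟨ cong (c ℤ.*_) (cong₂ ℤ._+_ (substSq-scale-at c (a 0) (shift b) n) (substSq-⊛-at c (shift a) b n)) ⟩
  c ℤ.* (a 0 ℤ.* substSq c (shift b) n ℤ.+ (substSq c (shift a) ⊛ substSq c b) n)
    -- The summand `+ 0` is the term of index 1, whose left factor is an odd coefficient of
    -- `substSq c a`.
    ≡⟨ lemma c (a 0) _ _ ⟩
  (+ 1) ℤ.* a 0 ℤ.* (c ℤ.* substSq c (shift b) n) ℤ.+ ((+ 0) ℤ.+ c ℤ.* (substSq c (shift a) ⊛ substSq c b) n)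
    ≡⟨ cong₂ (λ x y → (+ 1) ℤ.* a 0 ℤ.* x ℤ.+ ((+ 0) ℤ.+ y)) (substSq-suc-suc c b n)
           (trans (⊛-congˡ-at (substSq c b) n (substSq-suc-suc c a))
               (⊛-scaleˡ-at c (substSq c (shift a)) (substSq c b) n)) ⟨
  (+ 1) ℤ.* a 0 ℤ.* substSq c b (suc (suc n)) ℤ.+ ((+ 0) ℤ.+ (shift (shift (substSq c a)) ⊛ substSq c b) n)
    ≡⟨ cong (ℤ._+_ ((+ 1) ℤ.* a 0 ℤ.* substSq c b (suc (suc n))))
        (⊛-suc (shift (substSq c a)) (substSq c b) n) ⟨
  substSq c a 0 ℤ.* substSq c b (suc (suc n)) ℤ.+ (shift (substSq c a) ⊛ substSq c b) (suc n)
    ≡⟨ ⊛-suc (substSq c a) (substSq c b) (suc n) ⟨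
  (substSq c a ⊛ substSq c b) (suc (suc n)) ∎
  where
  open ≡-Reasoning
  lemma : ∀ c x p q → c ℤ.* (x ℤ.* p ℤ.+ q) ≡ (+ 1) ℤ.* x ℤ.* (c ℤ.* p) ℤ.+ ((+ 0) ℤ.+ c ℤ.* q)
  lemma = solve-∀

substSq-⊛ : ∀ c a b → substSq c (a ⊛ b) ≈ substSq c a ⊛ substSq c b
substSq-⊛ c a b = pointwise (substSq-⊛-at c a b)

substSq-⊕ : ∀ c a b → substSq c (a ⊕ b) ≈ substSq c a ⊕ substSq c b
substSq-⊕ c a b = pointwise (substSq-⊕-at c a b)

substSq-X-at : ∀ c n → substSq c X n ≡ c ℤ.* (X ⊛ X) n
substSq-X-at c zero       = sym (ℤₚ.*-zeroʳ c)
substSq-X-at c (suc zero) = sym (ℤₚ.*-zeroʳ c)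
substSq-X-at c (suc (suc n)) = trans (substSq-suc-suc c X n) (cong (c ℤ.*_)
  (trans (trans (substSq-pointwise c {shift X} {one} (λ where zero → refl ; (suc _) → refl) n)
      (coeff (substSq-one c) n))
         (sym (trans (X-⊛-suc X (suc n)) (lemma n)))))
  where
  lemma : ∀ n → X (suc n) ≡ one n
  lemma zero    = refl
  lemma (suc n) = refl

-- Recurrences for R, F and the right-hand side

Q-constant : ∀ m → Q m 0 ≡ + 1
Q-constant zero          = refl
Q-constant (suc zero)    = refl
Q-constant (suc (suc m)) = trans (ℤₚ.+-identityʳ _) (Q-constant (suc m))

Q-recurrence : ∀ m → Q (suc (suc m)) ⊕ X ⊛ Q m ≈ Q (suc m)
Q-recurrence m = begin
  Q (suc m) ⊕ (⊖ (X ⊛ Q m)) ⊕ X ⊛ Q m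
    ≈⟨ solve 3 (λ a b c → a :+ b :+ c := a :+ (c :+ b)) S.refl (Q (suc m)) (⊖ (X ⊛ Q m)) (X ⊛ Q m) ⟩
  Q (suc m) ⊕ (X ⊛ Q m ⊕ (⊖ (X ⊛ Q m)))
    ≈⟨ ⊕-congˡ (Q (suc m)) (⊖-inverse (X ⊛ Q m)) ⟩
  Q (suc m) ⊕ 0ˢ
    ≈⟨ S.+-identityʳ _ ⟩
  Q (suc m) ∎
  where open ≈-Reasoning

Q-R : ∀ k → Q (suc k) ⊛ R (suc k) ≈ Q k
Q-R k = ⊛-quotient (Q (suc k)) (Q k) (Q-constant (suc k))

-- Multiplied by the denominator `q₂`, the claim becomes the three-term recurrence of `Q`, once each
-- numerator is written as its quotient times its denominator.
R-recurrence : ∀ k → R (suc (suc k)) ≈ one ⊕ X ⊛ (R (suc k) ⊛ R (suc (suc k)))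
R-recurrence k = ⊛-cancelˡ q₂ (Q-constant (suc (suc k))) (begin
  q₂ ⊛ r₂
    ≈⟨ Q-R (suc k) ⟩
  q₁
    ≈⟨ Q-recurrence k ⟨
  q₂ ⊕ X ⊛ Q k
    ≈⟨ ⊕-congˡ q₂ (⊛-congˡ X (Q-R k)) ⟨
  q₂ ⊕ X ⊛ (q₁ ⊛ r₁)
    ≈⟨ ⊕-congˡ q₂ (⊛-congˡ X (⊛-congʳ r₁ (Q-R (suc k)))) ⟨
  q₂ ⊕ X ⊛ (q₂ ⊛ r₂ ⊛ r₁)
    ≈⟨ solve 4 (λ q₂ r₂ r₁ x → q₂ :+ x :* (q₂ :* r₂ :* r₁) := q₂ :* (con 1 :+ x :* (r₁ :* r₂))) S.refl q₂ r₂ r₁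
        X ⟩
  q₂ ⊛ (one ⊕ X ⊛ (r₁ ⊛ r₂)) ∎)
  where
  open ≈-Reasoning
  q₁ q₂ r₁ r₂ : Series
  q₁ = Q (suc k)
  q₂ = Q (suc (suc k))
  r₁ = R (suc k)
  r₂ = R (suc (suc k))

R-one : R 1 ≈ one
R-one = S.trans (S.sym (S.*-identityˡ (R 1))) (Q-R 0)

R-two : ∀ n → R 2 n ≡ + 1
R-two zero    = coeff (R-recurrence 0) 0
R-two (suc n) = trans (coeff R₂ (suc n)) (trans (ℤₚ.+-identityˡ _) (trans (X-⊛-suc (R 2) n) (R-two n)))
  where
  R₂ : R 2 ≈ one ⊕ X ⊛ R 2
  R₂ = S.trans (R-recurrence 0) (⊕-congˡ one (⊛-congˡ X (S.trans (⊛-congʳ (R 2) R-one) (S.*-identityˡ (R 2)))))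

sumS-cong : ∀ {f g : ℕ → Series} n → (∀ j → j < n → f j ≈ g j) →
  sumS (map f (upTo n)) ≈ sumS (map g (upTo n))
sumS-cong zero    p = S.refl
sumS-cong {f} {g} (suc n) p = begin
  sumS (map f (upTo (suc n)))  ≈⟨ sumS-map-upTo-suc f n ⟩
  sumS (map f (upTo n)) ⊕ f n  ≈⟨ ⊕-congʳ (f n) (sumS-cong n (λ j j<n → p j (ℕₚ.m≤n⇒m≤1+n j<n))) ⟩
  sumS (map g (upTo n)) ⊕ f n  ≈⟨ ⊕-congˡ (sumS (map g (upTo n))) (p n ℕₚ.≤-refl) ⟩
  sumS (map g (upTo n)) ⊕ g n  ≈⟨ sumS-map-upTo-suc g n ⟨
  sumS (map g (upTo (suc n)))  ∎
  where open ≈-Reasoning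

⊛-distribˡ-sumS : ∀ {A : Set} a (f : A → Series) xs → sumS (map (λ x → a ⊛ f x) xs) ≈ a ⊛ sumS (map f xs)
⊛-distribˡ-sumS a f []       = S.sym (S.zeroʳ a)
⊛-distribˡ-sumS a f (x ∷ xs) = begin
  a ⊛ f x ⊕ sumS (map (λ x → a ⊛ f x) xs)  ≈⟨ ⊕-congˡ (a ⊛ f x) (⊛-distribˡ-sumS a f xs) ⟩
  a ⊛ f x ⊕ a ⊛ sumS (map f xs)            ≈⟨ S.distribˡ a (f x) (sumS (map f xs)) ⟨
  a ⊛ (f x ⊕ sumS (map f xs))              ∎
  where open ≈-Reasoning

prodS-∷ʳ : ∀ as b → prodS (as ∷ʳ b) ≈ prodS as ⊛ b
prodS-∷ʳ []       b = S.*-comm b one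
prodS-∷ʳ (a ∷ as) b = S.trans (⊛-congˡ a (prodS-∷ʳ as b)) (S.sym (S.*-assoc a (prodS as) b))

prodS-map-upTo-suc : ∀ (f : ℕ → Series) n → prodS (map f (upTo (suc n))) ≈ prodS (map f (upTo n)) ⊛ f n
prodS-map-upTo-suc f n = S.trans
  (S.reflexive (cong prodS (trans (cong (map f) (sym (Listₚ.upTo-∷ʳ n))) (Listₚ.map-++ f (upTo n) _))))
  (prodS-∷ʳ (map f (upTo n)) (f n))

map-upTo-suc : ∀ {A : Set} (f : ℕ → A) n → map f (upTo (suc n)) ≡ f 0 ∷ map (f ∘ suc) (upTo n)
map-upTo-suc f n = cong (f 0 ∷_) (trans (Listₚ.map-applyUpTo suc f n) (sym (Listₚ.map-upTo (f ∘ suc) n)))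

Q[x²] R[x²] R[-x²] : ℕ → Series
Q[x²] k = substSq (+ 1) (Q k)
R[x²] k = substSq (+ 1) (R k)
R[-x²] k = substSq (- + 1) (R k)

Q[x²]-constant : ∀ k → Q[x²] k 0 ≡ + 1
Q[x²]-constant k = trans (ℤₚ.*-identityˡ (Q k 0)) (Q-constant k)

substSq-1-X : substSq (+ 1) X ≈ X ⊛ X
substSq-1-X = pointwise λ n → trans (substSq-X-at (+ 1) n) (ℤₚ.*-identityˡ _)

Q[x²]-recurrence : ∀ m → Q[x²] (suc (suc m)) ⊕ X ⊛ X ⊛ Q[x²] m ≈ Q[x²] (suc m)
Q[x²]-recurrence m = begin
  Q[x²] (suc (suc m)) ⊕ X ⊛ X ⊛ Q[x²] m
    ≈⟨ ⊕-congˡ (Q[x²] (suc (suc m))) (⊛-congʳ (Q[x²] m) substSq-1-X) ⟨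
  Q[x²] (suc (suc m)) ⊕ substSq (+ 1) X ⊛ Q[x²] m
    ≈⟨ ⊕-congˡ (Q[x²] (suc (suc m))) (substSq-⊛ (+ 1) X (Q m)) ⟨
  Q[x²] (suc (suc m)) ⊕ substSq (+ 1) (X ⊛ Q m)
    ≈⟨ substSq-⊕ (+ 1) (Q (suc (suc m))) (X ⊛ Q m) ⟨
  substSq (+ 1) (Q (suc (suc m)) ⊕ X ⊛ Q m)
    ≈⟨ substSq-cong (+ 1) (Q-recurrence m) ⟩
  Q[x²] (suc m) ∎
  where open ≈-Reasoning

Q[x²]-R[x²] : ∀ k → Q[x²] (suc k) ⊛ R[x²] (suc k) ≈ Q[x²] k
Q[x²]-R[x²] k = S.trans (S.sym (substSq-⊛ (+ 1) (Q (suc k)) (R (suc k)))) (substSq-cong (+ 1) (Q-R k))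

Fnum : ℕ → Series
Fnum m = sumS (map (λ j → (X ^ˢ (m ∸ 1 ∸ j)) ⊛ Q[x²] j) (upTo m))

Q[x²]-F : ∀ m → Q[x²] m ⊛ F m ≈ Fnum m
Q[x²]-F m = ⊛-quotient (Q[x²] m) (Fnum m) (Q[x²]-constant m)

-- Passing to m + 1 raises every old exponent by one, and the new summand has exponent 0.
Fnum-recurrence : ∀ m → Fnum (suc m) ≈ X ⊛ Fnum m ⊕ Q[x²] m
Fnum-recurrence m = begin
  Fnum (suc m)
    ≈⟨ sumS-map-upTo-suc (λ j → (X ^ˢ (m ∸ j)) ⊛ Q[x²] j) m ⟩
  sumS (map (λ j → (X ^ˢ (m ∸ j)) ⊛ Q[x²] j) (upTo m)) ⊕ (X ^ˢ (m ∸ m)) ⊛ Q[x²] m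
    ≈⟨ ⊕-congˡ (sumS (map (λ j → (X ^ˢ (m ∸ j)) ⊛ Q[x²] j) (upTo m)))
         (S.trans (S.reflexive (cong (λ d → (X ^ˢ d) ⊛ Q[x²] m) (ℕₚ.n∸n≡0 m))) (S.*-identityˡ (Q[x²] m))) ⟩
  sumS (map (λ j → (X ^ˢ (m ∸ j)) ⊛ Q[x²] j) (upTo m)) ⊕ Q[x²] m
    ≈⟨ ⊕-congʳ (Q[x²] m) (sumS-cong m (λ j j<m → S.trans
         (S.reflexive (cong (λ d → (X ^ˢ d) ⊛ Q[x²] j) (m∸j m j j<m)))
         (S.*-assoc X (X ^ˢ (m ∸ 1 ∸ j)) (Q[x²] j)))) ⟩
  sumS (map (λ j → X ⊛ ((X ^ˢ (m ∸ 1 ∸ j)) ⊛ Q[x²] j)) (upTo m)) ⊕ Q[x²] m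
    ≈⟨ ⊕-congʳ (Q[x²] m) (⊛-distribˡ-sumS X (λ j → (X ^ˢ (m ∸ 1 ∸ j)) ⊛ Q[x²] j) (upTo m)) ⟩
  X ⊛ Fnum m ⊕ Q[x²] m ∎
  where
  open ≈-Reasoning
  m∸j : ∀ m j → j < m → m ∸ j ≡ suc (m ∸ 1 ∸ j)
  m∸j (suc m) j (s≤s j≤m) = ℕₚ.+-∸-assoc 1 j≤m

-- The numerator gives q₂ F₂ = q₁ (1 + x F₁). Replacing the factor q₁ by q₂ + x² q₁ r₁ reproduces q₁
-- (1 + x F₁) = q₂ F₂ in the second summand, and q₂ cancels.
F-recurrence : ∀ k → F (suc (suc k)) ≈ one ⊕ X ⊛ F (suc k) ⊕ X ⊛ X ⊛ (R[x²] (suc k) ⊛ F (suc (suc k)))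
F-recurrence k = ⊛-cancelˡ q₂ (Q[x²]-constant (suc (suc k))) (begin
  q₂ ⊛ F₂
    ≈⟨ Q[x²]-F (suc (suc k)) ⟩
  Fnum (suc (suc k))
    ≈⟨ num ⟩
  q₁ ⊛ (one ⊕ X ⊛ F₁)
    ≈⟨ ⊛-congʳ (one ⊕ X ⊛ F₁) (Q[x²]-recurrence k) ⟨
  (q₂ ⊕ X ⊛ X ⊛ Q[x²] k) ⊛ (one ⊕ X ⊛ F₁)
    ≈⟨ ⊛-congʳ (one ⊕ X ⊛ F₁) (⊕-congˡ q₂ (⊛-congˡ (X ⊛ X) (Q[x²]-R[x²] k))) ⟨
  (q₂ ⊕ X ⊛ X ⊛ (q₁ ⊛ r₁)) ⊛ (one ⊕ X ⊛ F₁)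
    ≈⟨ solve 5 (λ q₂ x q₁ r₁ f₁ →
     (q₂ :+ x :* x :* (q₁ :* r₁)) :* (con 1 :+ x :* f₁)
         := q₂ :* (con 1 :+ x :* f₁) :+ x :* x :* r₁ :* (q₁ :* (con 1 :+ x :* f₁))) S.refl q₂ X q₁ r₁ F₁ ⟩
  q₂ ⊛ (one ⊕ X ⊛ F₁) ⊕ X ⊛ X ⊛ r₁ ⊛ (q₁ ⊛ (one ⊕ X ⊛ F₁))
    ≈⟨ ⊕-congˡ (q₂ ⊛ (one ⊕ X ⊛ F₁)) (⊛-congˡ (X ⊛ X ⊛ r₁) (S.trans (Q[x²]-F (suc (suc k))) num)) ⟨
  q₂ ⊛ (one ⊕ X ⊛ F₁) ⊕ X ⊛ X ⊛ r₁ ⊛ (q₂ ⊛ F₂)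
    ≈⟨ solve 5 (λ q₂ x r₁ f₁ f₂ →
     q₂ :* (con 1 :+ x :* f₁) :+ x :* x :* r₁ :* (q₂ :* f₂)
         := q₂ :* (con 1 :+ x :* f₁ :+ x :* x :* (r₁ :* f₂))) S.refl q₂ X r₁ F₁ F₂ ⟩
  q₂ ⊛ (one ⊕ X ⊛ F₁ ⊕ X ⊛ X ⊛ (r₁ ⊛ F₂)) ∎)
  where
  open ≈-Reasoning
  q₁ q₂ r₁ F₁ F₂ : Series
  q₁ = Q[x²] (suc k)
  q₂ = Q[x²] (suc (suc k))
  r₁ = R[x²] (suc k)
  F₁ = F (suc k)
  F₂ = F (suc (suc k))
  num : Fnum (suc (suc k)) ≈ q₁ ⊛ (one ⊕ X ⊛ F₁)
  num = begin
    Fnum (suc (suc k))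
      ≈⟨ Fnum-recurrence (suc k) ⟩
    X ⊛ Fnum (suc k) ⊕ q₁
      ≈⟨ ⊕-congʳ q₁ (⊛-congˡ X (Q[x²]-F (suc k))) ⟨
    X ⊛ (q₁ ⊛ F₁) ⊕ q₁
      ≈⟨ solve 3 (λ x q₁ f₁ → x :* (q₁ :* f₁) :+ q₁ := q₁ :* (con 1 :+ x :* f₁)) S.refl X q₁ F₁ ⟩
    q₁ ⊛ (one ⊕ X ⊛ F₁) ∎

F-one : F 1 ≈ one
F-one = begin
  F 1                 ≈⟨ S.*-identityˡ (F 1) ⟨
  one ⊛ F 1           ≈⟨ ⊛-congʳ (F 1) (substSq-one (+ 1)) ⟨
  Q[x²] 1 ⊛ F 1       ≈⟨ Q[x²]-F 1 ⟩
  one ⊛ Q[x²] 0 ⊕ 0ˢ  ≈⟨ S.+-identityʳ (one ⊛ Q[x²] 0) ⟩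
  one ⊛ Q[x²] 0       ≈⟨ S.*-identityˡ (Q[x²] 0) ⟩
  Q[x²] 0             ≈⟨ substSq-one (+ 1) ⟩
  one                 ∎
  where open ≈-Reasoning

X-⊛-X-⊛ : ∀ a n → (X ⊛ X ⊛ a) (suc (suc n)) ≡ a n
X-⊛-X-⊛ a n = trans (coeff (S.*-assoc X X a) (suc (suc n))) (trans (X-⊛-suc (X ⊛ a) (suc n)) (X-⊛-suc a n))

F-two-recurrence : F 2 ≈ one ⊕ X ⊛ one ⊕ X ⊛ X ⊛ F 2
F-two-recurrence = S.trans (F-recurrence 0) (S.+-cong (⊕-congˡ one (⊛-congˡ X F-one))
  (⊛-congˡ (X ⊛ X) (S.trans (⊛-congʳ (F 2) r-one) (S.*-identityˡ (F 2)))))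
  where
  r-one : R[x²] 1 ≈ one
  r-one = S.trans (substSq-cong (+ 1) R-one) (substSq-one (+ 1))

F-two : ∀ n → F 2 n ≡ + 1
F-two zero          = coeff F-two-recurrence 0
F-two (suc zero)    = coeff F-two-recurrence 1
F-two (suc (suc n)) = trans (coeff F-two-recurrence (suc (suc n)))
  (trans (cong₂ (λ x y → (+ 0) ℤ.+ x ℤ.+ y) (X-⊛-suc one (suc n)) (X-⊛-X-⊛ (F 2) n))
  (trans (ℤₚ.+-identityˡ (F 2 n)) (F-two n)))

-- Under the substitution of -x² the recurrence of `R` reads s₂ = 1 - x² s₁ s₂. The sign is hidden
-- in `σX`, the image of `X`, and is removed through σX + x² = 0.
R[-x²]-inverse : ∀ k → R[-x²] (suc (suc k)) ⊛ (one ⊕ X ⊛ X ⊛ R[-x²] (suc k)) ≈ one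
R[-x²]-inverse k = begin
  s₂ ⊛ (one ⊕ X ⊛ X ⊛ s₁)
    ≈⟨ solve 3 (λ s₂ x s₁ → s₂ :* (con 1 :+ x :* x :* s₁) := s₂ :+ x :* x :* (s₁ :* s₂)) S.refl s₂ X s₁ ⟩
  s₂ ⊕ X ⊛ X ⊛ (s₁ ⊛ s₂)
    ≈⟨ ⊕-congʳ (X ⊛ X ⊛ (s₁ ⊛ s₂)) s₂≈ ⟩
  one ⊕ σX ⊛ (s₁ ⊛ s₂) ⊕ X ⊛ X ⊛ (s₁ ⊛ s₂)
    ≈⟨ solve 4 (λ σ s₁ s₂ x → con 1 :+ σ :* (s₁ :* s₂) :+ x :* x :* (s₁ :* s₂) := con 1
        :+ (σ :+ x :* x) :* (s₁ :* s₂)) S.refl σX s₁ s₂ X ⟩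
  one ⊕ (σX ⊕ X ⊛ X) ⊛ (s₁ ⊛ s₂)
    ≈⟨ ⊕-congˡ one (⊛-congʳ (s₁ ⊛ s₂) σX+X²) ⟩
  one ⊕ 0ˢ ⊛ (s₁ ⊛ s₂)
    ≈⟨ solve 1 (λ y → con 1 :+ con 0 :* y := con 1) S.refl (s₁ ⊛ s₂) ⟩
  one ∎
  where
  open ≈-Reasoning
  σX s₁ s₂ : Series
  σX = substSq (- + 1) X
  s₁ = R[-x²] (suc k)
  s₂ = R[-x²] (suc (suc k))
  σX+X² : σX ⊕ X ⊛ X ≈ 0ˢ
  σX+X² = pointwise λ n → trans (cong (ℤ._+ (X ⊛ X) n)
      (trans (substSq-X-at (- + 1) n) (ℤₚ.-1*i≡-i ((X ⊛ X) n)))) (ℤₚ.+-inverseˡ ((X ⊛ X) n))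
  s₂≈ : s₂ ≈ one ⊕ σX ⊛ (s₁ ⊛ s₂)
  s₂≈ = begin
    s₂
      ≈⟨ substSq-cong (- + 1) (R-recurrence k) ⟩
    substSq (- + 1) (one ⊕ X ⊛ (R (suc k) ⊛ R (suc (suc k))))
      ≈⟨ substSq-⊕ (- + 1) one (X ⊛ (R (suc k) ⊛ R (suc (suc k)))) ⟩
    substSq (- + 1) one ⊕ substSq (- + 1) (X ⊛ (R (suc k) ⊛ R (suc (suc k))))
      ≈⟨ S.+-cong (substSq-one (- + 1)) (S.trans (substSq-⊛ (- + 1) X (R (suc k) ⊛ R (suc (suc k))))
          (⊛-congˡ σX (substSq-⊛ (- + 1) (R (suc k)) (R (suc (suc k)))))) ⟩
    one ⊕ σX ⊛ (s₁ ⊛ s₂) ∎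

Re[x²] : ℕ → Series
Re[x²] k = substSq (+ 1) (Re k)

rhsTerm : ℕ → ℕ → Series
rhsTerm k j = (X ^ˢ j) ⊛ (one ⊕ (X ^ˢ 2) ⊛ Re[x²] (k ∸ 1 ∸ j) ⊛ F (k ∸ j))
  ⊛ prodS (map (λ t → R[-x²] (k ∸ j ℕ.+ t)) (upTo (suc j)))

-- Raising `k` and `j` together leaves `k ∸ j` unchanged, hence also the bracket and the start of
-- the product. What is added is one x and, at the end of the product, one factor whose index is the
-- new `k`; the bound on `j` keeps the subtraction exact.
rhsTerm-suc : ∀ m j → j < m → rhsTerm (suc (suc (suc m))) (suc j)
  ≈ R[-x²] (suc (suc (suc m))) ⊛ X ⊛ rhsTerm (suc (suc m)) j
rhsTerm-suc m j j<m = begin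
  (X ^ˢ suc j) ⊛ body ⊛ prodS (map factor (upTo (suc (suc j))))
    ≈⟨ ⊛-congˡ ((X ^ˢ suc j) ⊛ body) (prodS-map-upTo-suc factor (suc j)) ⟩
  (X ^ˢ suc j) ⊛ body ⊛ (prodS (map factor (upTo (suc j))) ⊛ factor (suc j))
    ≈⟨ solve 5 (λ x xj b p f → x :* xj :* b :* (p :* f) := f :* x :* (xj :* b :* p)) S.refl X (X ^ˢ j) body
        (prodS (map factor (upTo (suc j)))) (factor (suc j)) ⟩
  factor (suc j) ⊛ X ⊛ ((X ^ˢ j) ⊛ body ⊛ prodS (map factor (upTo (suc j))))
    ≡⟨ cong (λ i → R[-x²] i ⊛ X ⊛ rhsTerm (suc (suc m)) j) index ⟩
  R[-x²] (suc (suc (suc m))) ⊛ X ⊛ rhsTerm (suc (suc m)) j ∎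
  where
  open ≈-Reasoning
  body : Series
  body = one ⊕ (X ^ˢ 2) ⊛ Re[x²] (suc m ∸ j) ⊛ F (suc (suc m) ∸ j)
  factor : ℕ → Series
  factor t = R[-x²] (suc (suc m) ∸ j ℕ.+ t)
  index : suc (suc m) ∸ j ℕ.+ suc j ≡ suc (suc (suc m))
  index = trans (ℕₚ.+-suc (suc (suc m) ∸ j) j)
      (cong suc (ℕₚ.m∸n+n≡m (ℕₚ.m≤n⇒m≤1+n (ℕₚ.m≤n⇒m≤1+n (ℕₚ.<⇒≤ j<m)))))

rhsLast : ℕ → Series
rhsLast m = (X ^ˢ m) ⊛ R 2 ⊛ prodS (map (λ t → R[-x²] (3 ℕ.+ t)) (upTo m))

-- The summand j = 0 is new; all others, and the closing term, are those for k - 1 times the common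
-- factor x Rₖ(-x²).
rhs-step : ∀ m → rhs (suc (suc (suc m))) ≈
  R[-x²] (suc (suc (suc m))) ⊛ (one ⊕ X ⊛ X ⊛ (Re[x²] (suc (suc m)) ⊛ F (suc (suc (suc m))))
      ⊕ X ⊛ rhs (suc (suc m)))
rhs-step m = begin
  sumS (map (rhsTerm k₃) (upTo (suc m))) ⊕ rhsLast (suc m)
    ≡⟨ cong (λ l → sumS l ⊕ rhsLast (suc m)) (map-upTo-suc (rhsTerm k₃) m) ⟩
  rhsTerm k₃ 0 ⊕ sumS (map (rhsTerm k₃ ∘ suc) (upTo m)) ⊕ rhsLast (suc m)
    ≈⟨ S.+-cong (⊕-congˡ (rhsTerm k₃ 0) (S.trans (sumS-cong m (rhsTerm-suc m))
        (⊛-distribˡ-sumS (R[-x²] k₃ ⊛ X) (rhsTerm k₂) (upTo m))))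
         (⊛-congˡ ((X ^ˢ suc m) ⊛ R 2) (prodS-map-upTo-suc (λ t → R[-x²] (3 ℕ.+ t)) m)) ⟩
  rhsTerm k₃ 0 ⊕ R[-x²] k₃ ⊛ X ⊛ sums ⊕ (X ^ˢ suc m) ⊛ R 2 ⊛ (prods ⊛ R[-x²] k₃)
    ≡⟨ cong (λ i → one ⊛ (one ⊕ X ⊛ (X ⊛ one) ⊛ Re[x²] k₂ ⊛ F k₃) ⊛ (R[-x²] i ⊛ one) ⊕ R[-x²] k₃ ⊛ X ⊛ sums
        ⊕ (X ^ˢ suc m) ⊛ R 2 ⊛ (prods ⊛ R[-x²] k₃)) (ℕₚ.+-identityʳ k₃) ⟩
  one ⊛ (one ⊕ X ⊛ (X ⊛ one) ⊛ Re[x²] k₂ ⊛ F k₃) ⊛ (R[-x²] k₃ ⊛ one) ⊕ R[-x²] k₃ ⊛ X ⊛ sums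
      ⊕ (X ^ˢ suc m) ⊛ R 2 ⊛ (prods ⊛ R[-x²] k₃)
    ≈⟨ solve 8 (λ x e f σ Σ xm r p →
         con 1 :* (con 1 :+ x :* (x :* con 1) :* e :* f) :* (σ :* con 1) :+ σ :* x :* Σ
             :+ x :* xm :* r :* (p :* σ)
         := σ :* (con 1 :+ x :* x :* (e :* f) :+ x :* (Σ :+ xm :* r :* p)))
         S.refl X (Re[x²] k₂) (F k₃) (R[-x²] k₃) sums (X ^ˢ m) (R 2) prods ⟩
  R[-x²] k₃ ⊛ (one ⊕ X ⊛ X ⊛ (Re[x²] k₂ ⊛ F k₃) ⊕ X ⊛ (sums ⊕ (X ^ˢ m) ⊛ R 2 ⊛ prods)) ∎
  where
  open ≈-Reasoning
  k₂ k₃ : ℕ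
  k₂ = suc (suc m)
  k₃ = suc k₂
  sums prods : Series
  sums  = sumS (map (rhsTerm k₂) (upTo m))
  prods = prodS (map (λ t → R[-x²] (3 ℕ.+ t)) (upTo m))

-- The leading factor of `rhs-step` is cancelled by its inverse 1 + x² Rₖ₋₁(-x²); the result has the
-- form that the count of even palindromes obeys.
rhs-recurrence : ∀ m → rhs (suc (suc (suc m))) ⊕ X ⊛ X ⊛ (R[-x²] (suc (suc m)) ⊛ rhs (suc (suc (suc m)))) ≈
  one ⊕ X ⊛ X ⊛ (Re[x²] (suc (suc m)) ⊛ F (suc (suc (suc m)))) ⊕ X ⊛ rhs (suc (suc m))
rhs-recurrence m = begin
  rhs k₃ ⊕ X ⊛ X ⊛ (R[-x²] k₂ ⊛ rhs k₃)
    ≈⟨ solve 3 (λ e x σ → e :+ x :* x :* (σ :* e) := (con 1 :+ x :* x :* σ) :* e) S.refl (rhs k₃) X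
        (R[-x²] k₂) ⟩
  (one ⊕ X ⊛ X ⊛ R[-x²] k₂) ⊛ rhs k₃
    ≈⟨ ⊛-congˡ (one ⊕ X ⊛ X ⊛ R[-x²] k₂) (rhs-step m) ⟩
  (one ⊕ X ⊛ X ⊛ R[-x²] k₂) ⊛ (R[-x²] k₃ ⊛ body)
    ≈⟨ solve 3 (λ a σ b → a :* (σ :* b) := σ :* a :* b) S.refl (one ⊕ X ⊛ X ⊛ R[-x²] k₂) (R[-x²] k₃) body ⟩
  R[-x²] k₃ ⊛ (one ⊕ X ⊛ X ⊛ R[-x²] k₂) ⊛ body
    ≈⟨ ⊛-congʳ body (R[-x²]-inverse (suc m)) ⟩
  one ⊛ body
    ≈⟨ S.*-identityˡ body ⟩
  body ∎
  where
  open ≈-Reasoning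
  k₂ k₃ : ℕ
  k₂ = suc (suc m)
  k₃ = suc k₂
  body : Series
  body = one ⊕ X ⊛ X ⊛ (Re[x²] k₂ ⊛ F k₃) ⊕ X ⊛ rhs k₂

rhs-two : ∀ n → rhs 2 n ≡ + 1
rhs-two n = trans (coeff (solve 1 (λ r → con 0 :+ con 1 :* r :* con 1 := r) S.refl (R 2)) n) (R-two n)

-- Counting in lists

count-++ : ∀ {A : Set} (p : A → Bool) xs ys → count p (xs ++ ys) ≡ count p xs ℕ.+ count p ys
count-++ p []       ys = refl
count-++ p (x ∷ xs) ys with p x
... | true  = cong suc (count-++ p xs ys)
... | false = count-++ p xs ys

count-map : ∀ {A B : Set} (p : B → Bool) (f : A → B) xs → count p (map f xs) ≡ count (p ∘ f) xs
count-map p f []       = refl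
count-map p f (x ∷ xs) with p (f x)
... | true  = cong suc (count-map p f xs)
... | false = count-map p f xs

count-cong : ∀ {A : Set} {p q : A → Bool} xs → (∀ x → x ∈ xs → p x ≡ q x) → count p xs ≡ count q xs
count-cong []       eq = refl
count-cong {p = p} {q} (x ∷ xs) eq rewrite eq x (here refl) with q x
... | true  = cong suc (count-cong xs (λ y y∈ → eq y (there y∈)))
... | false = count-cong xs (λ y y∈ → eq y (there y∈))

count-false : ∀ {A : Set} (xs : List A) → count (λ _ → false) xs ≡ 0
count-false []       = refl
count-false (x ∷ xs) = count-false xs

count-concatMap : ∀ {A B : Set} (p : B → Bool) (g : A → List B) xs →
  + count p (concatMap g xs) ≡ sumℤ (map (λ x → + count p (g x)) xs)
count-concatMap p g []       = refl
count-concatMap p g (x ∷ xs) = trans (cong +_ (count-++ p (g x) (concatMap g xs)))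
  (cong (ℤ._+_ (+ count p (g x))) (count-concatMap p g xs))

count-∧ : ∀ {A : Set} b (p : A → Bool) xs → count (λ x → b ∧ p x) xs ≡ (if b then 1 else 0) ℕ.* count p xs
count-∧ true  p xs = sym (ℕₚ.*-identityˡ _)
count-∧ false p xs = count-false xs

-- The splitting is asked only for members `x` of `xs`: on a list of trees of one size the parity of
-- the size is a constant, so a condition that depends on it still factors.
count-product : ∀ {A B C : Set} {p : C → Bool} (f : A → B → C) (u : A → Bool) (v : B → Bool) xs ys →
  (∀ x → x ∈ xs → ∀ y → p (f x y) ≡ u x ∧ v y) →
  count p (cartesianProductWith f xs ys) ≡ count u xs ℕ.* count v ys
count-product f u v []       ys eq = refl
count-product {p = p} f u v (x ∷ xs) ys eq = begin
  count p (map (f x) ys ++ cartesianProductWith f xs ys)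
    ≡⟨ count-++ p (map (f x) ys) (cartesianProductWith f xs ys) ⟩
  count p (map (f x) ys) ℕ.+ count p (cartesianProductWith f xs ys)
    ≡⟨ cong₂ ℕ._+_ (trans (count-map p (f x) ys)
        (trans (count-cong ys (λ y _ → eq x (here refl) y)) (count-∧ (u x) v ys)))
                   (count-product f u v xs ys (λ x x∈ → eq x (there x∈))) ⟩
  (if u x then 1 else 0) ℕ.* count v ys ℕ.+ count u xs ℕ.* count v ys
    ≡⟨ ℕₚ.*-distribʳ-+ (count v ys) (if u x then 1 else 0) (count u xs) ⟨
  ((if u x then 1 else 0) ℕ.+ count u xs) ℕ.* count v ys
    ≡⟨ cong (ℕ._* count v ys) (head (u x)) ⟩
  (if u x then suc (count u xs) else count u xs) ℕ.* count v ys ∎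
  where
  open ≡-Reasoning
  head : ∀ b → (if b then 1 else 0) ℕ.+ count u xs ≡ (if b then suc (count u xs) else count u xs)
  head true  = refl
  head false = refl

count-split : ∀ {A : Set} (p q : A → Bool) xs →
  count (λ x → p x ∧ q x) xs ℕ.+ count (λ x → p x ∧ not (q x)) xs ≡ count p xs
count-split p q []       = refl
count-split p q (x ∷ xs) with p x | q x
... | true  | true  = cong suc (count-split p q xs)
... | true  | false = trans (ℕₚ.+-suc _ _) (cong suc (count-split p q xs))
... | false | _     = count-split p q xs

sumℤ-upTo-cong : ∀ {f g : ℕ → ℤ} n → (∀ i → i < n → f i ≡ g i) → sumℤ (map f (upTo n)) ≡ sumℤ (map g (upTo n))
sumℤ-upTo-cong n eq = cong sumℤ (Listₚ.map-cong-local (Allₚ.applyUpTo⁺₁ id n (λ {i} → eq i)))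

sumℤ-+ : ∀ {A : Set} (f g : A → ℤ) xs → sumℤ (map (λ x → f x ℤ.+ g x) xs) ≡ sumℤ (map f xs) ℤ.+ sumℤ (map g xs)
sumℤ-+ f g []       = refl
sumℤ-+ f g (x ∷ xs) rewrite sumℤ-+ f g xs = lemma (f x) (g x) (sumℤ (map f xs)) (sumℤ (map g xs))
  where
  lemma : ∀ a b c d → (a ℤ.+ b) ℤ.+ (c ℤ.+ d) ≡ (a ℤ.+ c) ℤ.+ (b ℤ.+ d)
  lemma = solve-∀

isEven-suc : ∀ n → isEven (suc n) ≡ not (isEven n)
isEven-suc zero          = refl
isEven-suc (suc zero)    = refl
isEven-suc (suc (suc n)) = isEven-suc n

isEven-+ : ∀ m n → isEven (m ℕ.+ n) ≡ not (isEven m xor isEven n)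
isEven-+ zero          n = sym (Boolₚ.not-involutive _)
isEven-+ (suc zero)    n = isEven-suc n
isEven-+ (suc (suc m)) n = isEven-+ m n

isEven-double : ∀ n → isEven (n ℕ.+ n) ≡ true
isEven-double n rewrite isEven-+ n n with isEven n
... | true  = refl
... | false = refl

-- Trees and twisted palindromes

-- node a b is the permutation with a, raised above b, before the maximum and b after it; _⊝_ is the skew sum
-- and transpose the inverse.
data Tree : Set where
  leaf : Tree
  node : Tree → Tree → Tree

size : Tree → ℕ
size leaf       = 0
size (node a b) = suc (size a ℕ.+ size b)

infixr 5 _⊝_

_⊝_ : Tree → Tree → Tree
leaf     ⊝ t = t
node a b ⊝ t = node a (b ⊝ t)

transpose : Tree → Tree
transpose leaf       = leaf
transpose (node a b) = transpose b ⊝ node (transpose a) leaf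

-- The letters before the cut, those of `a` and the maximum, all exceed those of `b`, whence the
-- product; the maximum comes after `a` and forms no inversion with it.
inversions : Tree → ℕ
inversions leaf       = 0
inversions (node a b) = inversions a ℕ.+ inversions b ℕ.+ suc (size a) ℕ.* size b

isLeaf : Tree → Bool
isLeaf leaf       = true
isLeaf (node _ _) = false

-- The index is the length of the pattern minus two.
avoidsᵗ : ℕ → Tree → Bool
avoidsᵗ k       leaf       = true
avoidsᵗ zero    (node a b) = avoidsᵗ zero a ∧ isLeaf b
avoidsᵗ (suc k) (node a b) = avoidsᵗ k a ∧ avoidsᵗ (suc k) b

⊝-identityʳ : ∀ t → t ⊝ leaf ≡ t
⊝-identityʳ leaf       = refl
⊝-identityʳ (node a b) = cong (node a) (⊝-identityʳ b)

⊝-assoc : ∀ t u v → (t ⊝ u) ⊝ v ≡ t ⊝ u ⊝ v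
⊝-assoc leaf       u v = refl
⊝-assoc (node a b) u v = cong (node a) (⊝-assoc b u v)

transpose-⊝ : ∀ t u → transpose (t ⊝ u) ≡ transpose u ⊝ transpose t
transpose-⊝ leaf       u = sym (⊝-identityʳ (transpose u))
transpose-⊝ (node a b) u = trans (cong (_⊝ node (transpose a) leaf) (transpose-⊝ b u))
  (⊝-assoc (transpose u) (transpose b) (node (transpose a) leaf))

transpose-involutive : ∀ t → transpose (transpose t) ≡ t
transpose-involutive leaf       = refl
transpose-involutive (node a b) = trans (transpose-⊝ (transpose b) (node (transpose a) leaf))
  (cong₂ node (transpose-involutive a) (transpose-involutive b))

size-⊝ : ∀ t u → size (t ⊝ u) ≡ size t ℕ.+ size u
size-⊝ leaf       u = refl
size-⊝ (node a b) u = cong suc (trans (cong (size a ℕ.+_) (size-⊝ b u))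
  (sym (ℕₚ.+-assoc (size a) (size b) (size u))))

size-transpose : ∀ t → size (transpose t) ≡ size t
size-transpose leaf       = refl
size-transpose (node a b) rewrite size-⊝ (transpose b) (node (transpose a) leaf) | size-transpose a
  | size-transpose b =
  lemma (size b) (size a)
  where
  lemma : ∀ x y → x ℕ.+ suc (y ℕ.+ 0) ≡ suc (y ℕ.+ x)
  lemma = solveℕ-∀

inversions-⊝ : ∀ t u → inversions (t ⊝ u) ≡ inversions t ℕ.+ inversions u ℕ.+ size t ℕ.* size u
inversions-⊝ leaf       u = sym (ℕₚ.+-identityʳ _)
inversions-⊝ (node a b) u rewrite inversions-⊝ b u | size-⊝ b u =
  lemma (inversions a) (inversions b) (inversions u) (size a) (size b) (size u)
  where
  lemma : ∀ ia ib iu a b u → ia ℕ.+ (ib ℕ.+ iu ℕ.+ b ℕ.* u) ℕ.+ suc a ℕ.* (b ℕ.+ u)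
        ≡ ia ℕ.+ ib ℕ.+ suc a ℕ.* b ℕ.+ iu ℕ.+ suc (a ℕ.+ b) ℕ.* u
  lemma = solveℕ-∀

inversions-transpose : ∀ t → inversions (transpose t) ≡ inversions t
inversions-transpose leaf       = refl
inversions-transpose (node a b)
  rewrite inversions-⊝ (transpose b) (node (transpose a) leaf)
        | inversions-transpose a | inversions-transpose b | size-transpose a | size-transpose b =
  lemma (inversions a) (inversions b) (size a) (size b)
  where
  lemma : ∀ ia ib a b → ib ℕ.+ (ia ℕ.+ 0 ℕ.+ suc a ℕ.* 0) ℕ.+ b ℕ.* suc (a ℕ.+ 0) ≡ ia ℕ.+ ib ℕ.+ suc a ℕ.* b
  lemma = solveℕ-∀

avoidsᵗ-⊝ : ∀ k t u → avoidsᵗ (suc k) (t ⊝ u) ≡ avoidsᵗ (suc k) t ∧ avoidsᵗ (suc k) u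
avoidsᵗ-⊝ k leaf       u = refl
avoidsᵗ-⊝ k (node a b) u = trans (cong (avoidsᵗ k a ∧_) (avoidsᵗ-⊝ k b u))
  (sym (Boolₚ.∧-assoc (avoidsᵗ k a) (avoidsᵗ (suc k) b) (avoidsᵗ (suc k) u)))

isLeaf-⊝-node : ∀ t a b → isLeaf (t ⊝ node a b) ≡ false
isLeaf-⊝-node leaf       a b = refl
isLeaf-⊝-node (node _ _) a b = refl

avoidsᵗ-zero-⊝ : ∀ t a b → isLeaf t ≡ false → avoidsᵗ 0 (t ⊝ node a b) ≡ false
avoidsᵗ-zero-⊝ (node c d) a b _ = trans (cong (avoidsᵗ 0 c ∧_) (isLeaf-⊝-node d a b)) (Boolₚ.∧-zeroʳ _)

-- For a positive index the condition is imposed block by block, so reversing the spine does not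
-- affect it. For index zero a tree with two blocks is rejected before and after.
avoidsᵗ-transpose : ∀ k t → avoidsᵗ k (transpose t) ≡ avoidsᵗ k t
avoidsᵗ-transpose zero    leaf = refl
avoidsᵗ-transpose (suc k) leaf = refl
avoidsᵗ-transpose zero    (node a leaf) = cong (_∧ true) (avoidsᵗ-transpose zero a)
avoidsᵗ-transpose zero    (node a (node b c)) =
  trans (avoidsᵗ-zero-⊝ (transpose c ⊝ node (transpose b) leaf) (transpose a) leaf
      (isLeaf-⊝-node (transpose c) (transpose b) leaf))
        (sym (Boolₚ.∧-zeroʳ _))
avoidsᵗ-transpose (suc k) (node a b)
  rewrite avoidsᵗ-⊝ k (transpose b) (node (transpose a) leaf)
        | avoidsᵗ-transpose k a | avoidsᵗ-transpose (suc k) b | Boolₚ.∧-identityʳ (avoidsᵗ k a) =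
  Boolₚ.∧-comm (avoidsᵗ (suc k) b) (avoidsᵗ k a)

-- A normal form for the fixed points of `transpose`: `mid` stores the first block only, since the
-- last is its inverse, and `end` holds a palindrome because a single block must be its own inverse.
data Palindrome : Set where
  nil : Palindrome
  end : Palindrome → Palindrome
  mid : Tree → Palindrome → Palindrome

toTree : Palindrome → Tree
toTree nil       = leaf
toTree (end m)   = node (toTree m) leaf
toTree (mid a m) = node a (toTree m ⊝ node (transpose a) leaf)

transpose-toTree : ∀ m → transpose (toTree m) ≡ toTree m
transpose-toTree nil       = refl
transpose-toTree (end m)   = cong (λ t → node t leaf) (transpose-toTree m)
transpose-toTree (mid a m) = begin
  transpose (toTree m ⊝ node (transpose a) leaf) ⊝ node (transpose a) leaf
    ≡⟨ cong (_⊝ node (transpose a) leaf) (transpose-⊝ (toTree m) (node (transpose a) leaf)) ⟩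
  node (transpose (transpose a)) (transpose (toTree m) ⊝ node (transpose a) leaf)
    ≡⟨ cong₂ (λ a′ m′ → node a′ (m′ ⊝ node (transpose a) leaf)) (transpose-involutive a) (transpose-toTree m) ⟩
  node a (toTree m ⊝ node (transpose a) leaf) ∎
  where open ≡-Reasoning

node-injective : ∀ {a b c d} → node a b ≡ node c d → a ≡ c × b ≡ d
node-injective refl = refl , refl

⊝-node-injective : ∀ t u {a b} → t ⊝ node a leaf ≡ u ⊝ node b leaf → t ≡ u × a ≡ b
⊝-node-injective leaf       leaf       refl = refl , refl
⊝-node-injective leaf       (node c d) eq with trans (cong isLeaf (proj₂ (node-injective eq)))
  (isLeaf-⊝-node d _ leaf)
... | ()
⊝-node-injective (node c d) leaf       eq with trans (cong isLeaf (sym (proj₂ (node-injective eq))))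
  (isLeaf-⊝-node d _ leaf)
... | ()
⊝-node-injective (node c d) (node e f) eq with node-injective eq
... | refl , eq′ with ⊝-node-injective d f eq′
... | refl , refl = refl , refl

toTree-injective : ∀ m n → toTree m ≡ toTree n → m ≡ n
toTree-injective nil       nil       _  = refl
toTree-injective nil       (end n)   ()
toTree-injective nil       (mid b n) ()
toTree-injective (end m)   nil       ()
toTree-injective (end m)   (end n)   eq = cong end (toTree-injective m n (proj₁ (node-injective eq)))
toTree-injective (end m)   (mid b n) eq
  with trans (cong isLeaf (proj₂ (node-injective eq))) (isLeaf-⊝-node (toTree n) (transpose b) leaf)
... | ()
toTree-injective (mid a m) nil       ()
toTree-injective (mid a m) (end n)   eq
  with trans (cong isLeaf (sym (proj₂ (node-injective eq)))) (isLeaf-⊝-node (toTree m) (transpose a) leaf)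
... | ()
toTree-injective (mid a m) (mid b n) eq =
  cong₂ mid (proj₁ (node-injective eq))
            (toTree-injective m n (proj₁ (⊝-node-injective (toTree m) (toTree n) (proj₂ (node-injective eq)))))

last-block : ∀ a b → ∃₂ λ t c → node a b ≡ t ⊝ node c leaf
last-block a leaf       = leaf , a , refl
last-block a (node b c) with last-block b c
... | t , d , eq = node a t , d , cong (node a) eq

-- The bound `f` carries the induction: the middle part arises by cutting the last block off the
-- spine and is not a subterm.
toTree-surjective : ∀ f t → size t ≤ f → transpose t ≡ t → ∃ λ m → toTree m ≡ t
toTree-surjective f       leaf                _       _  = nil , refl
toTree-surjective (suc f) (node a leaf)       (s≤s l) eq
  with toTree-surjective f a (subst (_≤ f) (ℕₚ.+-identityʳ (size a)) l) (proj₁ (node-injective eq))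
... | m , refl = end m , refl
toTree-surjective (suc f) (node a (node b c)) l       eq with last-block b c
... | t , d , b≡ = subst (λ u → size (node a u) ≤ suc f → transpose (node a u) ≡ node a u → ∃ λ m → toTree m
  ≡ node a u)
                         (sym b≡) step l eq
  where
  step : size (node a (t ⊝ node d leaf)) ≤ suc f →
      transpose (node a (t ⊝ node d leaf)) ≡ node a (t ⊝ node d leaf) →
         ∃ λ m → toTree m ≡ node a (t ⊝ node d leaf)
  step (s≤s l) eq
    -- The transposed tree starts with the transposed last block, so `a` is `transpose d`; what
    -- follows the first block then compares `transpose t` with `t`.
    with node-injective {a = transpose d} (trans
        (cong (_⊝ node (transpose a) leaf) (sym (transpose-⊝ t (node d leaf)))) eq)
  ... | refl , eq″ with ⊝-node-injective (transpose t) t eq″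
  ... | t≡ , d≡ with toTree-surjective f t size≤ t≡
    where
    size≤ : size t ≤ f
    size≤ = ℕₚ.≤-trans (ℕₚ.m≤m+n (size t) _) (ℕₚ.≤-trans (ℕₚ.≤-reflexive (sym (size-⊝ t (node d leaf))))
              (ℕₚ.≤-trans (ℕₚ.m≤n+m _ (size (transpose d))) l))
  ... | m , refl = mid (transpose d) m ,
    cong (λ e → node (transpose d) (toTree m ⊝ node e leaf)) (transpose-involutive d)

-- The first argument is fuel: the list is complete once it is at least the size.
trees : ℕ → ℕ → List Tree
trees f       zero    = leaf ∷ []
trees zero    (suc n) = []
trees (suc f) (suc n) = concatMap (λ i → cartesianProductWith node (trees f i) (trees f (n ∸ i))) (upTo (suc n))

-- Indexed by twice the size, to match the coefficients of R[x²].
halfTrees : ℕ → ℕ → List Tree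
halfTrees f i = if isEven i then trees f (i / 2) else []

-- In `mid a m` there are 2|a| + 2 letters outside `m`; with i = 2|a| and total size n + 1 this
-- leaves `n ∸ suc i`. Odd `i` are kept and contribute nothing, so that the sum is literally a
-- convolution with a series in x².
palindromes : ℕ → ℕ → List Palindrome
palindromes f       zero    = nil ∷ []
palindromes zero    (suc n) = []
palindromes (suc f) (suc n) = map end (palindromes f n) ++
  concatMap (λ i → cartesianProductWith mid (halfTrees f i) (palindromes f (n ∸ suc i))) (upTo n)

∈-concatMap-upTo⁻ : ∀ {A : Set} {g : ℕ → List A} n {y} → y ∈ concatMap g (upTo n) → ∃ λ i → i < n × y ∈ g i
∈-concatMap-upTo⁻ {g = g} n y∈ with find (∈ₚ.∈-concatMap⁻ g {xs = upTo n} y∈)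
... | i , i∈ , y∈i = i , ∈ₚ.∈-upTo⁻ i∈ , y∈i

∈-concatMap-upTo⁺ : ∀ {A : Set} (g : ℕ → List A) {n y} i → i < n → y ∈ g i → y ∈ concatMap g (upTo n)
∈-concatMap-upTo⁺ g {n} i i<n y∈ = ∈ₚ.∈-concatMap⁺ g {xs = upTo n}
  (Any.map (λ where refl → y∈) (∈ₚ.∈-upTo⁺ i<n))

trees-size : ∀ f n t → t ∈ trees f n → size t ≡ n
trees-size zero    zero    .leaf (here refl) = refl
trees-size (suc f) zero    .leaf (here refl) = refl
trees-size (suc f) (suc n) t t∈ with ∈-concatMap-upTo⁻ (suc n) t∈
... | i , s≤s i≤n , t∈i with ∈ₚ.∈-cartesianProductWith⁻ node (trees f i) (trees f (n ∸ i)) t∈i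
... | a , b , a∈ , b∈ , refl = cong suc (trans (cong₂ ℕ._+_ (trees-size f i a a∈) (trees-size f (n ∸ i) b b∈))
  (ℕₚ.m+[n∸m]≡n i≤n))

trees-complete : ∀ f t → size t ≤ f → t ∈ trees f (size t)
trees-complete zero    leaf       _       = here refl
trees-complete (suc f) leaf       _       = here refl
trees-complete (suc f) (node a b) (s≤s l) =
  ∈-concatMap-upTo⁺ (λ i → cartesianProductWith node (trees f i) (trees f (size a ℕ.+ size b ∸ i))) (size a)
      (s≤s (ℕₚ.m≤m+n _ _))
    (∈ₚ.∈-cartesianProductWith⁺ node (trees-complete f a (ℕₚ.≤-trans (ℕₚ.m≤m+n _ _) l))
      (subst (λ m → b ∈ trees f m) (sym (ℕₚ.m+n∸m≡n (size a) (size b)))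
          (trees-complete f b (ℕₚ.≤-trans (ℕₚ.m≤n+m _ _) l))))

-- The function `key` reads off an element the index of the list that it came from, so lists for
-- different indices are disjoint.
concatMap-unique : ∀ {A B : Set} (g : A → List B) (key : B → A) xs → Unique xs → (∀ x → Unique (g x)) →
  (∀ x y → x ∈ xs → y ∈ g x → key y ≡ x) → Unique (concatMap g xs)
concatMap-unique g key []       _        _  _  = []
concatMap-unique g key (x ∷ xs) (x∉ ∷ u) ug kg =
  Uniqueₚ.++⁺ (ug x) (concatMap-unique g key xs u ug (λ x y x∈ → kg x y (there x∈))) disjoint
  where
  disjoint : ∀ {y} → y ∈ g x × y ∈ concatMap g xs → _
  disjoint {y} (y∈x , y∈xs) with find (∈ₚ.∈-concatMap⁻ g {xs = xs} y∈xs)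
  ... | z , z∈ , y∈z = All.lookup x∉ z∈ (trans (sym (kg x y (here refl) y∈x)) (kg z y (there z∈) y∈z))

leftSize : Tree → ℕ
leftSize leaf       = 0
leftSize (node a b) = size a

trees-unique : ∀ f n → Unique (trees f n)
trees-unique f       zero    = lemma f
  where
  lemma : ∀ f → Unique (trees f 0)
  lemma zero    = [] ∷ []
  lemma (suc f) = [] ∷ []
trees-unique zero    (suc n) = []
trees-unique (suc f) (suc n) = concatMap-unique _ leftSize (upTo (suc n)) (Uniqueₚ.upTo⁺ (suc n))
  (λ i → Uniqueₚ.cartesianProductWith⁺ node node-injective (trees-unique f i) (trees-unique f (n ∸ i)))
  key
  where
  key : ∀ i t → i ∈ upTo (suc n) → t ∈ cartesianProductWith node (trees f i) (trees f (n ∸ i)) → leftSize t ≡ i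
  key i t _ t∈ with ∈ₚ.∈-cartesianProductWith⁻ node (trees f i) (trees f (n ∸ i)) t∈
  ... | a , b , a∈ , b∈ , refl = trees-size f i a a∈

halfTrees-size : ∀ f i t → t ∈ halfTrees f i → size t ℕ.+ size t ≡ i
halfTrees-size f i t t∈ = lemma i (∈-trees i t∈)
  where
  ∈-trees : ∀ i → t ∈ halfTrees f i → isEven i ≡ true × size t ≡ i / 2
  ∈-trees i t∈ with isEven i
  ... | true = refl , trees-size f (i / 2) t t∈
  half : ∀ i → isEven i ≡ true → i / 2 ℕ.+ i / 2 ≡ i
  half zero          _  = refl
  half (suc (suc i)) ev rewrite half-suc-suc i | ℕₚ.+-suc (i / 2) (i / 2) = cong (suc ∘ suc) (half i ev)
  lemma : ∀ i → isEven i ≡ true × size t ≡ i / 2 → size t ℕ.+ size t ≡ i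
  lemma i (ev , eq) rewrite eq = half i ev

half-double : ∀ n → (n ℕ.+ n) / 2 ≡ n
half-double zero    = refl
half-double (suc n) rewrite ℕₚ.+-suc n n | half-suc-suc (n ℕ.+ n) = cong suc (half-double n)

halfTrees-complete : ∀ f t → size t ≤ f → t ∈ halfTrees f (size t ℕ.+ size t)
halfTrees-complete f t l rewrite isEven-double (size t) | half-double (size t) = trees-complete f t l

halfTrees-unique : ∀ f i → Unique (halfTrees f i)
halfTrees-unique f i with isEven i
... | true  = trees-unique f (i / 2)
... | false = []

size-mid : ∀ a m → size (toTree (mid a m)) ≡ suc (suc (size a ℕ.+ size a) ℕ.+ size (toTree m))
size-mid a m rewrite size-⊝ (toTree m) (node (transpose a) leaf)
  | size-transpose a = lemma (size a) (size (toTree m))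
  where
  lemma : ∀ x y → suc (x ℕ.+ (y ℕ.+ suc (x ℕ.+ 0))) ≡ suc (suc (x ℕ.+ x) ℕ.+ y)
  lemma = solveℕ-∀

palindromes-size : ∀ f n m → m ∈ palindromes f n → size (toTree m) ≡ n
palindromes-size zero    zero    .nil (here refl) = refl
palindromes-size (suc f) zero    .nil (here refl) = refl
palindromes-size (suc f) (suc n) m m∈ with ∈ₚ.∈-++⁻ (map end (palindromes f n)) m∈
... | inj₁ m∈ with ∈ₚ.∈-map⁻ end m∈
... | m′ , m′∈ , refl = cong suc (trans (ℕₚ.+-identityʳ _) (palindromes-size f n m′ m′∈))
palindromes-size (suc f) (suc n) m _ | inj₂ m∈ with ∈-concatMap-upTo⁻ n m∈
... | i , i<n , m∈i with ∈ₚ.∈-cartesianProductWith⁻ mid (halfTrees f i) (palindromes f (n ∸ suc i)) m∈i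
... | a , m′ , a∈ , m′∈ , refl = trans (size-mid a m′) (cong suc
  (trans (cong₂ (λ x y → suc x ℕ.+ y) (halfTrees-size f i a a∈) (palindromes-size f _ m′ m′∈))
      (ℕₚ.m+[n∸m]≡n i<n)))

palindromes-complete : ∀ f m → size (toTree m) ≤ f → m ∈ palindromes f (size (toTree m))
palindromes-complete zero    nil       _       = here refl
palindromes-complete (suc f) nil       _       = here refl
palindromes-complete (suc f) (end m)   (s≤s l)
  rewrite ℕₚ.+-identityʳ (size (toTree m)) = ∈ₚ.∈-++⁺ˡ (∈ₚ.∈-map⁺ end (palindromes-complete f m l))
palindromes-complete (suc f) (mid a m) l = subst (λ n → mid a m ∈ palindromes (suc f) n) (sym (size-mid a m))
  (∈ₚ.∈-++⁺ʳ (map end (palindromes f n))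
    (∈-concatMap-upTo⁺ (λ i → cartesianProductWith mid (halfTrees f i) (palindromes f (n ∸ suc i)))
      (size a ℕ.+ size a) (s≤s (ℕₚ.m≤m+n _ _))
      (∈ₚ.∈-cartesianProductWith⁺ mid (halfTrees-complete f a
          (ℕₚ.≤-trans (ℕₚ.≤-trans (ℕₚ.m≤m+n (size a) (size a)) (ℕₚ.n≤1+n _))
              (ℕₚ.≤-trans (ℕₚ.m≤m+n _ (size (toTree m))) n≤f)))
        (subst (λ i → m ∈ palindromes f i) (sym (ℕₚ.m+n∸m≡n (size a ℕ.+ size a) (size (toTree m))))
          (palindromes-complete f m (ℕₚ.≤-trans (ℕₚ.m≤n+m (size (toTree m)) (suc (size a ℕ.+ size a))) n≤f))))))
  where
  n : ℕ
  n = suc (size a ℕ.+ size a) ℕ.+ size (toTree m)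
  n≤f : n ≤ f
  n≤f = ℕₚ.≤-pred (subst (_≤ suc f) (size-mid a m) l)

middleSize : Palindrome → ℕ
middleSize (mid a m) = size a ℕ.+ size a
middleSize _         = 0

end-injective : ∀ {m n} → end m ≡ end n → m ≡ n
end-injective refl = refl

mid-injective : ∀ {a b m n} → mid a m ≡ mid b n → a ≡ b × m ≡ n
mid-injective refl = refl , refl

palindromes-unique : ∀ f n → Unique (palindromes f n)
palindromes-unique f       zero    = lemma f
  where
  lemma : ∀ f → Unique (palindromes f 0)
  lemma zero    = [] ∷ []
  lemma (suc f) = [] ∷ []
palindromes-unique zero    (suc n) = []
palindromes-unique (suc f) (suc n) = Uniqueₚ.++⁺ (Uniqueₚ.map⁺ end-injective (palindromes-unique f n))
  (concatMap-unique mids middleSize (upTo n) (Uniqueₚ.upTo⁺ n)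
    (λ i → Uniqueₚ.cartesianProductWith⁺ mid mid-injective (halfTrees-unique f i)
        (palindromes-unique f (n ∸ suc i)))
    key)
  disjoint
  where
  mids : ℕ → List Palindrome
  mids i = cartesianProductWith mid (halfTrees f i) (palindromes f (n ∸ suc i))
  key : ∀ i m → i ∈ upTo n → m ∈ mids i → middleSize m ≡ i
  key i m _ m∈ with ∈ₚ.∈-cartesianProductWith⁻ mid (halfTrees f i) (palindromes f (n ∸ suc i)) m∈
  ... | a , m′ , a∈ , m′∈ , refl = halfTrees-size f i a a∈
  disjoint : ∀ {m} → m ∈ map end (palindromes f n) × m ∈ concatMap mids (upTo n) → _
  disjoint (e∈ , m∈) with ∈ₚ.∈-map⁻ end e∈ | ∈-concatMap-upTo⁻ n m∈
  ... | m′ , m′∈ , refl | i , i<n , m∈i with ∈ₚ.∈-cartesianProductWith⁻ mid (halfTrees f i)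
      (palindromes f (n ∸ suc i)) m∈i
  ... | _ , _ , _ , _ , ()

-- Counting trees and palindromes by their generating functions

count-trees-node : ∀ {a b : Series} (p u v : Tree → Bool) f n → n ≤ f → (∀ x y → p (node x y) ≡ u x ∧ v y) →
  (∀ i → i ≤ f → + count u (trees f i) ≡ a i) → (∀ i → i ≤ f → + count v (trees f i) ≡ b i) →
  + count p (trees (suc f) (suc n)) ≡ (a ⊛ b) n
count-trees-node {a} {b} p u v f n n≤f split eqa eqb = trans
  (count-concatMap p (λ i → cartesianProductWith node (trees f i) (trees f (n ∸ i))) (upTo (suc n)))
  (sumℤ-upTo-cong (suc n) λ where
    i (s≤s i≤n) → trans (cong +_ (count-product node u v (trees f i) (trees f (n ∸ i)) (λ x _ → split x)))
      (trans (ℤₚ.pos-* (count u (trees f i)) (count v (trees f (n ∸ i))))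
        (cong₂ ℤ._*_ (eqa i (ℕₚ.≤-trans i≤n n≤f)) (eqb (n ∸ i) (ℕₚ.≤-trans (ℕₚ.m∸n≤m n i) n≤f)))))

count-isLeaf : ∀ f n → + count isLeaf (trees f n) ≡ one n
count-isLeaf zero    zero    = refl
count-isLeaf (suc f) zero    = refl
count-isLeaf zero    (suc n) = refl
count-isLeaf (suc f) (suc n) = cong +_ (trans (count-cong (trees (suc f) (suc n)) notLeaf)
  (count-false (trees (suc f) (suc n))))
  where
  notLeaf : ∀ t → t ∈ trees (suc f) (suc n) → isLeaf t ≡ false
  notLeaf leaf       t∈ with trees-size (suc f) (suc n) leaf t∈
  ... | ()
  notLeaf (node _ _) _  = refl

R-zero : ∀ k → R (suc (suc k)) 0 ≡ + 1
R-zero k = coeff (R-recurrence k) 0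

-- For a positive index the recursion of `avoidsᵗ` is the recurrence of `R` read at one coefficient;
-- the fuel bounds the sizes at which both factors of the convolution are already known.
count-avoidsᵗ : ∀ k f n → n ≤ f → + count (avoidsᵗ k) (trees f n) ≡ R (suc (suc k)) n
count-avoidsᵗ zero    zero    zero    _       = sym (R-zero 0)
count-avoidsᵗ (suc k) zero    zero    _       = sym (R-zero (suc k))
count-avoidsᵗ zero    (suc f) zero    _       = sym (R-zero 0)
count-avoidsᵗ (suc k) (suc f) zero    _       = sym (R-zero (suc k))
-- With index zero the right subtree is a leaf, so the convolution is with `one`, and one tree of
-- each size remains.
count-avoidsᵗ zero    (suc f) (suc n) (s≤s l) = trans
  (count-trees-node (avoidsᵗ 0) (avoidsᵗ 0) isLeaf f n l (λ _ _ → refl) (count-avoidsᵗ 0 f)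
      (λ i _ → count-isLeaf f i))
  (trans (trans (⊛-comm-at (R 2) one n) (one-⊛-at (R 2) n)) (trans (R-two n) (sym (R-two (suc n)))))
count-avoidsᵗ (suc k) (suc f) (suc n) (s≤s l) = trans
  (count-trees-node (avoidsᵗ (suc k)) (avoidsᵗ k) (avoidsᵗ (suc k)) f n l (λ _ _ → refl) (count-avoidsᵗ k f)
      (count-avoidsᵗ (suc k) f))
  (sym (trans (coeff (R-recurrence (suc k)) (suc n))
      (trans (ℤₚ.+-identityˡ _) (X-⊛-suc (R (suc (suc k)) ⊛ R (suc (suc (suc k)))) n))))

1^n≡1 : ∀ n → (+ 1) ℤ.^ n ≡ + 1
1^n≡1 zero    = refl
1^n≡1 (suc n) = trans (ℤₚ.*-identityˡ _) (1^n≡1 n)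

-1^n : ∀ n → (- + 1) ℤ.^ n ≡ (if isEven n then + 1 else - + 1)
-1^n zero    = refl
-1^n (suc n) rewrite isEven-suc n | -1^n n with isEven n
... | true  = refl
... | false = refl

count-halfTrees : ∀ k f i → i ≤ f → + count (avoidsᵗ k) (halfTrees f i) ≡ R[x²] (suc (suc k)) i
count-halfTrees k f i i≤f with isEven i
... | false = refl
... | true  = trans (count-avoidsᵗ k f (i / 2) (ℕₚ.≤-trans (m/n≤m i 2) i≤f))
  (sym (trans (cong (ℤ._* R (suc (suc k)) (i / 2)) (1^n≡1 (i / 2))) (ℤₚ.*-identityˡ _)))

evenᵖ : Palindrome → Bool
evenᵖ m = isEven (inversions (toTree m))

avoidsᵗ-end : ∀ k m → avoidsᵗ (suc k) (toTree (end m)) ≡ avoidsᵗ k (toTree m)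
avoidsᵗ-end k m = Boolₚ.∧-identityʳ _

-- The two outer blocks are mutually inverse and pass or fail together. One condition covers both,
-- which is why they contribute the series at x² and not its square.
avoidsᵗ-mid : ∀ k a m → avoidsᵗ (suc k) (toTree (mid a m)) ≡ avoidsᵗ k a ∧ avoidsᵗ (suc k) (toTree m)
avoidsᵗ-mid k a m rewrite avoidsᵗ-⊝ k (toTree m) (node (transpose a) leaf) | avoidsᵗ-transpose k a
  with avoidsᵗ k a
... | true  = Boolₚ.∧-identityʳ _
... | false = refl

avoidsᵗ-zero-mid : ∀ a m → avoidsᵗ 0 (toTree (mid a m)) ≡ false
avoidsᵗ-zero-mid a m = trans (cong (avoidsᵗ 0 a ∧_) (isLeaf-⊝-node (toTree m) (transpose a) leaf))
  (Boolₚ.∧-zeroʳ _)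

even-end : ∀ m → evenᵖ (end m) ≡ evenᵖ m
even-end m = cong isEven (lemma (inversions (toTree m)) (size (toTree m)))
  where
  lemma : ∀ x y → x ℕ.+ 0 ℕ.+ suc y ℕ.* 0 ≡ x
  lemma = solveℕ-∀

isEven-double-+ : ∀ m n → isEven (m ℕ.+ m ℕ.+ n) ≡ isEven n
isEven-double-+ m n = trans (isEven-+ (m ℕ.+ m) n)
  (trans (cong (λ b → not (b xor isEven n)) (isEven-double m)) (Boolₚ.not-involutive _))

isEven-square : ∀ n → isEven (n ℕ.* n) ≡ isEven n
isEven-square zero          = refl
isEven-square (suc zero)    = refl
isEven-square (suc (suc n)) =
  trans (cong isEven (lemma n)) (trans (isEven-double-+ (n ℕ.+ n ℕ.+ 2) (n ℕ.* n)) (isEven-square n))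
  where
  lemma : ∀ n → suc (suc n) ℕ.* suc (suc n) ≡ (n ℕ.+ n ℕ.+ 2) ℕ.+ (n ℕ.+ n ℕ.+ 2) ℕ.+ n ℕ.* n
  lemma = solveℕ-∀

-- The doubled part `c` collects the inversions within each outer block and those between an outer
-- block and `m`; the square counts the pairs between the two outer blocks, each of `suc (size a)`
-- letters with its maximum.
inversions-mid : ∀ a m → ∃ λ c → inversions (toTree (mid a m))
  ≡ c ℕ.+ c ℕ.+ (suc (size a) ℕ.* suc (size a) ℕ.+ inversions (toTree m))
inversions-mid a m
  rewrite inversions-⊝ (toTree m) (node (transpose a) leaf) | size-⊝ (toTree m) (node (transpose a) leaf)
        | inversions-transpose a | size-transpose a =
  inversions a ℕ.+ suc (size a) ℕ.* size (toTree m) ,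
  lemma (inversions a) (inversions (toTree m)) (size a) (size (toTree m))
  where
  lemma : ∀ x y a m → x ℕ.+ (y ℕ.+ (x ℕ.+ 0 ℕ.+ suc a ℕ.* 0) ℕ.+ m ℕ.* suc (a ℕ.+ 0))
      ℕ.+ suc a ℕ.* (m ℕ.+ suc (a ℕ.+ 0))
    ≡ (x ℕ.+ suc a ℕ.* m) ℕ.+ (x ℕ.+ suc a ℕ.* m) ℕ.+ (suc a ℕ.* suc a ℕ.+ y)
  lemma = solveℕ-∀

even-mid : ∀ a m → evenᵖ (mid a m) ≡ (if isEven (size a) then not (evenᵖ m) else evenᵖ m)
even-mid a m with inversions-mid a m
... | c , eq rewrite eq
  | isEven-double-+ c (suc (size a) ℕ.* suc (size a) ℕ.+ inversions (toTree m))
  | isEven-+ (suc (size a) ℕ.* suc (size a)) (inversions (toTree m))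
  | isEven-square (suc (size a)) | isEven-suc (size a)
  with isEven (size a)
... | true  = refl
... | false = Boolₚ.not-involutive _

-- The values `g` of the `mid` part are left open: for plain avoidance they are products of
-- coefficients, while for even palindromes they are evaluated only after a correction has been
-- added.
count-palindromes-suc : ∀ (p u : Palindrome → Bool) (g : ℕ → ℤ) f n → (∀ m → p (end m) ≡ u m) →
  (∀ i → i < n → + count p (cartesianProductWith mid (halfTrees f i) (palindromes f (n ∸ suc i))) ≡ g i) →
  + count p (palindromes (suc f) (suc n)) ≡ + count u (palindromes f n) ℤ.+ sumℤ (map g (upTo n))
count-palindromes-suc p u g f n eq eqg = trans (cong +_ (count-++ p (map end (palindromes f n)) _))
  (cong₂ ℤ._+_ (cong +_ (trans (count-map p end (palindromes f n))
      (count-cong (palindromes f n) (λ m _ → eq m))))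
    (trans (count-concatMap p (λ i → cartesianProductWith mid (halfTrees f i) (palindromes f (n ∸ suc i)))
        (upTo n))
           (sumℤ-upTo-cong n eqg)))

-- For n = 0 both sides vanish; otherwise x² lowers the degree by two. The range of the sum is that
-- of the `mid` part of `palindromes`.
X²-⊛-suc : ∀ a b n → (X ⊛ X ⊛ (a ⊛ b)) (suc n) ≡ sumℤ (map (λ i → a i ℤ.* b (n ∸ suc i)) (upTo n))
X²-⊛-suc a b zero    = trans (coeff (S.*-assoc X X (a ⊛ b)) 1) (X-⊛-suc (X ⊛ (a ⊛ b)) 0)
X²-⊛-suc a b (suc n) = X-⊛-X-⊛ (a ⊛ b) n

sumℤ-0 : ∀ {A : Set} (xs : List A) → sumℤ (map (λ _ → + 0) xs) ≡ + 0
sumℤ-0 []       = refl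
sumℤ-0 (x ∷ xs) = trans (ℤₚ.+-identityˡ _) (sumℤ-0 xs)

F-zero : ∀ k → F (suc (suc k)) 0 ≡ + 1
F-zero k = coeff (F-recurrence k) 0

n∸suc-i≤f : ∀ {n f} i → n ≤ f → n ∸ suc i ≤ f
n∸suc-i≤f {n} i = ℕₚ.≤-trans (ℕₚ.m∸n≤m n (suc i))

count-palindromes : ∀ k f n → n ≤ f → + count (avoidsᵗ k ∘ toTree) (palindromes f n) ≡ F (suc (suc k)) n
count-palindromes zero    zero    zero    _       = sym (F-zero 0)
count-palindromes (suc k) zero    zero    _       = sym (F-zero (suc k))
count-palindromes zero    (suc f) zero    _       = sym (F-zero 0)
count-palindromes (suc k) (suc f) zero    _       = sym (F-zero (suc k))
count-palindromes zero    (suc f) (suc n) (s≤s l) = trans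
  (count-palindromes-suc (avoidsᵗ 0 ∘ toTree) (avoidsᵗ 0 ∘ toTree) (λ _ → + 0) f n (λ m → Boolₚ.∧-identityʳ _)
    (λ i i<n → cong +_ (trans
      (count-product mid (λ _ → false) (λ _ → false) (halfTrees f i) (palindromes f (n ∸ suc i))
          (λ a _ → avoidsᵗ-zero-mid a))
      (cong (ℕ._* count (λ _ → false) (palindromes f (n ∸ suc i))) (count-false (halfTrees f i))))))
  (trans (cong₂ ℤ._+_ (count-palindromes 0 f n l) (sumℤ-0 (upTo n)))
    (trans (ℤₚ.+-identityʳ _) (trans (F-two n) (sym (F-two (suc n))))))
count-palindromes (suc k) (suc f) (suc n) (s≤s l) = trans
  (count-palindromes-suc (avoidsᵗ (suc k) ∘ toTree) (avoidsᵗ k ∘ toTree)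
    (λ i → R[x²] (suc (suc k)) i ℤ.* F (suc (suc (suc k))) (n ∸ suc i)) f n (avoidsᵗ-end k)
    (λ i i<n → trans (cong +_ (count-product mid (avoidsᵗ k) (avoidsᵗ (suc k) ∘ toTree) (halfTrees f i)
        (palindromes f (n ∸ suc i)) (λ a _ → avoidsᵗ-mid k a)))
      (trans (ℤₚ.pos-* (count (avoidsᵗ k) (halfTrees f i))
          (count (avoidsᵗ (suc k) ∘ toTree) (palindromes f (n ∸ suc i))))
        (cong₂ ℤ._*_ (count-halfTrees k f i (ℕₚ.≤-trans (ℕₚ.<⇒≤ i<n) l))
                     (count-palindromes (suc k) f (n ∸ suc i) (n∸suc-i≤f {n} i l))))))
  (trans (cong (ℤ._+ sumℤ (map (λ i → R[x²] (suc (suc k)) i ℤ.* F (suc (suc (suc k))) (n ∸ suc i)) (upTo n)))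
      (count-palindromes k f n l))
  (sym (trans (coeff (F-recurrence (suc k)) (suc n))
    (cong₂ ℤ._+_ (trans (ℤₚ.+-identityˡ _) (X-⊛-suc (F (suc (suc k))) n))
        (X²-⊛-suc (R[x²] (suc (suc k))) (F (suc (suc (suc k)))) n)))))

rhs-zero : ∀ k → rhs (suc (suc k)) 0 ≡ + 1
rhs-zero zero    = rhs-two 0
rhs-zero (suc k) = trans (sym (ℤₚ.+-identityʳ _)) (coeff (rhs-recurrence k) 0)

avoidsEven : ℕ → Palindrome → Bool
avoidsEven k m = avoidsᵗ k (toTree m) ∧ evenᵖ m

avoidsEven-mid : ∀ k a m → avoidsEven (suc k) (mid a m) ≡
  avoidsᵗ k a ∧ (avoidsᵗ (suc k) (toTree m) ∧ (if isEven (size a) then not (evenᵖ m) else evenᵖ m))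
avoidsEven-mid k a m = trans (cong₂ _∧_ (avoidsᵗ-mid k a m) (even-mid a m))
  (Boolₚ.∧-assoc (avoidsᵗ k a) (avoidsᵗ (suc k) (toTree m)) _)

-- The outer blocks add |a| + 1 to the parity, so m has to be odd if |a| is even, and even otherwise; the
-- odd palindromes are counted as the difference of all and the even ones, moved here to the left-hand side.
count-mids : ∀ k f i n {E : ℤ} → i ≤ f → n ≤ f → + count (avoidsEven (suc k)) (palindromes f n) ≡ E →
  + count (avoidsEven (suc k)) (cartesianProductWith mid (halfTrees f i) (palindromes f n))
      ℤ.+ R[-x²] (suc (suc k)) i ℤ.* E
  ≡ Re[x²] (suc (suc k)) i ℤ.* F (suc (suc (suc k))) n
count-mids k f i n i≤f n≤f refl with isEven i
... | false = refl
... | true rewrite 1^n≡1 (i / 2) | -1^n (i / 2)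
                 | sym (count-avoidsᵗ k f (i / 2) (ℕₚ.≤-trans (m/n≤m i 2) i≤f)) with isEven (i / 2) in ev
...   | true = begin
    + count (avoidsEven (suc k)) (cartesianProductWith mid (trees f (i / 2)) ps) ℤ.+ (+ 1) ℤ.* (+ P) ℤ.* (+ Ev)
      ≡⟨ cong (λ c → + c ℤ.+ (+ 1) ℤ.* (+ P) ℤ.* (+ Ev)) (count-product mid (avoidsᵗ k) odd (trees f (i / 2)) ps
           (λ a a∈ m → trans (avoidsEven-mid k a m)
               (cong (λ b → avoidsᵗ k a ∧ (avoidsᵗ (suc k) (toTree m) ∧ (if b then not (evenᵖ m) else evenᵖ m)))
             (trans (cong isEven (trees-size f (i / 2) a a∈)) ev)))) ⟩
    + (P ℕ.* Od) ℤ.+ (+ 1) ℤ.* (+ P) ℤ.* (+ Ev)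
      ≡⟨ cong (ℤ._+ (+ 1) ℤ.* (+ P) ℤ.* (+ Ev)) (ℤₚ.pos-* P Od) ⟩
    (+ P) ℤ.* (+ Od) ℤ.+ (+ 1) ℤ.* (+ P) ℤ.* (+ Ev)
      ≡⟨ lemma (+ P) (+ Od) (+ Ev) ⟩
    (+ 1) ℤ.* (+ P) ℤ.* ((+ Ev) ℤ.+ (+ Od))
      ≡⟨ cong (λ c → (+ 1) ℤ.* (+ P) ℤ.* (+ c)) (count-split (avoidsᵗ (suc k) ∘ toTree) evenᵖ ps) ⟩
    (+ 1) ℤ.* (+ P) ℤ.* (+ count (avoidsᵗ (suc k) ∘ toTree) ps)
      ≡⟨ cong ((+ 1) ℤ.* (+ P) ℤ.*_) (count-palindromes (suc k) f n n≤f) ⟩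
    (+ 1) ℤ.* (+ P) ℤ.* F (suc (suc (suc k))) n ∎
  where
  open ≡-Reasoning
  ps : List Palindrome
  ps = palindromes f n
  odd : Palindrome → Bool
  odd m = avoidsᵗ (suc k) (toTree m) ∧ not (evenᵖ m)
  P Ev Od : ℕ
  P  = count (avoidsᵗ k) (trees f (i / 2))
  Ev = count (avoidsEven (suc k)) ps
  Od = count odd ps
  lemma : ∀ p o e → p ℤ.* o ℤ.+ (+ 1) ℤ.* p ℤ.* e ≡ (+ 1) ℤ.* p ℤ.* (e ℤ.+ o)
  lemma = solve-∀
...   | false = begin
    + count (avoidsEven (suc k)) (cartesianProductWith mid (trees f (i / 2)) ps)
        ℤ.+ (- + 1) ℤ.* (+ P) ℤ.* (+ Ev)
      ≡⟨ cong (λ c → + c ℤ.+ (- + 1) ℤ.* (+ P) ℤ.* (+ Ev))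
          (count-product mid (avoidsᵗ k) (avoidsEven (suc k)) (trees f (i / 2)) ps
           (λ a a∈ m → trans (avoidsEven-mid k a m)
               (cong (λ b → avoidsᵗ k a ∧ (avoidsᵗ (suc k) (toTree m) ∧ (if b then not (evenᵖ m) else evenᵖ m)))
             (trans (cong isEven (trees-size f (i / 2) a a∈)) ev)))) ⟩
    + (P ℕ.* Ev) ℤ.+ (- + 1) ℤ.* (+ P) ℤ.* (+ Ev)
      ≡⟨ cong (ℤ._+ (- + 1) ℤ.* (+ P) ℤ.* (+ Ev)) (ℤₚ.pos-* P Ev) ⟩
    (+ P) ℤ.* (+ Ev) ℤ.+ (- + 1) ℤ.* (+ P) ℤ.* (+ Ev)
      ≡⟨ lemma (+ P) (+ Ev) ⟩
    + 0 ∎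
  where
  open ≡-Reasoning
  ps : List Palindrome
  ps = palindromes f n
  P Ev : ℕ
  P  = count (avoidsᵗ k) (trees f (i / 2))
  Ev = count (avoidsEven (suc k)) ps
  lemma : ∀ p e → p ℤ.* e ℤ.+ (- + 1) ℤ.* p ℤ.* e ≡ + 0
  lemma = solve-∀

avoidsEven-end : ∀ k m → avoidsEven (suc k) (end m) ≡ avoidsEven k m
avoidsEven-end k m = cong₂ _∧_ (avoidsᵗ-end k m) (even-end m)

avoidsEven-zero-mid : ∀ a m → avoidsEven 0 (mid a m) ≡ false
avoidsEven-zero-mid a m = cong (_∧ evenᵖ (mid a m)) (avoidsᵗ-zero-mid a m)

-- The recurrence of `rhs` has the convolution `w` on its left, so the sum over `w` is added to both
-- sides and cancelled at the end. The induction hypothesis serves at the preceding index for the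
-- `end` part and at the same index, for smaller sizes, in `count-mids`.
count-avoidsEven : ∀ k f n → n ≤ f → + count (avoidsEven k) (palindromes f n) ≡ rhs (suc (suc k)) n
count-avoidsEven zero    zero    zero    _       = sym (rhs-zero 0)
count-avoidsEven (suc k) zero    zero    _       = sym (rhs-zero (suc k))
count-avoidsEven zero    (suc f) zero    _       = sym (rhs-zero 0)
count-avoidsEven (suc k) (suc f) zero    _       = sym (rhs-zero (suc k))
count-avoidsEven zero    (suc f) (suc n) (s≤s l) = trans
  (count-palindromes-suc (avoidsEven 0) (avoidsEven 0) (λ _ → + 0) f n
    (λ m → cong₂ _∧_ (Boolₚ.∧-identityʳ (avoidsᵗ 0 (toTree m))) (even-end m))
    (λ i i<n → cong +_ (trans
      (count-product mid (λ _ → false) (λ _ → false) (halfTrees f i) (palindromes f (n ∸ suc i))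
          (λ a _ → avoidsEven-zero-mid a))
      (cong (ℕ._* count (λ _ → false) (palindromes f (n ∸ suc i))) (count-false (halfTrees f i))))))
  (trans (cong₂ ℤ._+_ (count-avoidsEven 0 f n l) (sumℤ-0 (upTo n)))
    (trans (ℤₚ.+-identityʳ _) (trans (rhs-two n) (sym (rhs-two (suc n))))))
count-avoidsEven (suc k) (suc f) (suc n) (s≤s l) = ℤGroup.∙-cancelʳ (sumℤ (map w (upTo n))) _ _ (begin
  + count (avoidsEven (suc k)) (palindromes (suc f) (suc n)) ℤ.+ sumℤ (map w (upTo n))
    ≡⟨ cong (ℤ._+ sumℤ (map w (upTo n))) (count-palindromes-suc (avoidsEven (suc k)) (avoidsEven k) g f n
        (avoidsEven-end k) (λ _ _ → refl)) ⟩
  + count (avoidsEven k) (palindromes f n) ℤ.+ sumℤ (map g (upTo n)) ℤ.+ sumℤ (map w (upTo n))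
    ≡⟨ ℤₚ.+-assoc (+ count (avoidsEven k) (palindromes f n)) (sumℤ (map g (upTo n))) (sumℤ (map w (upTo n))) ⟩
  + count (avoidsEven k) (palindromes f n) ℤ.+ (sumℤ (map g (upTo n)) ℤ.+ sumℤ (map w (upTo n)))
    ≡⟨ cong₂ ℤ._+_ (count-avoidsEven k f n l) (sym (sumℤ-+ g w (upTo n))) ⟩
  rhs k₂ n ℤ.+ sumℤ (map (λ i → g i ℤ.+ w i) (upTo n))
    ≡⟨ cong (ℤ._+_ (rhs k₂ n)) (sumℤ-upTo-cong n
        (λ i i<n → count-mids k f i (n ∸ suc i) (ℕₚ.≤-trans (ℕₚ.<⇒≤ i<n) l) (n∸suc-i≤f {n} i l)
         (count-avoidsEven (suc k) f (n ∸ suc i) (n∸suc-i≤f {n} i l)))) ⟩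
  rhs k₂ n ℤ.+ sumℤ (map (λ i → Re[x²] k₂ i ℤ.* F k₃ (n ∸ suc i)) (upTo n))
    ≡⟨ ℤₚ.+-comm (rhs k₂ n) _ ⟩
  sumℤ (map (λ i → Re[x²] k₂ i ℤ.* F k₃ (n ∸ suc i)) (upTo n)) ℤ.+ rhs k₂ n
    ≡⟨ cong₂ ℤ._+_ (trans (ℤₚ.+-identityˡ _) (X²-⊛-suc (Re[x²] k₂) (F k₃) n)) (X-⊛-suc (rhs k₂) n) ⟨
  (one ⊕ X ⊛ X ⊛ (Re[x²] k₂ ⊛ F k₃) ⊕ X ⊛ rhs k₂) (suc n)
    ≡⟨ coeff (rhs-recurrence k) (suc n) ⟨
  rhs k₃ (suc n) ℤ.+ (X ⊛ X ⊛ (R[-x²] k₂ ⊛ rhs k₃)) (suc n)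
    ≡⟨ cong (ℤ._+_ (rhs k₃ (suc n))) (X²-⊛-suc (R[-x²] k₂) (rhs k₃) n) ⟩
  rhs k₃ (suc n) ℤ.+ sumℤ (map w (upTo n)) ∎)
  where
  open ≡-Reasoning
  k₂ k₃ : ℕ
  k₂ = suc (suc k)
  k₃ = suc k₂
  g w : ℕ → ℤ
  g i = + count (avoidsEven (suc k)) (cartesianProductWith mid (halfTrees f i) (palindromes f (n ∸ suc i)))
  w i = R[-x²] k₂ i ℤ.* rhs k₃ (n ∸ suc i)

-- Pattern containment

<ᵇ-true : ∀ {m n} → m < n → (m <ᵇ n) ≡ true
<ᵇ-true {m} {n} m<n with m <ᵇ n | ℕₚ.<⇒<ᵇ m<n
... | true | _ = refl

<ᵇ-true⁻ : ∀ {m n} → (m <ᵇ n) ≡ true → m < n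
<ᵇ-true⁻ {m} {n} eq = ℕₚ.<ᵇ⇒< m n (subst T (sym eq) tt)

<ᵇ-false : ∀ {m n} → n ≤ m → (m <ᵇ n) ≡ false
<ᵇ-false {m} {n} n≤m with m <ᵇ n in eq
... | false = refl
... | true  = ⊥-elim (ℕₚ.<⇒≱ (<ᵇ-true⁻ eq) n≤m)

≡ᵇ-true : ∀ {m n} → m ≡ n → (m ≡ᵇ n) ≡ true
≡ᵇ-true {zero}  refl = refl
≡ᵇ-true {suc m} refl = ≡ᵇ-true {m} refl

≡ᵇ-true⁻ : ∀ {m n} → (m ≡ᵇ n) ≡ true → m ≡ n
≡ᵇ-true⁻ {zero}  {zero}  _  = refl
≡ᵇ-true⁻ {suc m} {suc n} eq = cong suc (≡ᵇ-true⁻ eq)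

∧-true⁻ : ∀ {x y} → x ∧ y ≡ true → x ≡ true × y ≡ true
∧-true⁻ {true} {true} _ = refl , refl

all-true : ∀ {A : Set} {p : A → Bool} xs → (∀ x → x ∈ xs → p x ≡ true) → all p xs ≡ true
all-true []       h = refl
all-true (x ∷ xs) h = cong₂ _∧_ (h x (here refl)) (all-true xs (λ y y∈ → h y (there y∈)))

all-true⁻ : ∀ {A : Set} {p : A → Bool} {xs} → all p xs ≡ true → ∀ x → x ∈ xs → p x ≡ true
all-true⁻ {p = p} {x ∷ xs} eq .x (here refl) = proj₁ (∧-true⁻ {p x} eq)
all-true⁻ {p = p} {x ∷ xs} eq y  (there y∈)  = all-true⁻ (proj₂ (∧-true⁻ {p x} eq)) y y∈

∧-false⁻ : ∀ {x y} → x ≡ true → x ∧ y ≡ false → y ≡ false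
∧-false⁻ refl eq = eq

all-false⁻ : ∀ {A : Set} {p : A → Bool} xs → all p xs ≡ false → ∃ λ x → x ∈ xs × p x ≡ false
all-false⁻ {p = p} (x ∷ xs) eq with p x in px
... | false = x , here refl , px
... | true with all-false⁻ xs eq
... | y , y∈ , py = y , there y∈ , py

any-true : ∀ {A : Set} {p : A → Bool} {xs} x → x ∈ xs → p x ≡ true → any p xs ≡ true
any-true x (here refl) eq rewrite eq = refl
any-true {p = p} {y ∷ ys} x (there x∈)  eq rewrite any-true {p = p} x x∈ eq = Boolₚ.∨-zeroʳ _

any-true⁻ : ∀ {A : Set} (p : A → Bool) xs → any p xs ≡ true → ∃ λ x → x ∈ xs × p x ≡ true
any-true⁻ p (x ∷ xs) eq with p x in px
... | true  = x , here refl , px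
... | false with any-true⁻ p xs eq
... | y , y∈ , py = y , there y∈ , py

at-++ˡ : ∀ xs ys i → i < length xs → at (xs ++ ys) i ≡ at xs i
at-++ˡ (x ∷ xs) ys zero    _       = refl
at-++ˡ (x ∷ xs) ys (suc i) (s≤s l) = at-++ˡ xs ys i l

at-++ʳ : ∀ xs ys i → at (xs ++ ys) (length xs ℕ.+ i) ≡ at ys i
at-++ʳ []       ys i = refl
at-++ʳ (x ∷ xs) ys i = at-++ʳ xs ys i

at-last : ∀ xs y → at (xs ++ y ∷ []) (length xs) ≡ y
at-last []       y = refl
at-last (x ∷ xs) y = at-last xs y

at-map : ∀ (f : ℕ → ℕ) xs i → i < length xs → at (map f xs) i ≡ f (at xs i)
at-map f (x ∷ xs) zero    _       = refl
at-map f (x ∷ xs) (suc i) (s≤s l) = at-map f xs i l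

at-∈ : ∀ xs i → i < length xs → at xs i ∈ xs
at-∈ (x ∷ xs) zero    _       = here refl
at-∈ (x ∷ xs) (suc i) (s≤s l) = there (at-∈ xs i l)

at-extensional : ∀ xs ys → length xs ≡ length ys → (∀ i → i < length xs → at xs i ≡ at ys i) → xs ≡ ys
at-extensional []       []       _  _ = refl
at-extensional (x ∷ xs) (y ∷ ys) eq h = cong₂ _∷_ (h 0 (s≤s z≤n))
  (at-extensional xs ys (ℕₚ.suc-injective eq) (λ i i< → h (suc i) (s≤s i<)))

length-snoc : ∀ {A : Set} (xs : List A) y → length (xs ++ y ∷ []) ≡ suc (length xs)
length-snoc []       y = refl
length-snoc (x ∷ xs) y = cong suc (length-snoc xs y)

subseqs-sound : ∀ w {u} → u ∈ subseqs w → u ⊆ w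
subseqs-sound []      (here refl) = []
subseqs-sound (x ∷ w) u∈ with ∈ₚ.∈-++⁻ (map (x ∷_) (subseqs w)) u∈
... | inj₂ u∈ = x ∷ⁿ subseqs-sound w u∈
... | inj₁ u∈ with ∈ₚ.∈-map⁻ (x ∷_) u∈
... | v , v∈ , refl = refl ∷ subseqs-sound w v∈

subseqs-complete : ∀ {u w} → u ⊆ w → u ∈ subseqs w
subseqs-complete []         = here refl
subseqs-complete {w = x ∷ w} (.x ∷ⁿ u⊆)  = ∈ₚ.∈-++⁺ʳ (map (x ∷_) (subseqs w)) (subseqs-complete u⊆)
subseqs-complete (refl ∷ u⊆) = ∈ₚ.∈-++⁺ˡ (∈ₚ.∈-map⁺ _ (subseqs-complete u⊆))

record Iso (p u : List ℕ) : Set where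
  constructor iso
  field
    length≡ : length u ≡ length p
    order≡  : ∀ i j → i < length p → j < length p → (at u i <ᵇ at u j) ≡ (at p i <ᵇ at p j)
open Iso

Contains : List ℕ → List ℕ → Set
Contains w p = ∃ λ u → u ⊆ w × Iso p u

orderIso-sound : ∀ p u → orderIso p u ≡ true → Iso p u
orderIso-sound p u eq = iso (≡ᵇ-true⁻ (proj₁ (∧-true⁻ {length u ≡ᵇ length p} eq))) order
  where
  order : ∀ i j → i < length p → j < length p → (at u i <ᵇ at u j) ≡ (at p i <ᵇ at p j)
  order i j i< j< with at u i <ᵇ at u j | at p i <ᵇ at p j
    | all-true⁻ (all-true⁻ (proj₂ (∧-true⁻ {length u ≡ᵇ length p} eq)) i (∈ₚ.∈-upTo⁺ i<)) j (∈ₚ.∈-upTo⁺ j<)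
  ... | true  | true  | _ = refl
  ... | false | false | _ = refl

-- By contradiction, because the comparison local to orderIso has no name to state a goal with.
orderIso-complete : ∀ p u → Iso p u → orderIso p u ≡ true
orderIso-complete p u (iso len rel) with orderIso p u in eq
... | true  = refl
... | false with all-false⁻ (upTo (length p)) (∧-false⁻ {length u ≡ᵇ length p} (≡ᵇ-true len) eq)
... | i , i∈ , eqᵢ with all-false⁻ (upTo (length p)) eqᵢ
... | j , j∈ , eqⱼ with at u i <ᵇ at u j | at p i <ᵇ at p j | rel i j (∈ₚ.∈-upTo⁻ i∈) (∈ₚ.∈-upTo⁻ j∈) | eqⱼ
... | true  | true  | _ | ()
... | false | false | _ | ()

contains-true : ∀ w p → Contains w p → contains w p ≡ true
contains-true w p (u , u⊆ , u≅) = any-true u (subseqs-complete u⊆) (orderIso-complete p u u≅)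

contains-true⁻ : ∀ w p → contains w p ≡ true → Contains w p
contains-true⁻ w p eq with any-true⁻ (orderIso p) (subseqs w) eq
... | u , u∈ , u≅ = u , subseqs-sound w u∈ , orderIso-sound p u u≅

contains-mono : ∀ {w w′ p} → w ⊆ w′ → Contains w p → Contains w′ p
contains-mono w⊆ (u , u⊆ , u≅) = u , ⊆-trans u⊆ w⊆ , u≅

⊆-++⁻ : ∀ xs {ys u : List ℕ} → u ⊆ xs ++ ys → ∃₂ λ v v′ → u ≡ v ++ v′ × v ⊆ xs × v′ ⊆ ys
⊆-++⁻ []       {u = u} u⊆ = [] , u , refl , [] , u⊆
⊆-++⁻ (x ∷ xs) (.x ∷ⁿ u⊆) with ⊆-++⁻ xs u⊆
... | v , v′ , eq , v⊆ , v′⊆ = v , v′ , eq , x ∷ⁿ v⊆ , v′⊆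
⊆-++⁻ (x ∷ xs) (refl ∷ u⊆) with ⊆-++⁻ xs u⊆
... | v , v′ , eq , v⊆ , v′⊆ = x ∷ v , v′ , cong (x ∷_) eq , refl ∷ v⊆ , v′⊆

⊆-map⁻ : ∀ (f : ℕ → ℕ) xs {u} → u ⊆ map f xs → ∃ λ v → u ≡ map f v × v ⊆ xs
⊆-map⁻ f []       []          = [] , refl , []
⊆-map⁻ f (x ∷ xs) (._ ∷ⁿ u⊆)  with ⊆-map⁻ f xs u⊆
... | v , eq , v⊆ = v , eq , x ∷ⁿ v⊆
⊆-map⁻ f (x ∷ xs) (refl ∷ u⊆) with ⊆-map⁻ f xs u⊆
... | v , eq , v⊆ = x ∷ v , cong (f x ∷_) eq , refl ∷ v⊆

<ᵇ-+ : ∀ c m n → (c ℕ.+ m <ᵇ c ℕ.+ n) ≡ (m <ᵇ n)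
<ᵇ-+ zero    m n = refl
<ᵇ-+ (suc c) m n = <ᵇ-+ c m n

at-shift-<ᵇ : ∀ c u i j → i < length u → j < length u →
  (at (map (c ℕ.+_) u) i <ᵇ at (map (c ℕ.+_) u) j) ≡ (at u i <ᵇ at u j)
at-shift-<ᵇ c u i j i< j< = trans (cong₂ _<ᵇ_ (at-map (c ℕ.+_) u i i<) (at-map (c ℕ.+_) u j j<))
  (<ᵇ-+ c (at u i) (at u j))

contains-shift : ∀ c w {p} → Contains w p → Contains (map (c ℕ.+_) w) p
contains-shift c w {p} (u , u⊆ , iso len rel) = map (c ℕ.+_) u , ⊆ₚ.map⁺ (c ℕ.+_) u⊆ ,
  iso (trans (Listₚ.length-map (c ℕ.+_) u) len) λ i j i< j< →
    trans (at-shift-<ᵇ c u i j (subst (i <_) (sym len) i<) (subst (j <_) (sym len) j<)) (rel i j i< j<)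

contains-shift⁻ : ∀ c w {p} → Contains (map (c ℕ.+_) w) p → Contains w p
contains-shift⁻ c w {p} (u , u⊆ , iso len rel) with ⊆-map⁻ (c ℕ.+_) w u⊆
... | v , refl , v⊆ = v , v⊆ , iso len′ λ i j i< j< →
    trans (sym (at-shift-<ᵇ c v i j (subst (i <_) (sym len′) i<) (subst (j <_) (sym len′) j<))) (rel i j i< j<)
  where
  len′ : length v ≡ length p
  len′ = trans (sym (Listₚ.length-map (c ℕ.+_) v)) len

-- A pattern whose first letter is smaller than its last cannot straddle a descending cut.
contains-skew⁻ : ∀ xs ys {p} l → length p ≡ suc l → at p 0 < at p l →
  (∀ x y → x ∈ xs → y ∈ ys → y < x) → Contains (xs ++ ys) p → Contains xs p ⊎ Contains ys p
contains-skew⁻ xs ys {p} l plen p0<pl desc (u , u⊆ , u≅) with ⊆-++⁻ xs u⊆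
... | []    , v′     , refl , _  , v′⊆ = inj₂ (v′ , v′⊆ , u≅)
... | x ∷ v , []     , refl , v⊆ , _   = inj₁ (x ∷ v , v⊆ , subst (Iso p) (Listₚ.++-identityʳ (x ∷ v)) u≅)
... | x ∷ v , y ∷ v′ , refl , v⊆ , v′⊆ = ⊥-elim
  (ℕₚ.<-asym x<last (desc x (at v″ l) (⊆ₚ.Any-resp-⊆ v⊆ (here refl)) (⊆ₚ.Any-resp-⊆ v′⊆ last∈)))
  where
  v″ : List ℕ
  v″ = x ∷ v ++ y ∷ v′
  l≡ : l ≡ length (x ∷ v) ℕ.+ length v′
  l≡ = ℕₚ.suc-injective (trans (sym plen) (trans (sym (length≡ u≅))
    (trans (Listₚ.length-++ (x ∷ v)) (ℕₚ.+-suc (length (x ∷ v)) (length v′)))))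
  last∈ : at v″ l ∈ y ∷ v′
  last∈ = subst (_∈ y ∷ v′) (sym (trans (cong (at v″) l≡) (at-++ʳ (x ∷ v) (y ∷ v′) (length v′))))
    (at-∈ (y ∷ v′) (length v′) ℕₚ.≤-refl)
  x<last : x < at v″ l
  x<last = <ᵇ-true⁻ (trans (order≡ u≅ 0 l (subst (0 <_) (sym plen) (s≤s z≤n))
      (subst (l <_) (sym plen) ℕₚ.≤-refl)) (<ᵇ-true p0<pl))

snoc-cases : ∀ {l} i → i < suc l → i < l ⊎ i ≡ l
snoc-cases i (s≤s i≤l) = ℕₚ.m≤n⇒m<n∨m≡n i≤l

at-snoc-< : ∀ xs y i → i < length xs → at (xs ++ y ∷ []) i ≡ at xs i
at-snoc-< xs y = at-++ˡ xs (y ∷ [])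

Iso-snoc : ∀ {p u m M} → (∀ x → x ∈ p → x < M) → (∀ x → x ∈ u → x < m) →
  Iso p u → Iso (p ++ M ∷ []) (u ++ m ∷ [])
Iso-snoc {p} {u} {m} {M} p<M u<m (iso len rel) = iso
  (trans (length-snoc u m) (trans (cong suc len) (sym (length-snoc p M))))
  λ i j i< j< → cases i j (snoc-cases i (subst (i <_) (length-snoc p M) i<))
      (snoc-cases j (subst (j <_) (length-snoc p M) j<))
  where
  lenᵘ : ∀ {i} → i < length p → i < length u
  lenᵘ {i} = subst (i <_) (sym len)
  lastᵘ : at (u ++ m ∷ []) (length p) ≡ m
  lastᵘ = trans (cong (at (u ++ m ∷ [])) (sym len)) (at-last u m)
  cases : ∀ i j → i < length p ⊎ i ≡ length p → j < length p ⊎ j ≡ length p →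
    (at (u ++ m ∷ []) i <ᵇ at (u ++ m ∷ []) j) ≡ (at (p ++ M ∷ []) i <ᵇ at (p ++ M ∷ []) j)
  cases i j (inj₁ i<) (inj₁ j<)
    rewrite at-snoc-< p M i i< | at-snoc-< p M j j< | at-snoc-< u m i (lenᵘ i<)
        | at-snoc-< u m j (lenᵘ j<) = rel i j i< j<
  cases i _ (inj₁ i<) (inj₂ refl)
    rewrite at-snoc-< p M i i< | at-snoc-< u m i (lenᵘ i<) | lastᵘ | at-last p M =
    trans (<ᵇ-true (u<m _ (at-∈ u i (lenᵘ i<)))) (sym (<ᵇ-true (p<M _ (at-∈ p i i<))))
  cases _ j (inj₂ refl) (inj₁ j<)
    rewrite at-snoc-< p M j j< | at-snoc-< u m j (lenᵘ j<) | lastᵘ | at-last p M =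
    trans (<ᵇ-false (ℕₚ.<⇒≤ (u<m _ (at-∈ u j (lenᵘ j<))))) (sym (<ᵇ-false (ℕₚ.<⇒≤ (p<M _ (at-∈ p j j<)))))
  cases _ _ (inj₂ refl) (inj₂ refl) = trans (<ᵇ-false {at (u ++ m ∷ []) (length p)} ℕₚ.≤-refl)
      (sym (<ᵇ-false {at (p ++ M ∷ []) (length p)} ℕₚ.≤-refl))

Iso-unsnoc : ∀ {p u m M} → Iso (p ++ M ∷ []) (u ++ m ∷ []) → Iso p u
Iso-unsnoc {p} {u} {m} {M} (iso len rel) = iso len′ λ i j i< j< →
  trans (cong₂ _<ᵇ_ (sym (at-snoc-< u m i (subst (i <_) (sym len′) i<)))
      (sym (at-snoc-< u m j (subst (j <_) (sym len′) j<))))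
  (trans (rel i j (bound i<) (bound j<)) (cong₂ _<ᵇ_ (at-snoc-< p M i i<) (at-snoc-< p M j j<)))
  where
  len′ : length u ≡ length p
  len′ = ℕₚ.suc-injective (trans (sym (length-snoc u m)) (trans len (length-snoc p M)))
  bound : ∀ {i} → i < length p → i < length (p ++ M ∷ [])
  bound {i} i< = subst (i <_) (sym (length-snoc p M)) (ℕₚ.m≤n⇒m≤1+n i<)

unsnoc : ∀ {A : Set} (xs : List A) l → length xs ≡ suc l → ∃₂ λ ys y → xs ≡ ys ++ y ∷ []
unsnoc (x ∷ [])     l       eq = [] , x , refl
unsnoc (x ∷ y ∷ xs) (suc l) eq with unsnoc (y ∷ xs) l (ℕₚ.suc-injective eq)
... | ys , z , eq′ = x ∷ ys , z , cong (x ∷_) eq′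

contains-snoc : ∀ xs m {p M} → (∀ x → x ∈ xs → x < m) → (∀ x → x ∈ p → x < M) →
  Contains xs p → Contains (xs ++ m ∷ []) (p ++ M ∷ [])
contains-snoc xs m xs<m p<M (u , u⊆ , u≅) = u ++ m ∷ [] , ⊆ₚ.++⁺ u⊆ ⊆-refl ,
  Iso-snoc p<M (λ x x∈ → xs<m x (⊆ₚ.Any-resp-⊆ u⊆ x∈)) u≅

-- An occurrence that uses `m` ends in it and loses that letter; an occurrence inside `xs` loses its
-- own last letter. Either way the shortened pattern remains in `xs`.
contains-snoc⁻ : ∀ xs m {p M} → Contains (xs ++ m ∷ []) (p ++ M ∷ []) → Contains xs p
contains-snoc⁻ xs m {p} {M} (u , u⊆ , u≅) with ⊆-++⁻ xs u⊆
... | v , m ∷ []  , refl , v⊆ , _     = v , v⊆ , Iso-unsnoc u≅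
... | v , m ∷ _ ∷ _ , refl , v⊆ , (_ ∷ⁿ ())
... | v , m ∷ _ ∷ _ , refl , v⊆ , (_ ∷ ())
... | v , [] , refl , v⊆ , _ with unsnoc v (length p)
  (trans (cong length (sym (Listₚ.++-identityʳ v))) (trans (length≡ u≅) (length-snoc p M)))
... | v′ , y , refl = v′ , ⊆-trans (⊆ₚ.++⁺ʳ (y ∷ []) ⊆-refl) v⊆ , Iso-unsnoc {m = y}
  (subst (Iso (p ++ M ∷ [])) (Listₚ.++-identityʳ (v′ ++ y ∷ [])) u≅)

-- The last letter of the pattern lies below its letter at `i`, so `m`, which exceeds all of `xs`,
-- cannot play it.
contains-snoc-nonmax⁻ : ∀ xs m {p} l i → length p ≡ suc l → i < l → at p l < at p i → (∀ x → x ∈ xs → x < m) →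
  Contains (xs ++ m ∷ []) p → Contains xs p
contains-snoc-nonmax⁻ xs m {p} l i plen i<l pl<pi xs<m (u , u⊆ , u≅) with ⊆-++⁻ xs u⊆
... | v , []          , refl , v⊆ , _ = v , v⊆ , subst (Iso p) (Listₚ.++-identityʳ v) u≅
... | v , _ ∷ _ ∷ _ , refl , v⊆ , (_ ∷ⁿ ())
... | v , _ ∷ _ ∷ _ , refl , v⊆ , (_ ∷ ())
... | v , y ∷ []      , refl , v⊆ , (_ ∷ⁿ ())
... | v , .m ∷ []     , refl , v⊆ , (refl ∷ []) = ⊥-elim
  (ℕₚ.<-asym m<vi (xs<m (at v i) (⊆ₚ.Any-resp-⊆ v⊆ (at-∈ v i i<v))))
  where
  l≡ : l ≡ length v
  l≡ = ℕₚ.suc-injective (trans (sym plen) (trans (sym (length≡ u≅)) (length-snoc v m)))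
  i<v : i < length v
  i<v = subst (i <_) l≡ i<l
  m<vi : m < at v i
  m<vi = subst₂ _<_ (trans (cong (at (v ++ m ∷ [])) l≡) (at-last v m)) (at-snoc-< v m i i<v)
    (<ᵇ-true⁻ (trans (order≡ u≅ l i (subst (l <_) (sym plen) ℕₚ.≤-refl)
        (subst (i <_) (sym plen) (ℕₚ.m≤n⇒m≤1+n i<l))) (<ᵇ-true pl<pi)))

-- Words of trees

word : Tree → List ℕ
word leaf       = []
word (node a b) = map (size b ℕ.+_) (word a ++ size a ∷ []) ++ word b

length-word : ∀ t → length (word t) ≡ size t
length-word leaf       = refl
length-word (node a b)
  rewrite Listₚ.length-++ (map (size b ℕ.+_) (word a ++ size a ∷ [])) {word b}
        | Listₚ.length-map (size b ℕ.+_) (word a ++ size a ∷ [])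
        | length-snoc (word a) (size a) | length-word a | length-word b = refl

word-< : ∀ t v → v ∈ word t → v < size t
word-snoc-< : ∀ t v → v ∈ word t ++ size t ∷ [] → v < suc (size t)
word-snoc-< t v v∈ with ∈ₚ.∈-++⁻ (word t) v∈
... | inj₁ v∈ = ℕₚ.m≤n⇒m≤1+n (word-< t v v∈)
... | inj₂ (here refl) = ℕₚ.≤-refl
word-< (node a b) v v∈ with ∈ₚ.∈-++⁻ (map (size b ℕ.+_) (word a ++ size a ∷ [])) v∈
... | inj₂ v∈b = ℕₚ.≤-trans (word-< b v v∈b) (ℕₚ.≤-trans (ℕₚ.m≤n+m (size b) (size a)) (ℕₚ.n≤1+n _))
... | inj₁ v∈a with ∈ₚ.∈-map⁻ (size b ℕ.+_) v∈a
... | x , x∈ , refl = ℕₚ.≤-trans (ℕₚ.+-monoʳ-< (size b) (word-snoc-< a x x∈))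
  (ℕₚ.≤-reflexive (ℕₚ.+-comm (size b) (suc (size a))))

word-descending : ∀ a b x y → x ∈ map (size b ℕ.+_) (word a ++ size a ∷ []) → y ∈ word b → y < x
word-descending a b x y x∈ y∈ with ∈ₚ.∈-map⁻ (size b ℕ.+_) x∈
... | v , _ , refl = ℕₚ.≤-trans (word-< b y y∈) (ℕₚ.m≤m+n (size b) v)

word-unique : ∀ t → Unique (word t)
word-unique leaf       = []
word-unique (node a b) = Uniqueₚ.++⁺
  (Uniqueₚ.map⁺ (ℕₚ.+-cancelˡ-≡ (size b) _ _) (Uniqueₚ.++⁺ (word-unique a) ([] ∷ [])
    λ where (v∈ , here refl) → ℕₚ.<-irrefl refl (word-< a (size a) v∈)))
  (word-unique b)
  (λ (x∈ , y∈) → ℕₚ.<-irrefl refl (word-descending a b _ _ x∈ y∈))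

word-⊝ : ∀ t u → word (t ⊝ u) ≡ map (size u ℕ.+_) (word t) ++ word u
word-⊝ leaf       u = refl
word-⊝ (node a b) u = begin
  map (size (b ⊝ u) ℕ.+_) wa ++ word (b ⊝ u)
    ≡⟨ cong₂ _++_ (trans (Listₚ.map-cong shift-+ wa) (Listₚ.map-∘ wa)) (word-⊝ b u) ⟩
  map (size u ℕ.+_) (map (size b ℕ.+_) wa) ++ map (size u ℕ.+_) (word b) ++ word u
    ≡⟨ Listₚ.++-assoc (map (size u ℕ.+_) (map (size b ℕ.+_) wa)) _ _ ⟨
  (map (size u ℕ.+_) (map (size b ℕ.+_) wa) ++ map (size u ℕ.+_) (word b)) ++ word u
    ≡⟨ cong (_++ word u) (Listₚ.map-++ (size u ℕ.+_) (map (size b ℕ.+_) wa) (word b)) ⟨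
  map (size u ℕ.+_) (map (size b ℕ.+_) wa ++ word b) ++ word u ∎
  where
  open ≡-Reasoning
  wa : List ℕ
  wa = word a ++ size a ∷ []
  shift-+ : ∀ x → size (b ⊝ u) ℕ.+ x ≡ size u ℕ.+ (size b ℕ.+ x)
  shift-+ x rewrite size-⊝ b u = lemma (size b) (size u) x
    where
    lemma : ∀ b u x → b ℕ.+ u ℕ.+ x ≡ u ℕ.+ (b ℕ.+ x)
    lemma = solveℕ-∀

word-node-leaf : ∀ a → word (node a leaf) ≡ word a ++ size a ∷ []
word-node-leaf a = trans (Listₚ.++-identityʳ _) (Listₚ.map-id (word a ++ size a ∷ []))

word-transpose-node : ∀ a b → word (transpose (node a b)) ≡
  map (suc (size a) ℕ.+_) (word (transpose b)) ++ word (transpose a) ++ size a ∷ []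
word-transpose-node a b = trans (word-⊝ (transpose b) (node (transpose a) leaf))
  (cong₂ (λ n w → map (suc n ℕ.+_) (word (transpose b)) ++ w)
    (trans (ℕₚ.+-identityʳ _) (size-transpose a))
    (trans (word-node-leaf (transpose a)) (cong (λ n → word (transpose a) ++ n ∷ []) (size-transpose a))))

at-word-< : ∀ t i → i < size t → at (word t) i < size t
at-word-< t i i< = word-< t _ (at-∈ (word t) i (subst (i <_) (sym (length-word t)) i<))

-- The letters before the cut take the values from `size b` on, and these are the positions that
-- follow the raised block in the transposed word. Behind the cut the roles of the two blocks are
-- exchanged, so each case reduces to one subtree.
word-inverse : ∀ t i → i < size t → at (word (transpose t)) (at (word t) i) ≡ i
word-inverse-snoc : ∀ t i → i < suc (size t) →
  at (word (transpose t) ++ size t ∷ []) (at (word t ++ size t ∷ []) i) ≡ i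
word-inverse-snoc t i i< with snoc-cases i i<
... | inj₁ i<t rewrite at-snoc-< (word t) (size t) i (subst (i <_) (sym (length-word t)) i<t)
                     | at-snoc-< (word (transpose t)) (size t) (at (word t) i)
                         (subst (at (word t) i <_) (sym (trans (length-word (transpose t)) (size-transpose t)))
                             (at-word-< t i i<t)) =
  word-inverse t i i<t
... | inj₂ refl = trans
  (cong (at (word (transpose t) ++ size t ∷ []))
      (trans (cong (at (word t ++ size t ∷ [])) (sym (length-word t))) (at-last (word t) (size t))))
  (trans (cong (at (word (transpose t) ++ size t ∷ []))
      (sym (trans (length-word (transpose t)) (size-transpose t))))
         (at-last (word (transpose t)) (size t)))
word-inverse (node a b) i i< with i ℕ.<? suc (size a)
... | yes i<a = begin
  at (word (transpose (node a b))) (at (word (node a b)) i)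
    ≡⟨ cong₂ at (word-transpose-node a b) (trans (at-++ˡ (map (size b ℕ.+_) wa) (word b) i
         (subst (i <_) (sym (trans (Listₚ.length-map (size b ℕ.+_) wa) length-wa)) i<a))
         (at-map (size b ℕ.+_) wa i (subst (i <_) (sym length-wa) i<a))) ⟩
  at (map (suc (size a) ℕ.+_) wbᵗ ++ waᵗ) (size b ℕ.+ at wa i)
    ≡⟨ cong (λ l → at (map (suc (size a) ℕ.+_) wbᵗ ++ waᵗ) (l ℕ.+ at wa i)) length-wbᵗ ⟨
  at (map (suc (size a) ℕ.+_) wbᵗ ++ waᵗ) (length (map (suc (size a) ℕ.+_) wbᵗ) ℕ.+ at wa i)
    ≡⟨ at-++ʳ (map (suc (size a) ℕ.+_) wbᵗ) waᵗ (at wa i) ⟩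
  at waᵗ (at wa i)
    ≡⟨ word-inverse-snoc a i i<a ⟩
  i ∎
  where
  open ≡-Reasoning
  wa waᵗ wbᵗ : List ℕ
  wa  = word a ++ size a ∷ []
  waᵗ = word (transpose a) ++ size a ∷ []
  wbᵗ = word (transpose b)
  length-wa : length wa ≡ suc (size a)
  length-wa = trans (length-snoc (word a) (size a)) (cong suc (length-word a))
  length-wbᵗ : length (map (suc (size a) ℕ.+_) wbᵗ) ≡ size b
  length-wbᵗ = trans (Listₚ.length-map (suc (size a) ℕ.+_) wbᵗ)
      (trans (length-word (transpose b)) (size-transpose b))
-- A position behind the cut is written as `suc (size a)` plus a position `j` in the word of `b`.
... | no i≮a with i ∸ suc (size a) | ℕₚ.m+[n∸m]≡n (ℕₚ.≮⇒≥ i≮a)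
... | j | refl = begin
  at (word (transpose (node a b))) (at (word (node a b)) (suc (size a) ℕ.+ j))
    ≡⟨ cong₂ at (word-transpose-node a b) (trans
        (cong (λ l → at (map (size b ℕ.+_) wa ++ word b) (l ℕ.+ j)) (sym length-wa))
         (at-++ʳ (map (size b ℕ.+_) wa) (word b) j)) ⟩
  at (map (suc (size a) ℕ.+_) wbᵗ ++ waᵗ) (at (word b) j)
    ≡⟨ at-++ˡ (map (suc (size a) ℕ.+_) wbᵗ) waᵗ (at (word b) j)
        (subst (at (word b) j <_) (sym (trans (Listₚ.length-map (suc (size a) ℕ.+_) wbᵗ) length-wbᵗ)) bj<) ⟩
  at (map (suc (size a) ℕ.+_) wbᵗ) (at (word b) j)
    ≡⟨ at-map (suc (size a) ℕ.+_) wbᵗ (at (word b) j) (subst (at (word b) j <_) (sym length-wbᵗ) bj<) ⟩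
  suc (size a) ℕ.+ at wbᵗ (at (word b) j)
    ≡⟨ cong (suc (size a) ℕ.+_) (word-inverse b j j<b) ⟩
  suc (size a) ℕ.+ j ∎
  where
  open ≡-Reasoning
  wa waᵗ wbᵗ : List ℕ
  wa  = word a ++ size a ∷ []
  waᵗ = word (transpose a) ++ size a ∷ []
  wbᵗ = word (transpose b)
  length-wa : length (map (size b ℕ.+_) wa) ≡ suc (size a)
  length-wa = trans (Listₚ.length-map (size b ℕ.+_) wa)
      (trans (length-snoc (word a) (size a)) (cong suc (length-word a)))
  length-wbᵗ : length wbᵗ ≡ size b
  length-wbᵗ = trans (length-word (transpose b)) (size-transpose b)
  j<b : j < size b
  j<b = ℕₚ.+-cancelˡ-< (suc (size a)) j (size b) i<
  bj< : at (word b) j < size b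
  bj< = at-word-< b j j<b

-- All letters before `m` are smaller, so on both sides this is the first occurrence of `m`, and the
-- splits coincide.
∷ʳ-split-injective : ∀ {xs xs′ ys ys′ : List ℕ} {m} → (∀ x → x ∈ xs → x < m) → (∀ x → x ∈ xs′ → x < m) →
  xs ++ m ∷ ys ≡ xs′ ++ m ∷ ys′ → xs ≡ xs′ × ys ≡ ys′
∷ʳ-split-injective {[]}     {[]}      _  _   refl = refl , refl
∷ʳ-split-injective {[]}     {x ∷ xs′} _  xs′< eq  =
  ⊥-elim (ℕₚ.<-irrefl (sym (proj₁ (Listₚ.∷-injective eq))) (xs′< x (here refl)))
∷ʳ-split-injective {x ∷ xs} {[]}      xs< _  eq   =
  ⊥-elim (ℕₚ.<-irrefl (proj₁ (Listₚ.∷-injective eq)) (xs< x (here refl)))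
∷ʳ-split-injective {x ∷ xs} {y ∷ xs′} xs< xs′< eq with Listₚ.∷-injective eq
... | refl , eq′ with ∷ʳ-split-injective (λ z z∈ → xs< z (there z∈)) (λ z z∈ → xs′< z (there z∈)) eq′
... | refl , refl = refl , refl

word-split : ∀ a b → word (node a b) ≡ map (size b ℕ.+_) (word a) ++ (size b ℕ.+ size a) ∷ word b
word-split a b = trans (cong (_++ word b) (Listₚ.map-++ (size b ℕ.+_) (word a) (size a ∷ [])))
  (Listₚ.++-assoc (map (size b ℕ.+_) (word a)) ((size b ℕ.+ size a) ∷ []) (word b))

-- Equal lengths give equal maxima, and the maximum marks the cut. The right parts are compared
-- first: once `b` and `d` agree, both left parts are raised by the same amount, which can be
-- undone.
word-injective : ∀ t u → word t ≡ word u → t ≡ u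
word-injective leaf       leaf       _  = refl
word-injective leaf       (node c d) eq with trans (cong length eq) (length-word (node c d))
... | ()
word-injective (node a b) leaf       eq with trans (sym (length-word (node a b))) (cong length eq)
... | ()
word-injective (node a b) (node c d) eq
  with ∷ʳ-split-injective (below a b) (subst (λ m → ∀ x → x ∈ map (size d ℕ.+_) (word c) → x < m) (sym size≡)
      (below c d))
         (trans (sym (word-split a b)) (trans eq
             (trans (word-split c d) (cong (λ m → map (size d ℕ.+_) (word c) ++ m ∷ word d) (sym size≡)))))
  where
  below : ∀ a b x → x ∈ map (size b ℕ.+_) (word a) → x < size b ℕ.+ size a
  below a b x x∈ with ∈ₚ.∈-map⁻ (size b ℕ.+_) x∈
  ... | v , v∈ , refl = ℕₚ.+-monoʳ-< (size b) (word-< a v v∈)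
  size≡ : size b ℕ.+ size a ≡ size d ℕ.+ size c
  size≡ = trans (ℕₚ.+-comm (size b) (size a)) (trans
    (ℕₚ.suc-injective (trans (sym (length-word (node a b))) (trans (cong length eq) (length-word (node c d)))))
    (ℕₚ.+-comm (size c) (size d)))
... | eqa , eqb with word-injective b d eqb
... | refl = cong (λ t → node t b) (word-injective a c (Listₚ.map-injective (ℕₚ.+-cancelˡ-≡ (size b) _ _) eqa))

-- Involutions as fixed points of the transpose

isInvolution-true : ∀ w → (∀ i → i < length w → at w (at w i) ≡ i) → isInvolution w ≡ true
isInvolution-true w inv = all-true (upTo (length w)) (λ i i∈ → ≡ᵇ-true (inv i (∈ₚ.∈-upTo⁻ i∈)))

isInvolution-true⁻ : ∀ w → isInvolution w ≡ true → ∀ i → i < length w → at w (at w i) ≡ i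
isInvolution-true⁻ w eq i i< = ≡ᵇ-true⁻ (all-true⁻ eq i (∈ₚ.∈-upTo⁺ i<))

isInvolution-word : ∀ t → transpose t ≡ t → isInvolution (word t) ≡ true
isInvolution-word t eq = isInvolution-true (word t) λ i i< →
  trans (cong (λ u → at (word u) (at (word t) i)) (sym eq)) (word-inverse t i (subst (i <_) (length-word t) i<))

-- For the word w, writing i as w(w(i)) and applying the inverse word gives w(i); hence the two
-- words agree, and `word` is injective.
isInvolution-word⁻ : ∀ t → isInvolution (word t) ≡ true → transpose t ≡ t
isInvolution-word⁻ t eq = word-injective (transpose t) t
  (at-extensional (word (transpose t)) (word t) length≡′ λ i i< → step i
      (subst (i <_) (trans (length-word (transpose t)) (size-transpose t)) i<))
  where
  length≡′ : length (word (transpose t)) ≡ length (word t)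
  length≡′ = trans (length-word (transpose t)) (trans (size-transpose t) (sym (length-word t)))
  step : ∀ i → i < size t → at (word (transpose t)) i ≡ at (word t) i
  step i i< = trans (cong (at (word (transpose t)))
      (sym (isInvolution-true⁻ (word t) eq i (subst (i <_) (sym (length-word t)) i<))))
    (word-inverse t (at (word t) i) (at-word-< t i i<))

-- The patterns 2134⋯k and 132 in words of trees

p2134-suc : ∀ k → p2134 (suc (suc (suc k))) ≡ p2134 (suc (suc k)) ++ suc (suc k) ∷ []
p2134-suc k = cong (λ l → 1 ∷ 0 ∷ l) (trans (cong (map (2 ℕ.+_)) (sym (Listₚ.upTo-∷ʳ k)))
  (Listₚ.map-++ (2 ℕ.+_) (upTo k) _))

length-p2134 : ∀ k → length (p2134 (suc (suc k))) ≡ suc (suc k)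
length-p2134 k = cong (suc ∘ suc) (trans (Listₚ.length-map (2 ℕ.+_) (upTo k)) (Listₚ.length-upTo k))

p2134-< : ∀ k x → x ∈ p2134 (suc (suc k)) → x < suc (suc k)
p2134-< k .1 (here refl)         = s≤s (s≤s z≤n)
p2134-< k .0 (there (here refl)) = s≤s z≤n
p2134-< k x  (there (there x∈)) with ∈ₚ.∈-map⁻ (2 ℕ.+_) x∈
... | v , v∈ , refl = s≤s (s≤s (∈ₚ.∈-upTo⁻ v∈))

-- From length three on the pattern ends above its first letter, as `contains-skew⁻` demands. The
-- pattern 21 descends, hence the separate clauses for index zero.
p2134-ascends : ∀ k → at (p2134 (suc (suc (suc k)))) 0 < at (p2134 (suc (suc (suc k)))) (suc (suc k))
p2134-ascends k = subst (1 <_)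
  (sym (trans (cong₂ at (p2134-suc k) (sym (length-p2134 k))) (at-last (p2134 (suc (suc k))) (suc (suc k)))))
  (s≤s (s≤s z≤n))

¬Contains-[] : ∀ {p l} → length p ≡ suc l → ¬ Contains [] p
¬Contains-[] plen ([] , [] , iso len _) with trans len plen
... | ()

-- An occurrence cannot straddle the cut. In the left part both the word and the pattern end in
-- their maximum, and removing the two passes to the shorter pattern in `a`.
contains-node-suc⁻ : ∀ k a b → Contains (word (node a b)) (p2134 (suc (suc (suc k)))) →
  Contains (word a) (p2134 (suc (suc k))) ⊎ Contains (word b) (p2134 (suc (suc (suc k))))
contains-node-suc⁻ k a b c
  with contains-skew⁻ (map (size b ℕ.+_) (word a ++ size a ∷ [])) (word b) (suc (suc k)) (length-p2134 (suc k))
      (p2134-ascends k) (word-descending a b) c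
... | inj₂ c = inj₂ c
... | inj₁ c = inj₁ (contains-snoc⁻ (word a) (size a) (subst (Contains (word a ++ size a ∷ [])) (p2134-suc k)
                 (contains-shift⁻ (size b) (word a ++ size a ∷ []) c)))

avoidsᵗ-sound : ∀ k t → avoidsᵗ k t ≡ true → ¬ Contains (word t) (p2134 (suc (suc k)))
avoidsᵗ-sound k       leaf          _  c = ¬Contains-[] (length-p2134 k) c
avoidsᵗ-sound (suc k) (node a b)    eq c with ∧-true⁻ {avoidsᵗ k a} eq | contains-node-suc⁻ k a b c
... | eqa , eqb | inj₁ c = avoidsᵗ-sound k a eqa c
... | eqa , eqb | inj₂ c = avoidsᵗ-sound (suc k) b eqb c
-- The last letter of 21, at index 1, lies below the one at index 0, so the final maximum cannot
-- play it.
avoidsᵗ-sound zero    (node a leaf) eq c = avoidsᵗ-sound zero a (proj₁ (∧-true⁻ {avoidsᵗ 0 a} eq))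
  (contains-snoc-nonmax⁻ (word a) (size a) 1 0 refl (s≤s z≤n) (s≤s z≤n) (word-< a)
    (subst (λ w → Contains w (1 ∷ 0 ∷ [])) (word-node-leaf a) c))
avoidsᵗ-sound zero    (node a (node b c)) eq _ with trans (sym (Boolₚ.∧-zeroʳ (avoidsᵗ 0 a))) eq
... | ()

word-node-⊇ˡ : ∀ a b → map (size b ℕ.+_) (word a ++ size a ∷ []) ⊆ word (node a b)
word-node-⊇ˡ a b = ⊆ₚ.++⁺ʳ (word b) ⊆-refl

Iso-21 : ∀ {x y} → y < x → Iso (1 ∷ 0 ∷ []) (x ∷ y ∷ [])
Iso-21 {x} {y} y<x = iso refl order
  where
  order : ∀ i j → i < 2 → j < 2 → (at (x ∷ y ∷ []) i <ᵇ at (x ∷ y ∷ []) j)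
      ≡ (at (1 ∷ 0 ∷ []) i <ᵇ at (1 ∷ 0 ∷ []) j)
  order 0 0 _ _ = <ᵇ-false {x} ℕₚ.≤-refl
  order 0 1 _ _ = <ᵇ-false (ℕₚ.<⇒≤ y<x)
  order 1 0 _ _ = <ᵇ-true y<x
  order 1 1 _ _ = <ᵇ-false {y} ℕₚ.≤-refl
  order _ (suc (suc _)) _ (s≤s (s≤s ()))
  order (suc (suc _)) _ (s≤s (s≤s ())) _

avoidsᵗ-complete : ∀ k t → avoidsᵗ k t ≡ false → Contains (word t) (p2134 (suc (suc k)))
avoidsᵗ-complete (suc k) (node a b) eq with avoidsᵗ k a in eqa
... | false = contains-mono (word-node-⊇ˡ a b) (contains-shift (size b) (word a ++ size a ∷ [])
  (subst (Contains (word a ++ size a ∷ [])) (sym (p2134-suc k))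
      (contains-snoc (word a) (size a) (word-< a) (p2134-< k) (avoidsᵗ-complete k a eqa))))
... | true  = contains-mono (⊆ₚ.++⁺ˡ (map (size b ℕ.+_) (word a ++ size a ∷ [])) ⊆-refl)
  (avoidsᵗ-complete (suc k) b eq)
avoidsᵗ-complete zero (node a b) eq with avoidsᵗ 0 a in eqa
... | false = contains-mono (word-node-⊇ˡ a b) (contains-shift (size b) (word a ++ size a ∷ [])
  (contains-mono (⊆ₚ.++⁺ʳ (size a ∷ []) ⊆-refl) (avoidsᵗ-complete zero a eqa)))
avoidsᵗ-complete zero (node a (node c d)) eq | true with word (node c d) | length-word (node c d)
  | word-< (node c d)
-- The occurrence of 21 is the maximum of the first block followed by `x`, the first letter after
-- the cut.
... | x ∷ w | _ | w< = (size (node c d) ℕ.+ size a) ∷ x ∷ [] ,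
  subst (_ ⊆_) (sym (trans (cong (_++ (x ∷ w)) (Listₚ.map-++ (size (node c d) ℕ.+_) (word a) (size a ∷ [])))
      (Listₚ.++-assoc (map (size (node c d) ℕ.+_) (word a)) _ (x ∷ w))))
    (⊆ₚ.++⁺ˡ (map (size (node c d) ℕ.+_) (word a)) (refl ∷ refl ∷ minimum w)) ,
  Iso-21 x<
  where
  x< : x < size (node c d) ℕ.+ size a
  x< = ℕₚ.≤-trans (w< x (here refl)) (ℕₚ.m≤m+n _ _)

avoids-word-2134 : ∀ k t → avoids (word t) (p2134 (suc (suc k))) ≡ avoidsᵗ k t
avoids-word-2134 k t with contains (word t) (p2134 (suc (suc k))) in eqc | avoidsᵗ k t in eqa
... | true  | false = refl
... | false | true  = refl
... | true  | true  = ⊥-elim (avoidsᵗ-sound k t eqa (contains-true⁻ (word t) _ eqc))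
... | false | false with trans (sym eqc) (contains-true (word t) _ (avoidsᵗ-complete k t eqa))
... | ()

-- The pattern starts below its last letter and so cannot straddle the cut; its last letter, at
-- index 2, lies below the one at index 1 and so cannot be the maximum that ends the left part.
¬Contains-132 : ∀ t → ¬ Contains (word t) p132
¬Contains-132 leaf       c = ¬Contains-[] {p132} refl c
¬Contains-132 (node a b) c
  with contains-skew⁻ (map (size b ℕ.+_) (word a ++ size a ∷ [])) (word b) 2 refl (s≤s z≤n)
      (word-descending a b) c
... | inj₂ c = ¬Contains-132 b c
... | inj₁ c = ¬Contains-132 a (contains-snoc-nonmax⁻ (word a) (size a) 2 1 refl (s≤s (s≤s z≤n)) (s≤s (s≤s z≤n))
  (word-< a)
                 (contains-shift⁻ (size b) (word a ++ size a ∷ []) c))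

avoids-word-132 : ∀ t → avoids (word t) p132 ≡ true
avoids-word-132 t with contains (word t) p132 in eq
... | false = refl
... | true  = ⊥-elim (¬Contains-132 t (contains-true⁻ (word t) p132 eq))

-- Inversions of words

inversionsʷ : List ℕ → ℕ
inversionsʷ []       = 0
inversionsʷ (x ∷ xs) = count (_<ᵇ x) xs ℕ.+ inversionsʷ xs

map-at-upTo : ∀ xs → map (at xs) (upTo (length xs)) ≡ xs
map-at-upTo []       = refl
map-at-upTo (x ∷ xs) = trans (map-upTo-suc (at (x ∷ xs)) (length xs)) (cong (x ∷_) (map-at-upTo xs))

upTo-suc : ∀ n → upTo (suc n) ≡ 0 ∷ map suc (upTo n)
upTo-suc n = cong (0 ∷_) (sym (Listₚ.map-upTo suc n))

-- Row 0 compares `x` with all later letters; in every other row the column 0 fails the test on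
-- positions by computation and drops out.
numInversions-∷ : ∀ x xs → numInversions (x ∷ xs) ≡ count (_<ᵇ x) xs ℕ.+ numInversions xs
numInversions-∷ x xs = trans (cong sum (map-upTo-suc f n))
  (cong₂ ℕ._+_ first (cong sum (Listₚ.map-cong rest (upTo n))))
  where
  n : ℕ
  n = length xs
  f : ℕ → ℕ
  f i = count (λ j → (i <ᵇ j) ∧ (at (x ∷ xs) j <ᵇ at (x ∷ xs) i)) (upTo (suc n))
  first : f 0 ≡ count (_<ᵇ x) xs
  first = trans (cong (count (λ j → (0 <ᵇ j) ∧ (at (x ∷ xs) j <ᵇ x))) (upTo-suc n))
    (trans (count-map (λ j → (0 <ᵇ j) ∧ (at (x ∷ xs) j <ᵇ x)) suc (upTo n))
    (trans (sym (count-map (_<ᵇ x) (at xs) (upTo n))) (cong (count (_<ᵇ x)) (map-at-upTo xs))))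
  rest : ∀ i → f (suc i) ≡ count (λ j → (i <ᵇ j) ∧ (at xs j <ᵇ at xs i)) (upTo n)
  rest i = trans (cong (count (λ j → (suc i <ᵇ j) ∧ (at (x ∷ xs) j <ᵇ at xs i))) (upTo-suc n))
    (count-map (λ j → (suc i <ᵇ j) ∧ (at (x ∷ xs) j <ᵇ at xs i)) suc (upTo n))

numInversions≡ : ∀ xs → numInversions xs ≡ inversionsʷ xs
numInversions≡ []       = refl
numInversions≡ (x ∷ xs) = trans (numInversions-∷ x xs) (cong (count (_<ᵇ x) xs ℕ.+_) (numInversions≡ xs))

count-true : ∀ {A : Set} (xs : List A) → count (λ _ → true) xs ≡ length xs
count-true []       = refl
count-true (x ∷ xs) = cong suc (count-true xs)

inversionsʷ-++ : ∀ xs ys → (∀ x y → x ∈ xs → y ∈ ys → y < x) →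
  inversionsʷ (xs ++ ys) ≡ inversionsʷ xs ℕ.+ inversionsʷ ys ℕ.+ length xs ℕ.* length ys
inversionsʷ-++ []       ys _    = sym (ℕₚ.+-identityʳ _)
inversionsʷ-++ (x ∷ xs) ys desc
  rewrite count-++ (_<ᵇ x) xs ys | inversionsʷ-++ xs ys (λ x y x∈ y∈ → desc x y (there x∈) y∈)
        | trans (count-cong {p = _<ᵇ x} {λ _ → true} ys (λ y y∈ → <ᵇ-true (desc x y (here refl) y∈)))
            (count-true ys) =
  lemma (count (_<ᵇ x) xs) (length ys) (inversionsʷ xs) (inversionsʷ ys) (length xs ℕ.* length ys)
  where
  lemma : ∀ c l i j m → c ℕ.+ l ℕ.+ (i ℕ.+ j ℕ.+ m) ≡ c ℕ.+ i ℕ.+ j ℕ.+ (l ℕ.+ m)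
  lemma = solveℕ-∀

inversionsʷ-snoc : ∀ xs m → (∀ x → x ∈ xs → x < m) → inversionsʷ (xs ++ m ∷ []) ≡ inversionsʷ xs
inversionsʷ-snoc []       m _    = refl
inversionsʷ-snoc (x ∷ xs) m xs<m rewrite count-++ (_<ᵇ x) xs (m ∷ []) | <ᵇ-false (ℕₚ.<⇒≤ (xs<m x (here refl)))
  | ℕₚ.+-identityʳ (count (_<ᵇ x) xs) = cong (count (_<ᵇ x) xs ℕ.+_)
      (inversionsʷ-snoc xs m (λ y y∈ → xs<m y (there y∈)))

inversionsʷ-shift : ∀ c xs → inversionsʷ (map (c ℕ.+_) xs) ≡ inversionsʷ xs
inversionsʷ-shift c []       = refl
inversionsʷ-shift c (x ∷ xs) = cong₂ ℕ._+_
  (trans (count-map (_<ᵇ c ℕ.+ x) (c ℕ.+_) xs) (count-cong xs (λ y _ → <ᵇ-+ c y x))) (inversionsʷ-shift c xs)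

inversionsʷ-word : ∀ t → inversionsʷ (word t) ≡ inversions t
inversionsʷ-word leaf       = refl
inversionsʷ-word (node a b)
  rewrite inversionsʷ-++ (map (size b ℕ.+_) (word a ++ size a ∷ [])) (word b) (word-descending a b)
        | inversionsʷ-shift (size b) (word a ++ size a ∷ [])
        | inversionsʷ-snoc (word a) (size a) (word-< a) | inversionsʷ-word a | inversionsʷ-word b
        | Listₚ.length-map (size b ℕ.+_) (word a ++ size a ∷ [])
        | length-snoc (word a) (size a) | length-word a | length-word b = refl

numInversions-word : ∀ t → numInversions (word t) ≡ inversions t
numInversions-word t = trans (numInversions≡ (word t)) (inversionsʷ-word t)

-- Pigeonhole arguments

remove-∈ : ∀ {A : Set} (ys : List A) {x z zs} → z ∈ ys ++ x ∷ zs → x ≢ z → z ∈ ys ++ zs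
remove-∈ []       (here refl) x≢z = ⊥-elim (x≢z refl)
remove-∈ []       (there z∈)  _   = z∈
remove-∈ (y ∷ ys) (here refl) _   = here refl
remove-∈ (y ∷ ys) (there z∈)  x≢z = there (remove-∈ ys z∈ x≢z)

length-remove : ∀ {A : Set} (ys : List A) x zs → length (ys ++ x ∷ zs) ≡ suc (length (ys ++ zs))
length-remove []       x zs = refl
length-remove (y ∷ ys) x zs = cong suc (length-remove ys x zs)

-- Each counted element uses up its own image in `zs`: once that is removed, the images of the later
-- elements are still there, since `g` is injective and `xs` has no repetition.
count-≤-length : ∀ {A C : Set} (p : A → Bool) (g : A → C) → (∀ {x y} → g x ≡ g y → x ≡ y) →
  ∀ xs zs → Unique xs → (∀ x → x ∈ xs → p x ≡ true → g x ∈ zs) → count p xs ≤ length zs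
count-≤-length p g inj []       zs _       _    = z≤n
count-≤-length p g inj (x ∷ xs) zs (x∉ ∷ u) sub with p x in px
... | false = count-≤-length p g inj xs zs u (λ y y∈ → sub y (there y∈))
... | true with ∈ₚ.∈-∃++ (sub x (here refl) px)
... | ys , ys′ , refl = ℕₚ.≤-trans
  (s≤s (count-≤-length p g inj xs (ys ++ ys′) u
      (λ y y∈ py → remove-∈ ys (sub y (there y∈) py) (λ eq → All.lookup x∉ y∈ (inj eq)))))
  (ℕₚ.≤-reflexive (sym (length-remove ys (g x) ys′)))

Unique-⊆-length : ∀ {A : Set} {xs zs : List A} → Unique xs → (∀ x → x ∈ xs → x ∈ zs) → length xs ≤ length zs
Unique-⊆-length {xs = xs} {zs} u sub = subst (_≤ length zs) (count-true xs)
  (count-≤-length (λ _ → true) id id xs zs u (λ x x∈ _ → sub x x∈))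

Unique-<-length : ∀ {n xs} → Unique xs → (∀ x → x ∈ xs → x < n) → length xs ≤ n
Unique-<-length {n} {xs} u xs<n = subst (length xs ≤_) (Listₚ.length-upTo n)
  (Unique-⊆-length u (λ x x∈ → ∈ₚ.∈-upTo⁺ (xs<n x x∈)))

select : ∀ {A : Set} → (A → Bool) → List A → List A
select p []       = []
select p (x ∷ xs) = if p x then x ∷ select p xs else select p xs

length-select : ∀ {A : Set} (p : A → Bool) xs → length (select p xs) ≡ count p xs
length-select p []       = refl
length-select p (x ∷ xs) with p x
... | true  = cong suc (length-select p xs)
... | false = length-select p xs

∈-select : ∀ {A : Set} (p : A → Bool) {xs x} → x ∈ xs → p x ≡ true → x ∈ select p xs
∈-select p {y ∷ ys} (here refl) eq rewrite eq = here refl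
∈-select p {y ∷ ys} (there x∈)  eq with p y
... | true  = there (∈-select p x∈ eq)
... | false = ∈-select p x∈ eq

-- Two pigeonhole bounds: the selected part of `xs` lies in the image of the selected part of `ys`,
-- and `f` maps the latter injectively into the former.
count-bijection : ∀ {A B : Set} {p : A → Bool} {q : B → Bool} (f : B → A) → (∀ {x y} → f x ≡ f y → x ≡ y) →
  ∀ {xs ys} → Unique xs → Unique ys →
  (∀ y → y ∈ ys → q y ≡ true → f y ∈ xs × p (f y) ≡ true) →
  (∀ x → x ∈ xs → p x ≡ true → ∃ λ y → y ∈ ys × q y ≡ true × f y ≡ x) →
  count p xs ≡ count q ys
count-bijection {p = p} {q} f inj {xs} {ys} uxs uys into onto = ℕₚ.≤-antisym
  (subst (count p xs ≤_) (trans (Listₚ.length-map f (select q ys)) (length-select q ys))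
    (count-≤-length p id id xs (map f (select q ys)) uxs λ x x∈ px → image (onto x x∈ px)))
  (subst (count q ys ≤_) (length-select p xs)
    (count-≤-length q f inj ys (select p xs) uys λ y y∈ qy → ∈-select p (proj₁ (into y y∈ qy))
        (proj₂ (into y y∈ qy))))
  where
  image : ∀ {x} → (∃ λ y → y ∈ ys × q y ≡ true × f y ≡ x) → x ∈ map f (select q ys)
  image (y , y∈ , qy , refl) = ∈ₚ.∈-map⁺ f (∈-select q y∈ qy)

-- A missing `v` could be prepended, giving n + 1 distinct letters below `n`.
Unique-full : ∀ {n xs} → Unique xs → (∀ x → x ∈ xs → x < n) → length xs ≡ n → ∀ v → v < n → v ∈ xs
Unique-full {n} {xs} u xs<n len v v<n with v ∈? xs
... | yes v∈ = v∈
... | no  v∉ = ⊥-elim (ℕₚ.<-irrefl len (Unique-<-length {xs = v ∷ xs} (Allₚ.¬Any⇒All¬ xs v∉ ∷ u)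
  λ where .v (here refl) → v<n
          x (there x∈) → xs<n x x∈))

-- If a letter occurred again later, its earlier copy could be dropped, and a list shorter than `zs`
-- would still cover `zs`.
full-Unique : ∀ {A : Set} {zs ws : List A} → Unique zs → (∀ z → z ∈ zs → z ∈ ws) → length ws ≡ length zs →
  Unique ws
full-Unique {zs = zs} {ws} u sub len = go [] ws refl
  where
  fresh : ∀ pre w post → pre ++ w ∷ post ≡ ws → w ∉ post
  fresh pre w post refl w∈ = ℕₚ.<-irrefl refl (ℕₚ.≤-trans
    (ℕₚ.≤-reflexive (trans (sym (length-remove pre w post)) len))
    (Unique-⊆-length u (λ z z∈ → drop pre (sub z z∈))))
    where
    drop : ∀ pre {z} → z ∈ pre ++ w ∷ post → z ∈ pre ++ post
    drop []        (here refl) = w∈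
    drop []        (there z∈)  = z∈
    drop (y ∷ pre) (here refl) = here refl
    drop (y ∷ pre) (there z∈)  = there (drop pre z∈)
  go : ∀ pre post → pre ++ post ≡ ws → Unique post
  go pre []         _  = []
  go pre (w ∷ post) eq = Allₚ.¬Any⇒All¬ post (fresh pre w post eq) ∷
    go (pre ++ w ∷ []) post (trans (Listₚ.++-assoc pre (w ∷ []) post) eq)

-- Every 132-avoiding permutation is the word of a tree

record IsPermutation (n : ℕ) (w : List ℕ) : Set where
  constructor permutation
  field
    length-≡ : length w ≡ n
    bounded  : ∀ x → x ∈ w → x < n
    unique   : Unique w
open IsPermutation

Avoids132 : List ℕ → Set
Avoids132 w = ∀ x y z → x ∷ y ∷ z ∷ [] ⊆ w → x < z → z < y → ⊥

unshift : ∀ c xs → (∀ x → x ∈ xs → c ≤ x) → ∃ λ ys → xs ≡ map (c ℕ.+_) ys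
unshift c []       _    = [] , refl
unshift c (x ∷ xs) c≤xs with unshift c xs (λ y y∈ → c≤xs y (there y∈))
... | ys , refl = x ∸ c ∷ ys , cong (_∷ map (c ℕ.+_) ys) (sym (ℕₚ.m+[n∸m]≡n (c≤xs x (here refl))))

-- Below a letter of `xs` lie all the distinct letters of `ys`, which bounds it from below. Above a
-- letter y of `ys` lie all of `xs`, within the n - y - 1 values left there, which bounds y from
-- above.
descending-bounds : ∀ {n} xs ys → length xs ℕ.+ length ys ≡ n → Unique xs → Unique ys →
  (∀ x → x ∈ xs → x < n) → (∀ y → y ∈ ys → y < n) → (∀ x y → x ∈ xs → y ∈ ys → y < x) →
  (∀ x → x ∈ xs → length ys ≤ x) × (∀ y → y ∈ ys → y < length ys)
descending-bounds {n} xs ys len uxs uys xs<n ys<n desc = lower , upper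
  where
  lower : ∀ x → x ∈ xs → length ys ≤ x
  lower x x∈ = Unique-<-length uys (λ y y∈ → desc x y x∈ y∈)
  upper : ∀ y → y ∈ ys → y < length ys
  upper y y∈ with unshift (suc y) xs (λ x x∈ → desc x y x∈ y∈)
  ... | zs , eq = ℕₚ.+-cancelˡ-≤ (length xs) (suc y) (length ys) (ℕₚ.≤-trans
    (ℕₚ.+-monoˡ-≤ (suc y) (ℕₚ.≤-trans (ℕₚ.≤-reflexive
        (trans (cong length eq) (Listₚ.length-map (suc y ℕ.+_) zs)))
      (Unique-<-length (Uniqueₚ.map⁻ {f = suc y ℕ.+_} (subst Unique eq uxs)) zs<)))
    (ℕₚ.≤-reflexive (trans (ℕₚ.m∸n+n≡m (ys<n y y∈)) (sym len))))
    where
    zs< : ∀ z → z ∈ zs → z < n ∸ suc y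
    zs< z z∈ = ℕₚ.+-cancelˡ-< (suc y) z (n ∸ suc y) (subst (suc y ℕ.+ z <_) (sym (ℕₚ.m+[n∸m]≡n (ys<n y y∈)))
      (xs<n (suc y ℕ.+ z) (subst (suc y ℕ.+ z ∈_) (sym eq) (∈ₚ.∈-map⁺ (suc y ℕ.+_) z∈))))

Unique-++⁻ : ∀ {A : Set} (xs : List A) {ys} → Unique (xs ++ ys) →
  Unique xs × Unique ys × (∀ x → x ∈ xs → x ∉ ys)
Unique-++⁻ []       u        = [] , u , λ _ ()
Unique-++⁻ (x ∷ xs) (x∉ ∷ u) with Unique-++⁻ xs u
... | uxs , uys , dis = Allₚ.++⁻ˡ xs x∉ ∷ uxs , uys , λ where
  .x (here refl) x∈ys → All.lookup (Allₚ.++⁻ʳ xs x∉) x∈ys refl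
  y (there y∈) → dis y y∈

∈⇒⊆ : ∀ {x : ℕ} {xs} → x ∈ xs → x ∷ [] ⊆ xs
∈⇒⊆ {xs = y ∷ xs} (here refl) = refl ∷ minimum xs
∈⇒⊆ {xs = y ∷ xs} (there x∈)  = y ∷ⁿ ∈⇒⊆ x∈

-- The maximum cuts the word, and the bounds make each side a permutation again, the left one after
-- lowering by `length ys`. Fuel drives the induction, as the sides are not subterms.
word-surjective : ∀ f n w → n ≤ f → IsPermutation n w → Avoids132 w → ∃ λ t → word t ≡ w
word-surjective f       zero    []  _       _ _ = leaf , refl
word-surjective (suc f) (suc n) w (s≤s n≤f) (permutation len w<n u) av
  with ∈ₚ.∈-∃++ (Unique-full u w<n len n ℕₚ.≤-refl)
... | xs , ys , refl with Unique-++⁻ xs u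
... | uxs , (n∉ys ∷ uys) , dis = body
  where
  len′ : length xs ℕ.+ length ys ≡ n
  len′ = ℕₚ.suc-injective (trans (sym (ℕₚ.+-suc (length xs) (length ys)))
      (trans (sym (Listₚ.length-++ xs)) len))
  xs<n : ∀ x → x ∈ xs → x < n
  xs<n x x∈ = ℕₚ.≤∧≢⇒< (ℕₚ.≤-pred (w<n x (∈ₚ.∈-++⁺ˡ x∈))) (λ where refl → dis x x∈ (here refl))
  ys<n : ∀ y → y ∈ ys → y < n
  ys<n y y∈ = ℕₚ.≤∧≢⇒< (ℕₚ.≤-pred (w<n y (∈ₚ.∈-++⁺ʳ xs (there y∈)))) (λ eq → All.lookup n∉ys y∈ (sym eq))
  desc : ∀ x y → x ∈ xs → y ∈ ys → y < x
  -- If x < y, the letters x, n, y would form 132 with the maximum in the middle.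
  desc x y x∈ y∈ = ℕₚ.≤∧≢⇒< (ℕₚ.≮⇒≥ λ x<y → av x n y (⊆ₚ.++⁺ (∈⇒⊆ x∈) (refl ∷ ∈⇒⊆ y∈)) x<y (ys<n y y∈))
    (λ where refl → dis x x∈ (there y∈))
  bounds : (∀ x → x ∈ xs → length ys ≤ x) × (∀ y → y ∈ ys → y < length ys)
  bounds = descending-bounds xs ys len′ uxs uys xs<n ys<n desc
  body : ∃ λ t → word t ≡ xs ++ n ∷ ys
  body with unshift (length ys) xs (proj₁ bounds)
  ... | zs , refl
    with word-surjective f (length zs) zs
           (ℕₚ.≤-trans (ℕₚ.≤-trans (ℕₚ.≤-reflexive (sym (Listₚ.length-map (length ys ℕ.+_) zs)))
               (ℕₚ.m+n≤o⇒m≤o _ (ℕₚ.≤-reflexive len′))) n≤f)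
           (permutation refl
             (λ z z∈ → ℕₚ.+-cancelˡ-< (length ys) z (length zs) (subst (length ys ℕ.+ z <_)
               (trans (sym len′) (trans (ℕₚ.+-comm _ (length ys))
                   (cong (length ys ℕ.+_) (Listₚ.length-map (length ys ℕ.+_) zs))))
               (xs<n _ (∈ₚ.∈-map⁺ (length ys ℕ.+_) z∈))))
             (Uniqueₚ.map⁻ {f = length ys ℕ.+_} uxs))
           (λ x y z sub x<z z<y → av _ _ _ (⊆ₚ.++⁺ʳ (n ∷ ys) (⊆ₚ.map⁺ (length ys ℕ.+_) sub))
             (ℕₚ.+-monoʳ-< (length ys) x<z) (ℕₚ.+-monoʳ-< (length ys) z<y))
       | word-surjective f (length ys) ys (ℕₚ.≤-trans (ℕₚ.m+n≤o⇒n≤o _ (ℕₚ.≤-reflexive len′)) n≤f)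
           (permutation refl (proj₂ bounds) uys)
           (λ x y z sub → av x y z (⊆ₚ.++⁺ˡ xs (n ∷ⁿ sub)))
  ... | a , refl | b , refl = node a b , trans (word-split a b)
    (cong₂ (λ l m → map (l ℕ.+_) (word a) ++ m ∷ word b) (sym (length-word b))
      (trans (cong₂ ℕ._+_ (sym (length-word b)) (sym (length-word a)))
          (trans (ℕₚ.+-comm (length (word b)) (length (word a)))
        (trans (cong (ℕ._+ length (word b)) (sym (Listₚ.length-map (length (word b) ℕ.+_) (word a)))) len′))))

-- Transfer of the count to palindromes

allWords-sound : ∀ m n {w} → w ∈ allWords m n → length w ≡ n × (∀ x → x ∈ w → x < m)
allWords-sound m zero    (here refl) = refl , λ _ ()
allWords-sound m (suc n) w∈ with ∈-concatMap-upTo⁻ m w∈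
... | a , a<m , w∈a with ∈ₚ.∈-map⁻ (a ∷_) w∈a
... | v , v∈ , refl with allWords-sound m n v∈
... | len , v<m = cong suc len , λ where
  .a (here refl) → a<m
  x  (there x∈)  → v<m x x∈

allWords-complete : ∀ m w → (∀ x → x ∈ w → x < m) → w ∈ allWords m (length w)
allWords-complete m []      _   = here refl
allWords-complete m (a ∷ w) w<m = ∈-concatMap-upTo⁺ (λ a → map (a ∷_) (allWords m (length w))) a
  (w<m a (here refl))
  (∈ₚ.∈-map⁺ (a ∷_) (allWords-complete m w (λ x x∈ → w<m x (there x∈))))

allWords-unique : ∀ m n → Unique (allWords m n)
allWords-unique m zero    = [] ∷ []
allWords-unique m (suc n) = concatMap-unique (λ a → map (a ∷_) (allWords m n)) (λ w → at w 0) (upTo m)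
  (Uniqueₚ.upTo⁺ m)
  (λ a → Uniqueₚ.map⁺ Listₚ.∷-injectiveʳ (allWords-unique m n)) key
  where
  key : ∀ a w → a ∈ upTo m → w ∈ map (a ∷_) (allWords m n) → at w 0 ≡ a
  key a w _ w∈ with ∈ₚ.∈-map⁻ (a ∷_) w∈
  ... | _ , _ , refl = refl

perms-unique : ∀ n → Unique (perms n)
perms-unique n = Uniqueₚ.filter⁺ _ (allWords-unique n n)

isPerm-sound : ∀ n w → isPerm n w ≡ true → ∀ v → v < n → v ∈ w
isPerm-sound n w eq v v<n with any-true⁻ (v ≡ᵇ_) w (all-true⁻ eq v (∈ₚ.∈-upTo⁺ v<n))
... | x , x∈ , v≡x rewrite ≡ᵇ-true⁻ {v} {x} v≡x = x∈

isPerm-complete : ∀ n w → (∀ v → v < n → v ∈ w) → isPerm n w ≡ true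
isPerm-complete n w full = all-true (upTo n) λ v v∈ → any-true v (full v (∈ₚ.∈-upTo⁻ v∈)) (≡ᵇ-true {v} refl)

-- The test `isPerm` demands only that every value occurs; the absence of repetitions follows from
-- the length by pigeonhole.
perms-sound : ∀ n {w} → w ∈ perms n → IsPermutation n w
perms-sound n {w} w∈ with ∈ₚ.∈-filter⁻ (T? ∘ isPerm n) {xs = allWords n n} w∈
... | w∈all , perm with allWords-sound n n w∈all
... | len , w<n = permutation len w<n (full-Unique (Uniqueₚ.upTo⁺ n)
  (λ v v∈ → isPerm-sound n w (T-true perm) v (∈ₚ.∈-upTo⁻ v∈)) (trans len (sym (Listₚ.length-upTo n))))
  where
  T-true : ∀ {b} → T b → b ≡ true
  T-true {true} _ = refl

perms-complete : ∀ n {w} → IsPermutation n w → w ∈ perms n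
perms-complete n {w} (permutation len w<n u) = ∈ₚ.∈-filter⁺ (T? ∘ isPerm n)
  (subst (λ l → w ∈ allWords n l) len (allWords-complete n w w<n))
  (subst T (sym (isPerm-complete n w (Unique-full u w<n len))) tt)

Iso-132 : ∀ {x y z} → x < z → z < y → Iso p132 (x ∷ y ∷ z ∷ [])
Iso-132 {x} {y} {z} x<z z<y = iso refl order
  where
  order : ∀ i j → i < 3 → j < 3 → (at (x ∷ y ∷ z ∷ []) i <ᵇ at (x ∷ y ∷ z ∷ []) j) ≡ (at p132 i <ᵇ at p132 j)
  order 0 0 _ _ = <ᵇ-false {x} ℕₚ.≤-refl
  order 0 1 _ _ = <ᵇ-true (ℕₚ.<-trans x<z z<y)
  order 0 2 _ _ = <ᵇ-true x<z
  order 1 0 _ _ = <ᵇ-false (ℕₚ.<⇒≤ (ℕₚ.<-trans x<z z<y))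
  order 1 1 _ _ = <ᵇ-false {y} ℕₚ.≤-refl
  order 1 2 _ _ = <ᵇ-false (ℕₚ.<⇒≤ z<y)
  order 2 0 _ _ = <ᵇ-false (ℕₚ.<⇒≤ x<z)
  order 2 1 _ _ = <ᵇ-true z<y
  order 2 2 _ _ = <ᵇ-false {z} ℕₚ.≤-refl
  order _ (suc (suc (suc _))) _ (s≤s (s≤s (s≤s ())))
  order (suc (suc (suc _))) _ (s≤s (s≤s (s≤s ()))) _

avoids-132-sound : ∀ w → avoids w p132 ≡ true → Avoids132 w
avoids-132-sound w eq x y z sub x<z z<y with trans (sym eq)
  (cong not (contains-true w p132 (_ , sub , Iso-132 x<z z<y)))
... | ()

word-permutation : ∀ t → IsPermutation (size t) (word t)
word-permutation t = permutation (length-word t) (word-< t) (word-unique t)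

evenAvoider : ℕ → List ℕ → Bool
evenAvoider k π = isInvolution π ∧ isEven (numInversions π) ∧ avoids π p132 ∧ avoids π (p2134 (suc (suc k)))

evenAvoider-word : ∀ k t → transpose t ≡ t → evenAvoider k (word t) ≡ avoidsᵗ k t ∧ isEven (inversions t)
evenAvoider-word k t eq rewrite isInvolution-word t eq | numInversions-word t | avoids-word-132 t
  | avoids-word-2134 k t =
  Boolₚ.∧-comm (isEven (inversions t)) (avoidsᵗ k t)

-- Avoiding 132 yields a tree, being an involution makes the tree fixed under `transpose` and hence
-- a palindrome, and the length of the word gives its size.
evenAvoider⇒word : ∀ k n w → w ∈ perms n → evenAvoider k w ≡ true → ∃ λ m →
  m ∈ palindromes n n × word (toTree m) ≡ w
evenAvoider⇒word k n w w∈ eq with ∧-true⁻ {isInvolution w} eq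
... | inv , eq′ with ∧-true⁻ {isEven (numInversions w)} eq′
... | _ , eq″ with word-surjective n n w ℕₚ.≤-refl (perms-sound n w∈)
  (avoids-132-sound w (proj₁ (∧-true⁻ {avoids w p132} eq″)))
... | t , refl with toTree-surjective (size t) t ℕₚ.≤-refl (isInvolution-word⁻ t inv)
... | m , refl with trans (sym (length-word (toTree m))) (length-≡ (perms-sound n w∈))
... | refl = m , palindromes-complete n m ℕₚ.≤-refl , refl

Ie-palindromes : ∀ k n → Ie (p2134 (suc (suc k))) n ≡ count (avoidsEven k) (palindromes n n)
Ie-palindromes k n = count-bijection {p = evenAvoider k} {avoidsEven k} (word ∘ toTree)
  (λ {m} {m′} eq → toTree-injective m m′ (word-injective (toTree m) (toTree m′) eq))
  (perms-unique n) (palindromes-unique n n) into onto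
  where
  into : ∀ m → m ∈ palindromes n n → avoidsEven k m ≡ true →
      word (toTree m) ∈ perms n × evenAvoider k (word (toTree m)) ≡ true
  into m m∈ eq = subst (λ n → word (toTree m) ∈ perms n) (palindromes-size n n m m∈)
      (perms-complete _ (word-permutation (toTree m))) ,
    trans (evenAvoider-word k (toTree m) (transpose-toTree m)) eq
  onto : ∀ w → w ∈ perms n → evenAvoider k w ≡ true → ∃ λ m → m ∈ palindromes n n × avoidsEven k m
      ≡ true × word (toTree m) ≡ w
  onto w w∈ eq with evenAvoider⇒word k n w w∈ eq
  ... | m , m∈ , refl = m , m∈ , trans (sym (evenAvoider-word k (toTree m) (transpose-toTree m))) eq , refl

theorem3p7 : (k : ℕ) → 2 ≤ k → (n : ℕ) → + Ie (p2134 k) n ≡ rhs k n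
theorem3p7 (suc (suc k)) (s≤s (s≤s z≤n)) n = trans (cong +_ (Ie-palindromes k n))
  (count-avoidsEven k n n ℕₚ.≤-refl)
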